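{- Let $N \geq 2$ be an integer. Then there exist positive integers $a$ and $b$ such that $N = a+b$ and $\Omega(ab) \leq 21$.
   Context: $\Omega(n)$ denotes the number of prime factors of $n$ counted with multiplicity. -}

module Defs where

open import Data.Nat.Base using (ℕ; NonZero)
open import Data.List.Base using (length)
open import Data.Nat.Primality.Factorisation using (factorise; factors)

Ω : (n : ℕ) → .{{NonZero n}} → ℕ
Ω n = length (factors (factorise n))

{-# OPTIONS --safe #-}
module Submission where

-- Average Ω(n) + Ω(N - n) over 0 < n < N against a non-negative sieve weight θ(n): if the mean is below 22, then some n
-- has Ω(n (N - n)) ≤ 21. The weight is a product, over blocks [2^(w 2^i), 2^(w 2^(i+1))) of primes with i < I, of Brun's
-- inclusion-exclusion for n (N - n) cut after an even number of terms, later on the lower blocks. It involves only small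
-- moduli, so its sums over residue classes are known up to a small error. When a prime p of a block divides n (N - n), the
-- cut sum over that block collapses to a single elementary symmetric function e_2r, of mean at most 3^2r / (2r)!; hence the
-- sieving primes contribute little to the mean of Ω. The other primes enter through
--   z Ω(n) ≤ log₂ n + Σ_{p < 2^z} (z - log₂ p) v_p(n),
-- whose right-hand side is bounded by Chebyshev's estimate that [2^k, 2^(k+1)) contains at most 2^(k+1) / k primes.
-- With a = w 2^I, 6 ≤ w ≤ 11, 2^(45 a) ≤ N < 2^(45 (w+1) 2^I) and z = 15 a, the mean of each of Ω(n), Ω(N - n) is below 11.
-- Smaller N need no sieve, and for N < 2^22 the split 1 + (N - 1) will do.

open import Defs
open import Data.List.Base using (List; []; _∷_; _++_; length; map; filter; downFrom)
open import Data.List.Membership.Propositional using (_∈_; _∉_)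
open import Data.List.Membership.Propositional.Properties
  using (∈-++⁺ˡ; ∈-++⁺ʳ; ∈-++⁻; ∈-∃++; ∈-map⁺; ∈-map⁻; ∈-filter⁺; ∈-filter⁻; ∈-downFrom⁺; ∈-downFrom⁻)
open import Data.List.Properties using (length-++; length-map; length-filter; length-downFrom)
open import Data.List.Relation.Binary.Permutation.Propositional.Properties using (↭-length)
open import Data.List.Relation.Unary.All as All using (All; []; _∷_)
import Data.List.Relation.Unary.All.Properties as All
open import Data.List.Relation.Unary.Any using (here; there)
open import Data.List.Relation.Unary.AllPairs using ([]; _∷_)
open import Data.List.Relation.Unary.Unique.Propositional using (Unique)
import Data.List.Relation.Unary.Unique.Propositional.Properties as Unique
open import Data.Nat.Base
open import Data.Nat.Coprimality as Coprimality using (Coprime; coprime-Bézout; coprime-divisor)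
open import Data.Nat.Combinatorics
  using (_C_; nCk+nC[k+1]≡[n+1]C[k+1]; nCk≡nC[n∸k]; nCn≡1; nCk≡n!/k![n-k]!; k![n∸k]!∣n!)
open import Data.Nat.DivMod using (m%n<n; m≡m%n+[m/n]*n; m/n*n≡m)
open import Data.Nat.Divisibility
open import Data.Nat.GCD using (module Bézout)
open import Data.Nat.ListAction using (product)
open import Data.Nat.ListAction.Properties using (product-++)
open import Data.Nat.Primality
open import Data.Nat.Primality.Factorisation
open import Data.Nat.Properties
import Data.Nat.Tactic.RingSolver as ℕ-Solver
open import Data.Product using (∃; ∃₂; _×_; _,_; proj₁; proj₂)
open import Data.Rational.Base using (ℚ; 0ℚ; 1ℚ; 1/_)
  renaming (_+_ to _⊕_; _*_ to _⊗_; _-_ to _⊖_; _≤_ to _≼_; _<_ to _≺_; -_ to ⊖_)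
import Data.Rational.Base as ℚ
import Data.Rational.Properties as ℚ
open import Data.Sum using (_⊎_; inj₁; inj₂)
open import Function.Base using (_∘_; id)
open import Relation.Binary.PropositionalEquality
open import Relation.Nullary using (¬_; Dec; yes; no; contradiction)
open import Relation.Nullary.Decidable using (True; dec⇒maybe; toWitness)
open import Tactic.RingSolver using (solve-∀)
open import Tactic.RingSolver.Core.AlmostCommutativeRing using (AlmostCommutativeRing; fromCommutativeRing)

-- With all n weighted equally, Ω(n) has mean about log log N, so plain averaging fails for large N.
-- The growth comes from the primes between a fixed 2^w and a small power 2^a of N; these are
-- sieved, and the primes on either side contribute a bounded amount. No sharp count of almost
-- primes is needed: the weight must only be non-negative, have mean at least 66^-I, and have
-- computable sums over multiples of prime powers.
--
-- The exponents of the block ends double so that Σ 1/(p-1) over every block has the same bound 3/2;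
-- one analysis of the truncation then serves all blocks. The logarithm of the error caused by a
-- block is proportional to its scale, which halves from one block to the next lower one, so further
-- terms are affordable there: the whole sieve costs a factor 2^(28 a). Summing over primes below
-- 2^z costs 2^(15 a) more, and 45 = 28 + 15 + 2 leaves 2^(2 a) for the remaining factors. The ratio
-- z / a = 15 is a compromise: raising it lowers log₂ N / z, but adds unsieved primes and error.

≤-by : ∀ {a b} d → b ≡ a + d → a ≤ b
≤-by d refl = m≤m+n _ d

-- Ordered arithmetic of rationals

ℚ-ring : AlmostCommutativeRing _ _
ℚ-ring = fromCommutativeRing ℚ.+-*-commutativeRing (λ x → dec⇒maybe (0ℚ ℚ.≟ x))

≼-refl : ∀ {a} → a ≼ a
≼-refl = ℚ.≤-refl

≼-trans : ∀ {a b c} → a ≼ b → b ≼ c → a ≼ c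
≼-trans = ℚ.≤-trans

≼-reflexive : ∀ {a b} → a ≡ b → a ≼ b
≼-reflexive = ℚ.≤-reflexive

0≼⊕ : ∀ {a b} → 0ℚ ≼ a → 0ℚ ≼ b → 0ℚ ≼ a ⊕ b
0≼⊕ = ℚ.+-mono-≤ {0ℚ} {_} {0ℚ}

0≼1 : 0ℚ ≼ 1ℚ
0≼1 = ℚ.nonNegative⁻¹ 1ℚ

-- Inequalities are certified by exhibiting the difference as a non-negative expression.
≼-by : ∀ {a b} d → 0ℚ ≼ d → b ≡ a ⊕ d → a ≼ b
≼-by {a} d h refl = subst (_≼ a ⊕ d) (ℚ.+-identityʳ a) (ℚ.+-monoʳ-≤ a h)

0≼⊖ : ∀ {a b} → a ≼ b → 0ℚ ≼ b ⊖ a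
0≼⊖ {a} {b} h = subst (_≼ b ⊖ a) (ℚ.+-inverseʳ a) (ℚ.+-monoˡ-≤ (⊖ a) h)

⊕-mono : ∀ {a b c d} → a ≼ b → c ≼ d → a ⊕ c ≼ b ⊕ d
⊕-mono = ℚ.+-mono-≤

⊕-monoʳ : ∀ a {b c} → b ≼ c → a ⊕ b ≼ a ⊕ c
⊕-monoʳ a = ℚ.+-monoʳ-≤ a

⊗-monoˡ : ∀ {a b c} → 0ℚ ≼ c → a ≼ b → c ⊗ a ≼ c ⊗ b
⊗-monoˡ {c = c} h = ℚ.*-monoˡ-≤-nonNeg c {{ℚ.nonNegative h}}

⊗-monoʳ : ∀ {a b c} → 0ℚ ≼ c → a ≼ b → a ⊗ c ≼ b ⊗ c
⊗-monoʳ {c = c} h = ℚ.*-monoʳ-≤-nonNeg c {{ℚ.nonNegative h}}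

0≼⊗ : ∀ {a b} → 0ℚ ≼ a → 0ℚ ≼ b → 0ℚ ≼ a ⊗ b
0≼⊗ {a} {b} h k = subst (_≼ a ⊗ b) (ℚ.*-zeroʳ a) (⊗-monoˡ h k)

⊗-mono : ∀ {a b c d} → 0ℚ ≼ c → 0ℚ ≼ b → a ≼ b → c ≼ d → a ⊗ c ≼ b ⊗ d
⊗-mono hc hb h k = ≼-trans (⊗-monoʳ hc h) (⊗-monoˡ hb k)

abstract
  -- Abstract, so that `ι n` and `inv n` never unfold to normalised fractions. Setting `inv 0` to 0
  -- makes `inv` total, so that sums of inverses carry no side conditions.
  ι : ℕ → ℚ
  ι zero = 0ℚ
  ι (suc n) = 1ℚ ⊕ ι n

  ι0 : ι 0 ≡ 0ℚ
  ι0 = refl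

  ι-suc : ∀ n → ι (suc n) ≡ 1ℚ ⊕ ι n
  ι-suc n = refl

  ι1 : ι 1 ≡ 1ℚ
  ι1 = refl

  ι-+ : ∀ m n → ι (m + n) ≡ ι m ⊕ ι n
  ι-+ zero n = sym (ℚ.+-identityˡ (ι n))
  ι-+ (suc m) n = trans (cong (1ℚ ⊕_) (ι-+ m n)) (sym (ℚ.+-assoc 1ℚ (ι m) (ι n)))

  ι-* : ∀ m n → ι (m * n) ≡ ι m ⊗ ι n
  ι-* zero n = sym (ℚ.*-zeroˡ (ι n))
  ι-* (suc m) n = trans (ι-+ n (m * n)) (trans (cong (ι n ⊕_) (ι-* m n)) (lem (ι m) (ι n)))
    where
    lem : ∀ a b → b ⊕ a ⊗ b ≡ (1ℚ ⊕ a) ⊗ b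
    lem = solve-∀ ℚ-ring

  ι-nonneg : ∀ n → 0ℚ ≼ ι n
  ι-nonneg zero = ≼-refl
  ι-nonneg (suc n) = 0≼⊕ 0≼1 (ι-nonneg n)

  ι-pos : ∀ n → 0ℚ ≺ ι (suc n)
  ι-pos n = ℚ.<-≤-trans (ℚ.positive⁻¹ 1ℚ) (≼-by (ι n) (ι-nonneg n) refl)

  inv : ℕ → ℚ
  inv zero = 0ℚ
  inv (suc n) = 1/_ (ι (suc n)) {{ℚ.>-nonZero (ι-pos n)}}

  inv-inverse : ∀ n .{{_ : NonZero n}} → ι n ⊗ inv n ≡ 1ℚ
  inv-inverse (suc n) = ℚ.*-inverseʳ (ι (suc n)) {{ℚ.>-nonZero (ι-pos n)}}

  inv0 : inv 0 ≡ 0ℚ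
  inv0 = refl

ι-mono : ∀ {m n} → m ≤ n → ι m ≼ ι n
ι-mono {m} {n} h with m≤n⇒∃[o]m+o≡n h
... | k , refl = ≼-by (ι k) (ι-nonneg k) (ι-+ m k)

1⋠0 : ¬ (1ℚ ≼ 0ℚ)
1⋠0 h = ℚ.<-irrefl refl (ℚ.<-≤-trans (ℚ.positive⁻¹ 1ℚ) h)

ι-cancel-≤ : ∀ {m n} → ι m ≼ ι n → m ≤ n
ι-cancel-≤ {m} {n} h with m ≤? n
... | yes p = p
... | no q = contradiction (subst₂ _≼_ (lem (ι n)) (ℚ.+-inverseʳ (ι n)) (⊕-mono below ≼-refl)) 1⋠0
  where
  below : 1ℚ ⊕ ι n ≼ ι n
  below = ≼-trans (subst (_≼ ι m) (ι-suc n) (ι-mono (≰⇒> q))) h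
  lem : ∀ a → 1ℚ ⊕ a ⊕ ⊖ a ≡ 1ℚ
  lem = solve-∀ ℚ-ring

inv-nonneg : ∀ n → 0ℚ ≼ inv n
inv-nonneg zero = ≼-reflexive (sym inv0)
inv-nonneg (suc n) with ℚ.≤-total 0ℚ (inv (suc n))
... | inj₁ h = h
... | inj₂ h = contradiction bad 1⋠0
  where
  bad : 1ℚ ≼ 0ℚ
  bad = subst₂ _≼_ (inv-inverse (suc n)) (ℚ.*-zeroʳ (ι (suc n))) (⊗-monoˡ (ι-nonneg (suc n)) h)

inv-* : ∀ m n .{{_ : NonZero m}} .{{_ : NonZero n}} → inv (m * n) ≡ inv m ⊗ inv n
inv-* m n = begin
  inv (m * n) ≡⟨ sym (ℚ.*-identityʳ _) ⟩
  inv (m * n) ⊗ 1ℚ ≡⟨ cong (inv (m * n) ⊗_) (sym (cong₂ _⊗_ (inv-inverse m) (inv-inverse n))) ⟩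
  inv (m * n) ⊗ (ι m ⊗ inv m ⊗ (ι n ⊗ inv n)) ≡⟨ lem (inv (m * n)) (ι m) (inv m) (ι n) (inv n) ⟩
  ι m ⊗ ι n ⊗ inv (m * n) ⊗ (inv m ⊗ inv n) ≡⟨ cong (λ a → a ⊗ inv (m * n) ⊗ (inv m ⊗ inv n)) (sym (ι-* m n)) ⟩
  ι (m * n) ⊗ inv (m * n) ⊗ (inv m ⊗ inv n) ≡⟨ cong (_⊗ (inv m ⊗ inv n)) (inv-inverse (m * n)) ⟩
  1ℚ ⊗ (inv m ⊗ inv n) ≡⟨ ℚ.*-identityˡ _ ⟩
  inv m ⊗ inv n ∎
  where
  open ≡-Reasoning
  instance
    mn≢0 = m*n≢0 m n
  lem : ∀ v a b c d → v ⊗ (a ⊗ b ⊗ (c ⊗ d)) ≡ a ⊗ c ⊗ v ⊗ (b ⊗ d)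
  lem = solve-∀ ℚ-ring

frac-≼ : ∀ a b m n .{{_ : NonZero m}} .{{_ : NonZero n}} → a * n ≤ b * m → ι a ⊗ inv m ≼ ι b ⊗ inv n
frac-≼ a b m n h = subst₂ _≼_ left right (⊗-monoʳ (0≼⊗ (inv-nonneg m) (inv-nonneg n)) (ι-mono h))
  where
  lem : ∀ a m n v → a ⊗ n ⊗ (m ⊗ v) ≡ a ⊗ m ⊗ (n ⊗ v)
  lem = solve-∀ ℚ-ring
  lem′ : ∀ a n v m → a ⊗ n ⊗ (v ⊗ m) ≡ a ⊗ m ⊗ (n ⊗ v)
  lem′ = solve-∀ ℚ-ring
  left : ι (a * n) ⊗ (inv m ⊗ inv n) ≡ ι a ⊗ inv m
  left = trans (cong (_⊗ (inv m ⊗ inv n)) (ι-* a n))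
    (trans (lem (ι a) (inv m) (ι n) (inv n)) (trans (cong (ι a ⊗ inv m ⊗_) (inv-inverse n)) (ℚ.*-identityʳ _)))
  right : ι (b * m) ⊗ (inv m ⊗ inv n) ≡ ι b ⊗ inv n
  right = trans (cong (_⊗ (inv m ⊗ inv n)) (ι-* b m))
    (trans (lem′ (ι b) (ι m) (inv m) (inv n)) (trans (cong (ι b ⊗ inv n ⊗_) (inv-inverse m)) (ℚ.*-identityʳ _)))

inv-anti : ∀ {m n} .{{_ : NonZero m}} → m ≤ n → inv n ≼ inv m
inv-anti {m} {n} h = subst₂ _≼_ (one (inv n)) (one (inv m)) (frac-≼ 1 1 n m (*-monoʳ-≤ 1 h))
  where
  instance
    n≢0 = >-nonZero (≤-trans (>-nonZero⁻¹ m) h)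
  one : ∀ v → ι 1 ⊗ v ≡ v
  one v = trans (cong (_⊗ v) ι1) (ℚ.*-identityˡ v)

-- Finite sums and indicators

Σ : ∀ {A : Set} → List A → (A → ℚ) → ℚ
Σ [] f = 0ℚ
Σ (x ∷ xs) f = f x ⊕ Σ xs f

module _ {A : Set} where

  Σ-cong : ∀ (xs : List A) {f g : A → ℚ} → (∀ {x} → x ∈ xs → f x ≡ g x) → Σ xs f ≡ Σ xs g
  Σ-cong [] h = refl
  Σ-cong (x ∷ xs) h = cong₂ _⊕_ (h (here refl)) (Σ-cong xs (λ i → h (there i)))

  Σ-mono : ∀ (xs : List A) {f g : A → ℚ} → (∀ {x} → x ∈ xs → f x ≼ g x) → Σ xs f ≼ Σ xs g
  Σ-mono [] h = ≼-refl
  Σ-mono (x ∷ xs) h = ⊕-mono (h (here refl)) (Σ-mono xs (λ i → h (there i)))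

  Σ-nonneg : ∀ (xs : List A) {f : A → ℚ} → (∀ {x} → x ∈ xs → 0ℚ ≼ f x) → 0ℚ ≼ Σ xs f
  Σ-nonneg [] h = ≼-refl
  Σ-nonneg (x ∷ xs) h = 0≼⊕ (h (here refl)) (Σ-nonneg xs (λ i → h (there i)))

  Σ-⊕ : ∀ (xs : List A) {f g : A → ℚ} → Σ xs (λ x → f x ⊕ g x) ≡ Σ xs f ⊕ Σ xs g
  Σ-⊕ [] = refl
  Σ-⊕ (x ∷ xs) {f} {g} = trans (cong (f x ⊕ g x ⊕_) (Σ-⊕ xs)) (lem (f x) (g x) (Σ xs f) (Σ xs g))
    where
    lem : ∀ a b c d → a ⊕ b ⊕ (c ⊕ d) ≡ a ⊕ c ⊕ (b ⊕ d)
    lem = solve-∀ ℚ-ring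

  Σ-⊖ : ∀ (xs : List A) {f g : A → ℚ} → Σ xs (λ x → f x ⊖ g x) ≡ Σ xs f ⊖ Σ xs g
  Σ-⊖ [] = refl
  Σ-⊖ (x ∷ xs) {f} {g} = trans (cong (f x ⊖ g x ⊕_) (Σ-⊖ xs)) (lem (f x) (g x) (Σ xs f) (Σ xs g))
    where
    lem : ∀ a b c d → a ⊖ b ⊕ (c ⊖ d) ≡ a ⊕ c ⊖ (b ⊕ d)
    lem = solve-∀ ℚ-ring

  Σ-⊗ˡ : ∀ (xs : List A) c {f : A → ℚ} → Σ xs (λ x → c ⊗ f x) ≡ c ⊗ Σ xs f
  Σ-⊗ˡ [] c = sym (ℚ.*-zeroʳ c)
  Σ-⊗ˡ (x ∷ xs) c {f} = trans (cong (c ⊗ f x ⊕_) (Σ-⊗ˡ xs c)) (sym (ℚ.*-distribˡ-+ c (f x) (Σ xs f)))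

  Σ-⊗ʳ : ∀ (xs : List A) c {f : A → ℚ} → Σ xs (λ x → f x ⊗ c) ≡ Σ xs f ⊗ c
  Σ-⊗ʳ xs c {f} = trans (Σ-cong xs (λ {x} _ → ℚ.*-comm (f x) c)) (trans (Σ-⊗ˡ xs c) (ℚ.*-comm c (Σ xs f)))

  Σ-++ : ∀ (xs ys : List A) {f : A → ℚ} → Σ (xs ++ ys) f ≡ Σ xs f ⊕ Σ ys f
  Σ-++ [] ys {f} = sym (ℚ.+-identityˡ (Σ ys f))
  Σ-++ (x ∷ xs) ys {f} = trans (cong (f x ⊕_) (Σ-++ xs ys)) (sym (ℚ.+-assoc (f x) (Σ xs f) (Σ ys f)))

  Σ-const : ∀ (xs : List A) c → Σ xs (λ _ → c) ≡ ι (length xs) ⊗ c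
  Σ-const [] c = sym (trans (cong (_⊗ c) ι0) (ℚ.*-zeroˡ c))
  Σ-const (x ∷ xs) c = trans (cong (c ⊕_) (Σ-const xs c))
    (sym (trans (cong (_⊗ c) (ι-suc (length xs))) (lem (ι (length xs)) c)))
    where
    lem : ∀ l c → (1ℚ ⊕ l) ⊗ c ≡ c ⊕ l ⊗ c
    lem = solve-∀ ℚ-ring

  Σ-∈ : ∀ (xs : List A) {f : A → ℚ} {x} → (∀ {x} → x ∈ xs → 0ℚ ≼ f x) → x ∈ xs → f x ≼ Σ xs f
  Σ-∈ (x ∷ xs) {f} h (here refl) = ≼-by (Σ xs f) (Σ-nonneg xs (λ i → h (there i))) refl
  Σ-∈ (y ∷ xs) {f} h (there i) = ≼-trans (Σ-∈ xs (λ j → h (there j)) i)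
    (≼-by (f y) (h (here refl)) (ℚ.+-comm (f y) (Σ xs f)))

Σ-swap : ∀ {A B : Set} (xs : List A) (ys : List B) {f : A → B → ℚ} →
  Σ xs (λ x → Σ ys (f x)) ≡ Σ ys (λ y → Σ xs (λ x → f x y))
Σ-swap [] ys = sym (trans (Σ-const ys 0ℚ) (ℚ.*-zeroʳ (ι (length ys))))
Σ-swap (x ∷ xs) ys {f} = trans (cong (Σ ys (f x) ⊕_) (Σ-swap xs ys)) (sym (Σ-⊕ ys))

𝟙 : ∀ {P : Set} → Dec P → ℚ
𝟙 (yes _) = 1ℚ
𝟙 (no _) = 0ℚ

𝟙-yes : ∀ {P : Set} (d : Dec P) → P → 𝟙 d ≡ 1ℚ
𝟙-yes (yes _) _ = refl
𝟙-yes (no q) p = contradiction p q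

𝟙-no : ∀ {P : Set} (d : Dec P) → ¬ P → 𝟙 d ≡ 0ℚ
𝟙-no (yes p) q = contradiction p q
𝟙-no (no _) _ = refl

𝟙-nonneg : ∀ {P : Set} (d : Dec P) → 0ℚ ≼ 𝟙 d
𝟙-nonneg (yes _) = 0≼1
𝟙-nonneg (no _) = ≼-refl

𝟙≼1 : ∀ {P : Set} (d : Dec P) → 𝟙 d ≼ 1ℚ
𝟙≼1 (yes _) = ≼-refl
𝟙≼1 (no _) = 0≼1

𝟙-⇔ : ∀ {P Q : Set} (d : Dec P) (e : Dec Q) → (P → Q) → (Q → P) → 𝟙 d ≡ 𝟙 e
𝟙-⇔ (yes p) e f g = sym (𝟙-yes e (f p))
𝟙-⇔ (no p) e f g = sym (𝟙-no e (λ q → p (g q)))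

𝟙-× : ∀ {P Q R : Set} (d : Dec P) (e : Dec Q) (c : Dec R) → (P → Q → R) → (R → P) → (R → Q) →
  𝟙 d ⊗ 𝟙 e ≡ 𝟙 c
𝟙-× (yes p) (yes q) c f g h = trans (ℚ.*-identityˡ 1ℚ) (sym (𝟙-yes c (f p q)))
𝟙-× (yes p) (no q) c f g h = trans (ℚ.*-zeroʳ 1ℚ) (sym (𝟙-no c (λ r → q (h r))))
𝟙-× (no p) e c f g h = trans (ℚ.*-zeroˡ (𝟙 e)) (sym (𝟙-no c (λ r → p (g r))))

-- Counting multiples of a modulus

δ : ℕ → ℕ → ℚ
δ m n = 𝟙 (m ∣? n)

-- The numbers counted are c+1, …, c+X; the remainder of c+X modulo m records the discrepancy.
count-multiples : ∀ m c .{{_ : NonZero m}} → ∃ λ r₀ → r₀ < m × (∀ X → ∃₂ λ q r →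
  r < m × X + c ≡ q * m + r × ι m ⊗ Σ (downFrom X) (λ i → δ m (suc i + c)) ⊕ ι r ≡ ι X ⊕ ι r₀)
count-multiples m c = c % m , m%n<n c m , go
  where
  r₀ = c % m
  go : ∀ X → ∃₂ λ q r → r < m × X + c ≡ q * m + r ×
    ι m ⊗ Σ (downFrom X) (λ i → δ m (suc i + c)) ⊕ ι r ≡ ι X ⊕ ι r₀
  go zero = c / m , r₀ , m%n<n c m , trans (m≡m%n+[m/n]*n c m) (+-comm r₀ _) ,
    trans (cong (_⊕ ι r₀) (ℚ.*-zeroʳ (ι m))) (cong (_⊕ ι r₀) (sym ι0))
  go (suc X) with go X
  ... | q , r , r<m , eq , h with suc r ≟ m
  ...   | yes refl = suc q , 0 , z<s , eq′ ,
          trans (cong (λ a → ι m ⊗ (a ⊕ s) ⊕ ι 0) (𝟙-yes (m ∣? (suc X + c)) dvd)) count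
    where
    s = Σ (downFrom X) (λ i → δ m (suc i + c))
    eq′ : suc X + c ≡ suc q * m + 0
    eq′ = trans (cong suc eq) (lem q r)
      where
      lem : ∀ q r → suc (q * suc r + r) ≡ suc q * suc r + 0
      lem = ℕ-Solver.solve-∀
    dvd : m ∣ suc X + c
    dvd = divides (suc q) (trans eq′ (+-identityʳ _))
    count : ι m ⊗ (1ℚ ⊕ s) ⊕ ι 0 ≡ ι (suc X) ⊕ ι r₀
    count = begin
      ι m ⊗ (1ℚ ⊕ s) ⊕ ι 0 ≡⟨ cong₂ (λ a b → a ⊗ (1ℚ ⊕ s) ⊕ b) (ι-suc r) ι0 ⟩
      (1ℚ ⊕ ι r) ⊗ (1ℚ ⊕ s) ⊕ 0ℚ ≡⟨ lem (ι r) s ⟩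
      1ℚ ⊕ ((1ℚ ⊕ ι r) ⊗ s ⊕ ι r) ≡⟨ cong (λ a → 1ℚ ⊕ (a ⊗ s ⊕ ι r)) (sym (ι-suc r)) ⟩
      1ℚ ⊕ (ι m ⊗ s ⊕ ι r) ≡⟨ cong (1ℚ ⊕_) h ⟩
      1ℚ ⊕ (ι X ⊕ ι r₀) ≡⟨ sym (ℚ.+-assoc 1ℚ (ι X) (ι r₀)) ⟩
      1ℚ ⊕ ι X ⊕ ι r₀ ≡⟨ cong (_⊕ ι r₀) (sym (ι-suc X)) ⟩
      ι (suc X) ⊕ ι r₀ ∎
      where
      open ≡-Reasoning
      lem : ∀ r s → (1ℚ ⊕ r) ⊗ (1ℚ ⊕ s) ⊕ 0ℚ ≡ 1ℚ ⊕ ((1ℚ ⊕ r) ⊗ s ⊕ r)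
      lem = solve-∀ ℚ-ring
  ...   | no sr≢m = q , suc r , sr<m , eq′ ,
          trans (cong (λ a → ι m ⊗ (a ⊕ s) ⊕ ι (suc r)) (𝟙-no (m ∣? (suc X + c)) ndvd)) count
    where
    s = Σ (downFrom X) (λ i → δ m (suc i + c))
    sr<m = ≤∧≢⇒< r<m sr≢m
    eq′ : suc X + c ≡ q * m + suc r
    eq′ = trans (cong suc eq) (sym (+-suc _ r))
    ndvd : ¬ m ∣ suc X + c
    ndvd d = >⇒∤ sr<m (∣m+n∣m⇒∣n (subst (m ∣_) eq′ d) (n∣m*n q))
    count : ι m ⊗ (0ℚ ⊕ s) ⊕ ι (suc r) ≡ ι (suc X) ⊕ ι r₀
    count = begin
      ι m ⊗ (0ℚ ⊕ s) ⊕ ι (suc r) ≡⟨ cong (ι m ⊗ (0ℚ ⊕ s) ⊕_) (ι-suc r) ⟩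
      ι m ⊗ (0ℚ ⊕ s) ⊕ (1ℚ ⊕ ι r) ≡⟨ lem (ι m) (ι r) s ⟩
      1ℚ ⊕ (ι m ⊗ s ⊕ ι r) ≡⟨ cong (1ℚ ⊕_) h ⟩
      1ℚ ⊕ (ι X ⊕ ι r₀) ≡⟨ sym (ℚ.+-assoc 1ℚ (ι X) (ι r₀)) ⟩
      1ℚ ⊕ ι X ⊕ ι r₀ ≡⟨ cong (_⊕ ι r₀) (sym (ι-suc X)) ⟩
      ι (suc X) ⊕ ι r₀ ∎
      where
      open ≡-Reasoning
      lem : ∀ m r s → m ⊗ (0ℚ ⊕ s) ⊕ (1ℚ ⊕ r) ≡ 1ℚ ⊕ (m ⊗ s ⊕ r)
      lem = solve-∀ ℚ-ring

-- Both one-sided estimates are carried along because subtraction exchanges them.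
record Near (a b D : ℚ) : Set where
  constructor _&_
  field
    above : a ≼ b ⊕ D
    below : b ≼ a ⊕ D

Near-⊕ : ∀ {a b c d D E} → Near a b D → Near c d E → Near (a ⊕ c) (b ⊕ d) (D ⊕ E)
Near-⊕ {a} {b} {c} {d} {D} {E} (h & k) (h′ & k′) =
  subst (a ⊕ c ≼_) (lem b D d E) (⊕-mono h h′) & subst (b ⊕ d ≼_) (lem a D c E) (⊕-mono k k′)
  where
  lem : ∀ a b c d → a ⊕ b ⊕ (c ⊕ d) ≡ a ⊕ c ⊕ (b ⊕ d)
  lem = solve-∀ ℚ-ring

Near-⊖ : ∀ {a b c d D E} → Near a b D → Near c d E → Near (a ⊖ c) (b ⊖ d) (D ⊕ E)
Near-⊖ {a} {b} {c} {d} {D} {E} (h & k) (h′ & k′) =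
  ≼-by _ (0≼⊕ (0≼⊖ h) (0≼⊖ k′)) (lem a b c d D E) & ≼-by _ (0≼⊕ (0≼⊖ k) (0≼⊖ h′)) (lem b a d c D E)
  where
  lem : ∀ a b c d D E → b ⊖ d ⊕ (D ⊕ E) ≡ a ⊖ c ⊕ (b ⊕ D ⊖ a ⊕ (c ⊕ E ⊖ d))
  lem = solve-∀ ℚ-ring

Near-refl : ∀ {a D} → 0ℚ ≼ D → Near a a D
Near-refl h = ≼-by _ h refl & ≼-by _ h refl

Near-weaken : ∀ {a b D E} → D ≼ E → Near a b D → Near a b E
Near-weaken {a} {b} h (k & k′) = ≼-trans k (⊕-mono (≼-refl {b}) h) & ≼-trans k′ (⊕-mono (≼-refl {a}) h)

-- In the identity m s + r = X + r₀ of `count-multiples` both remainders lie in [0, m), so m s is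
-- within m of X. After division the error is 1, whatever the modulus.
count-near : ∀ m c X .{{_ : NonZero m}} →
  Near (Σ (downFrom X) (λ i → δ m (suc i + c))) (inv m ⊗ ι X) 1ℚ
count-near m c X with count-multiples m c
... | r₀ , r₀<m , f with f X
... | q , r , r<m , _ , h = bound r₀ r r₀<m (trans h (ℚ.+-comm (ι X) (ι r₀))) & bound′ r r₀ r<m h
  where
  s = Σ (downFrom X) (λ i → δ m (suc i + c))
  v = inv m
  cancel : ∀ a → v ⊗ (ι m ⊗ a) ≡ a
  cancel a = trans (sym (ℚ.*-assoc v (ι m) a)) (trans (cong (_⊗ a) (trans (ℚ.*-comm v (ι m)) (inv-inverse m))) (ℚ.*-identityˡ a))
  bound : ∀ r₀ r → r₀ < m → ι m ⊗ s ⊕ ι r ≡ ι r₀ ⊕ ι X → s ≼ v ⊗ ι X ⊕ 1ℚ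
  bound r₀ r r₀<m h = subst₂ _≼_ (cancel s) eq (⊗-monoˡ (inv-nonneg m) le)
    where
    lem : ∀ X m r r₀ ms → ms ⊕ r ≡ r₀ ⊕ X → X ⊕ m ≡ ms ⊕ ((m ⊖ r₀) ⊕ r)
    lem X m r r₀ ms e = trans (lemA X m r₀) (trans (cong (_⊕ (m ⊖ r₀)) (sym e)) (lemB ms r (m ⊖ r₀)))
      where
      lemA : ∀ X m r₀ → X ⊕ m ≡ r₀ ⊕ X ⊕ (m ⊖ r₀)
      lemA = solve-∀ ℚ-ring
      lemB : ∀ a r b → a ⊕ r ⊕ b ≡ a ⊕ (b ⊕ r)
      lemB = solve-∀ ℚ-ring
    le : ι m ⊗ s ≼ ι X ⊕ ι m
    le = ≼-by _ (0≼⊕ (0≼⊖ (ι-mono (<⇒≤ r₀<m))) (ι-nonneg r)) (lem (ι X) (ι m) (ι r) (ι r₀) (ι m ⊗ s) h)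
    eq : v ⊗ (ι X ⊕ ι m) ≡ v ⊗ ι X ⊕ 1ℚ
    eq = trans (ℚ.*-distribˡ-+ v (ι X) (ι m)) (cong (v ⊗ ι X ⊕_) (trans (ℚ.*-comm v (ι m)) (inv-inverse m)))
  bound′ : ∀ r r₀ → r < m → ι m ⊗ s ⊕ ι r ≡ ι X ⊕ ι r₀ → v ⊗ ι X ≼ s ⊕ 1ℚ
  bound′ r r₀ r<m h = subst₂ _≼_ refl eq (⊗-monoˡ (inv-nonneg m) le)
    where
    lem : ∀ X m r r₀ ms → ms ⊕ r ≡ X ⊕ r₀ → ms ⊕ m ≡ X ⊕ ((m ⊖ r) ⊕ r₀)
    lem X m r r₀ ms e = trans (lemA ms m r) (trans (cong (_⊕ (m ⊖ r)) e) (lemB X r₀ (m ⊖ r)))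
      where
      lemA : ∀ X m r₀ → X ⊕ m ≡ X ⊕ r₀ ⊕ (m ⊖ r₀)
      lemA = solve-∀ ℚ-ring
      lemB : ∀ a r b → a ⊕ r ⊕ b ≡ a ⊕ (b ⊕ r)
      lemB = solve-∀ ℚ-ring
    le : ι X ≼ ι m ⊗ s ⊕ ι m
    le = ≼-by _ (0≼⊕ (0≼⊖ (ι-mono (<⇒≤ r<m))) (ι-nonneg r₀)) (lem (ι X) (ι m) (ι r) (ι r₀) (ι m ⊗ s) h)
    eq : v ⊗ (ι m ⊗ s ⊕ ι m) ≡ s ⊕ 1ℚ
    eq = trans (ℚ.*-distribˡ-+ v (ι m ⊗ s) (ι m)) (cong₂ _⊕_ (cancel s) (trans (ℚ.*-comm v (ι m)) (inv-inverse m)))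

-- Equidistribution in residue classes

coprime-∣-* : ∀ {m p k} → Coprime m p → m ∣ k → p ∣ k → m * p ∣ k
coprime-∣-* {m} {p} cop (divides q refl) p∣k
  with divides r refl ← coprime-divisor (Coprimality.sym cop) (subst (p ∣_) (*-comm q m) p∣k) =
  divides r (trans (*-assoc r p m) (cong (r *_) (*-comm p m)))

chinese-remainder : ∀ m p .{{_ : NonZero m}} .{{_ : NonZero p}} → Coprime m p → ∀ c c′ →
  ∃ λ c″ → (∃ λ s → c″ ≡ c + m * s) × (∃ λ t → c″ ≡ c′ + p * t)
chinese-remainder (suc m) (suc p) cop c c′ with coprime-Bézout cop
-- The usual c + x m (c′ - c) with x m ≡ 1 modulo the second modulus. After matching, `p` is the
-- predecessor of that modulus, so `p * c` stands for -c. The other sign of the Bézout identity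
-- exchanges the roles.
... | Bézout.+- x y eq = c + suc m * (x * (c′ + p * c)) , (_ , refl) , (c + y * (c′ + p * c)) , eq′
  where
  shape : ∀ m x c c′ p → c + m * (x * (c′ + p * c)) ≡ c + x * m * (c′ + p * c)
  shape = ℕ-Solver.solve-∀
  lem : ∀ p y c c′ → c + (1 + y * suc p) * (c′ + p * c) ≡ c′ + suc p * (c + y * (c′ + p * c))
  lem = ℕ-Solver.solve-∀
  eq′ : c + suc m * (x * (c′ + p * c)) ≡ c′ + suc p * (c + y * (c′ + p * c))
  eq′ = trans (shape (suc m) x c c′ p) (trans (cong (λ a → c + a * (c′ + p * c)) (sym eq)) (lem p y c c′))
... | Bézout.-+ x y eq = c′ + suc p * (y * (c + m * c′)) , ((c′ + x * (c + m * c′)) , eq′) , (_ , refl)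
  where
  shape : ∀ m x c c′ p → c + m * (x * (c′ + p * c)) ≡ c + x * m * (c′ + p * c)
  shape = ℕ-Solver.solve-∀
  lem : ∀ p y c c′ → c + (1 + y * suc p) * (c′ + p * c) ≡ c′ + suc p * (c + y * (c′ + p * c))
  lem = ℕ-Solver.solve-∀
  eq′ : c′ + suc p * (y * (c + m * c′)) ≡ c + suc m * (c′ + x * (c + m * c′))
  eq′ = trans (shape (suc p) y c′ c m) (trans (cong (λ a → c′ + a * (c + m * c′)) (sym eq)) (lem m x c′ c))

shift-∣ : ∀ {m n c c″ s} → c″ ≡ c + m * s → m ∣ n + c → m ∣ n + c″
shift-∣ {m} {n} {c} {_} {s} refl h = subst (m ∣_) (+-assoc n c (m * s)) (∣m∣n⇒∣m+n h (m∣m*n s))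

unshift-∣ : ∀ {m n c c″ s} → c″ ≡ c + m * s → m ∣ n + c″ → m ∣ n + c
unshift-∣ {m} {n} {c} {_} {s} refl h =
  ∣m+n∣m⇒∣n (subst (m ∣_) (trans (sym (+-assoc n c (m * s))) (+-comm (n + c) (m * s))) h) (m∣m*n s)

module _ (X : ℕ) where

  -- f has mean d, up to an error D, on each residue class to a modulus prime to S.
  -- Residue classes are written n ≡ -c, as m ∣ n + c.
  record Equi (S : List ℕ) (f : ℕ → ℚ) (d D : ℚ) : Set where
    constructor equi
    field
      near : ∀ m c → NonZero m → (∀ {q} → q ∈ S → Coprime q m) →
        Near (Σ (downFrom X) (λ i → δ m (suc i + c) ⊗ f (suc i))) (inv m ⊗ ι X ⊗ d) D

  open Equi

  Equi-1 : Equi [] (λ _ → 1ℚ) 1ℚ 1ℚ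
  Equi-1 .near m c m≢0 _ = subst₂ (λ a b → Near a b 1ℚ)
    (Σ-cong (downFrom X) (λ {i} _ → sym (ℚ.*-identityʳ (δ m (suc i + c))))) (sym (ℚ.*-identityʳ (inv m ⊗ ι X)))
    (count-near m c X {{m≢0}})

  Equi-0 : ∀ {S} {f : ℕ → ℚ} → Equi S (λ n → 0ℚ ⊗ f n) 0ℚ 0ℚ
  Equi-0 {f = f} .near m c _ _ = subst₂ (λ a b → Near a b 0ℚ) eq (sym (ℚ.*-zeroʳ (inv m ⊗ ι X))) (Near-refl {0ℚ} ≼-refl)
    where
    lem : ∀ a b → a ⊗ (0ℚ ⊗ b) ≡ 0ℚ
    lem = solve-∀ ℚ-ring
    eq : 0ℚ ≡ Σ (downFrom X) (λ i → δ m (suc i + c) ⊗ (0ℚ ⊗ f (suc i)))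
    eq = sym (trans (Σ-cong (downFrom X) (λ {i} _ → lem (δ m (suc i + c)) (f (suc i))))
      (trans (Σ-const (downFrom X) 0ℚ) (ℚ.*-zeroʳ (ι (length (downFrom X))))))

  Equi-cong : ∀ {S S′ f g d e D} → (∀ {q} → q ∈ S → q ∈ S′) → (∀ n → f n ≡ g n) → d ≡ e →
    Equi S f d D → Equi S′ g e D
  Equi-cong {D = D} sub fg de h .near m c m≢0 cop = subst₂ (λ a b → Near a b D)
    (Σ-cong (downFrom X) (λ {i} _ → cong (δ m (suc i + c) ⊗_) (fg (suc i)))) (cong (inv m ⊗ ι X ⊗_) de)
    (near h m c m≢0 (λ i → cop (sub i)))

  Equi-weaken : ∀ {S f d D E} → D ≼ E → Equi S f d D → Equi S f d E
  Equi-weaken h k .near m c m≢0 cop = Near-weaken h (near k m c m≢0 cop)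

  Equi-⊕ : ∀ {S f g d e D E} → Equi S f d D → Equi S g e E → Equi S (λ n → f n ⊕ g n) (d ⊕ e) (D ⊕ E)
  Equi-⊕ {f = f} {g} {d} {e} {D} {E} h k .near m c m≢0 cop = subst₂ (λ a b → Near a b (D ⊕ E))
    (trans (sym (Σ-⊕ (downFrom X))) (Σ-cong (downFrom X) (λ {i} _ → sym (ℚ.*-distribˡ-+ (δ m (suc i + c)) (f (suc i)) (g (suc i))))))
    (sym (ℚ.*-distribˡ-+ (inv m ⊗ ι X) d e))
    (Near-⊕ (near h m c m≢0 cop) (near k m c m≢0 cop))

  Equi-⊖ : ∀ {S f g d e D E} → Equi S f d D → Equi S g e E → Equi S (λ n → f n ⊖ g n) (d ⊖ e) (D ⊕ E)
  Equi-⊖ {f = f} {g} {d} {e} {D} {E} h k .near m c m≢0 cop = subst₂ (λ a b → Near a b (D ⊕ E))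
    (trans (sym (Σ-⊖ (downFrom X))) (Σ-cong (downFrom X) (λ {i} _ → lem (δ m (suc i + c)) (f (suc i)) (g (suc i)))))
    (lem (inv m ⊗ ι X) d e)
    (Near-⊖ (near h m c m≢0 cop) (near k m c m≢0 cop))
    where
    lem : ∀ a b c → a ⊗ b ⊖ a ⊗ c ≡ a ⊗ (b ⊖ c)
    lem = solve-∀ ℚ-ring

  -- By the Chinese remainder theorem a class modulo m and one modulo p form a single class modulo m
  -- p, so the mean gains the factor 1/p and the error does not grow. From then on p is excluded
  -- from the moduli.
  Equi-δ : ∀ {S f d D p} .{{_ : NonZero p}} → (∀ {q} → q ∈ S → Coprime q p) → Equi S f d D → ∀ c₀ →
    Equi (p ∷ S) (λ n → δ p (n + c₀) ⊗ f n) (inv p ⊗ d) D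
  Equi-δ {f = f} {d} {D} {p} copS h c₀ .near m c m≢0 cop
    with chinese-remainder m p {{m≢0}} (Coprimality.sym (cop (here refl))) c c₀
  ... | c″ , (s , eqs) , (t , eqt) = subst₂ (λ a b → Near a b D)
    (Σ-cong (downFrom X) (λ {i} _ → trans (cong (_⊗ f (suc i)) (sym (split i))) (ℚ.*-assoc (δ m (suc i + c)) (δ p (suc i + c₀)) (f (suc i)))))
    (trans (cong (λ a → a ⊗ ι X ⊗ d) (inv-* m p {{m≢0}})) (lem (inv m) (inv p) (ι X) d))
    (near h (m * p) c″ (m*n≢0 m p {{m≢0}}) copm)
    where
    lem : ∀ m p X d → m ⊗ p ⊗ X ⊗ d ≡ m ⊗ X ⊗ (p ⊗ d)
    lem = solve-∀ ℚ-ring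
    copm : ∀ {q} → q ∈ _ → Coprime q (m * p)
    copm i {k} (k∣q , k∣mp) = copS i (k∣q , coprime-divisor cop′ k∣mp)
      where
      cop′ : Coprime k m
      cop′ (a , b) = cop (there i) (∣-trans a k∣q , b)
    split : ∀ i → δ m (suc i + c) ⊗ δ p (suc i + c₀) ≡ δ (m * p) (suc i + c″)
    split i = 𝟙-× (m ∣? (suc i + c)) (p ∣? (suc i + c₀)) ((m * p) ∣? (suc i + c″))
      (λ a b → coprime-∣-* (Coprimality.sym (cop (here refl))) (shift-∣ {n = suc i} eqs a) (shift-∣ {n = suc i} eqt b))
      (λ a → unshift-∣ {n = suc i} eqs (m*n∣⇒m∣ m p a))
      (λ a → unshift-∣ {n = suc i} eqt (m*n∣⇒n∣ m p a))

-- The events p ∣ n (N - n) and their means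

module _ (N : ℕ) where

  -- The indicator of p ∣ n (N - n) and its mean; when p ∣ N the two residue classes coincide.
  -- N - n ≡ 0 mod p is written p ∣ n + (p-1) N.
  hit : ∀ p → Dec (p ∣ N) → ℕ → ℚ
  hit p (yes _) n = δ p (n + 0)
  hit p (no _) n = δ p (n + 0) ⊕ δ p (n + pred p * N)

  mean : ∀ p → Dec (p ∣ N) → ℚ
  mean p (yes _) = inv p
  mean p (no _) = inv p ⊕ inv p

  χ : ℕ → ℕ → ℚ
  χ n p = hit p (p ∣? N) n

  χ̂ : ℕ → ℚ
  χ̂ p = mean p (p ∣? N)

  χ̂-nonneg : ∀ p → 0ℚ ≼ χ̂ p
  χ̂-nonneg p with p ∣? N
  ... | yes _ = inv-nonneg p
  ... | no _ = 0≼⊕ (inv-nonneg p) (inv-nonneg p)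

  χ̂-≼ : ∀ p → χ̂ p ≼ inv p ⊕ inv p
  χ̂-≼ p with p ∣? N
  ... | yes _ = ≼-by (inv p) (inv-nonneg p) refl
  ... | no _ = ≼-refl

  χ-nonneg : ∀ n p → 0ℚ ≼ χ n p
  χ-nonneg n p with p ∣? N
  ... | yes _ = 𝟙-nonneg (p ∣? (n + 0))
  ... | no _ = 0≼⊕ (𝟙-nonneg (p ∣? (n + 0))) (𝟙-nonneg (p ∣? (n + pred p * N)))

  p∣pN : ∀ p → NonZero p → p ∣ N + pred p * N
  p∣pN (suc p) _ = divides N (*-comm (suc p) N)

  -- If p divides both n and N - n, it divides N; so for p ∤ N the two classes are disjoint.
  χ≼1 : ∀ n {p} → NonZero p → χ n p ≼ 1ℚ
  χ≼1 n {p} p≢0 with p ∣? N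
  ... | yes _ = 𝟙≼1 (p ∣? (n + 0))
  ... | no p∤N with p ∣? (n + 0) | p ∣? (n + pred p * N)
  ...   | yes a | yes b = contradiction (∣m+n∣m⇒∣n (subst (p ∣_) (+-comm N (pred p * N)) (p∣pN p p≢0))
            (∣m+n∣m⇒∣n b (subst (p ∣_) (+-identityʳ n) a))) p∤N
  ...   | yes _ | no _ = ≼-reflexive (ℚ.+-identityʳ 1ℚ)
  ...   | no _ | yes _ = ≼-reflexive (ℚ.+-identityˡ 1ℚ)
  ...   | no _ | no _ = ≼-trans (≼-reflexive (ℚ.+-identityˡ 0ℚ)) 0≼1

  χ≡1 : ∀ {n p} → NonZero p → p ∣ n ⊎ p ∣ n + pred p * N → χ n p ≡ 1ℚ
  χ≡1 {n} {p} p≢0 h with p ∣? N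
  ... | yes p∣N = 𝟙-yes (p ∣? (n + 0)) (subst (p ∣_) (sym (+-identityʳ n)) (p∣n h))
    where
    p∣n : p ∣ n ⊎ p ∣ n + pred p * N → p ∣ n
    p∣n (inj₁ a) = a
    p∣n (inj₂ b) = ∣m+n∣m⇒∣n (subst (p ∣_) (+-comm n (pred p * N)) b) (∣n⇒∣m*n (pred p) p∣N)
  ... | no p∤N with p ∣? (n + 0) | p ∣? (n + pred p * N)
  ...   | yes a | yes b = contradiction (∣m+n∣m⇒∣n (subst (p ∣_) (+-comm N (pred p * N)) (p∣pN p p≢0))
            (∣m+n∣m⇒∣n b (subst (p ∣_) (+-identityʳ n) a))) p∤N
  ...   | yes _ | no _ = ℚ.+-identityʳ 1ℚ
  ...   | no _ | yes _ = ℚ.+-identityˡ 1ℚ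
  ...   | no a | no b with h
  ...     | inj₁ a′ = contradiction (subst (p ∣_) (sym (+-identityʳ n)) a′) a
  ...     | inj₂ b′ = contradiction b′ b

  -- The error doubles because there may be two residue classes.
  Equi-χ : ∀ {X S f d D p} → NonZero p → 0ℚ ≼ D → (∀ {q} → q ∈ S → Coprime q p) → Equi X S f d D →
    Equi X (p ∷ S) (λ n → χ n p ⊗ f n) (χ̂ p ⊗ d) (D ⊕ D)
  Equi-χ {X} {S} {f} {d} {D} {p} p≢0 0≼D cop h with p ∣? N
  ... | yes _ = Equi-weaken X (≼-by D 0≼D refl) (Equi-δ X {{p≢0}} cop h 0)
  ... | no _ = Equi-cong X id (λ n → sym (ℚ.*-distribʳ-+ (f n) (δ p (n + 0)) (δ p (n + pred p * N))))
    (sym (ℚ.*-distribʳ-+ d (inv p) (inv p)))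
    (Equi-⊕ X (Equi-δ X {{p≢0}} cop h 0) (Equi-δ X {{p≢0}} cop h (pred p * N)))

-- Truncated inclusion-exclusion

-- Partial sums Σ_{j<t} (-1)^j e_j of the elementary symmetric functions e_j = esym j: truncated inclusion-exclusion.
incl-excl : ℕ → (ℕ → ℚ) → List ℕ → ℚ
incl-excl zero x ps = 0ℚ
incl-excl (suc t) x [] = 1ℚ
incl-excl (suc t) x (p ∷ ps) = incl-excl (suc t) x ps ⊖ x p ⊗ incl-excl t x ps

esym : ℕ → (ℕ → ℚ) → List ℕ → ℚ
esym zero x ps = 1ℚ
esym (suc t) x [] = 0ℚ
esym (suc t) x (p ∷ ps) = esym (suc t) x ps ⊕ x p ⊗ esym t x ps

-- The complete product of the 1 - x p, expanded so that its recursion matches that of `incl-excl`.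
survive : (ℕ → ℚ) → List ℕ → ℚ
survive x [] = 1ℚ
survive x (p ∷ ps) = survive x ps ⊖ x p ⊗ survive x ps

sgn : ℕ → ℚ
sgn zero = 1ℚ
sgn (suc t) = ⊖ sgn t

double : ℕ → ℕ
double zero = zero
double (suc r) = suc (suc (double r))

sgn-double : ∀ r → sgn (double r) ≡ 1ℚ
sgn-double zero = refl
sgn-double (suc r) = trans (lem (sgn (double r))) (sgn-double r)
  where
  lem : ∀ a → ⊖ (⊖ a) ≡ a
  lem = solve-∀ ℚ-ring

module _ (x : ℕ → ℚ) where

  incl-excl-1 : ∀ ps → incl-excl 1 x ps ≡ 1ℚ
  incl-excl-1 [] = refl
  incl-excl-1 (p ∷ ps) = trans (cong (_⊖ x p ⊗ 0ℚ) (incl-excl-1 ps)) (lem (x p))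
    where
    lem : ∀ a → 1ℚ ⊖ a ⊗ 0ℚ ≡ 1ℚ
    lem = solve-∀ ℚ-ring

  -- The sums are symmetric in the primes, so any entry may play the part of the head. The induction
  -- compares taking out two entries in either order.
  incl-excl-remove : ∀ t as p bs →
    incl-excl (suc t) x (as ++ p ∷ bs) ≡ incl-excl (suc t) x (as ++ bs) ⊖ x p ⊗ incl-excl t x (as ++ bs)
  incl-excl-remove t [] p bs = refl
  incl-excl-remove zero (a ∷ as) p bs =
    trans (cong (_⊖ x a ⊗ 0ℚ) (incl-excl-remove 0 as p bs)) (lem (incl-excl 1 x (as ++ bs)) (x a) (x p))
    where
    lem : ∀ g a b → g ⊖ b ⊗ 0ℚ ⊖ a ⊗ 0ℚ ≡ g ⊖ a ⊗ 0ℚ ⊖ b ⊗ 0ℚ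
    lem = solve-∀ ℚ-ring
  incl-excl-remove (suc t) (a ∷ as) p bs =
    trans (cong₂ (λ u v → u ⊖ x a ⊗ v) (incl-excl-remove (suc t) as p bs) (incl-excl-remove t as p bs))
      (lem (incl-excl (suc (suc t)) x (as ++ bs)) (incl-excl (suc t) x (as ++ bs)) (incl-excl t x (as ++ bs)) (x a) (x p))
    where
    lem : ∀ g₂ g₁ g₀ a b → g₂ ⊖ b ⊗ g₁ ⊖ a ⊗ (g₁ ⊖ b ⊗ g₀) ≡ g₂ ⊖ a ⊗ g₁ ⊖ b ⊗ (g₁ ⊖ a ⊗ g₀)
    lem = solve-∀ ℚ-ring

  incl-excl-step : ∀ t ps → incl-excl (suc t) x ps ⊖ incl-excl t x ps ≡ sgn t ⊗ esym t x ps
  incl-excl-step zero ps = trans (cong (_⊖ 0ℚ) (incl-excl-1 ps)) refl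
  incl-excl-step (suc t) [] = lem (sgn t)
    where
    lem : ∀ s → 1ℚ ⊖ 1ℚ ≡ (⊖ s) ⊗ 0ℚ
    lem = solve-∀ ℚ-ring
  incl-excl-step (suc t) (p ∷ ps) = begin
    G₂ ⊖ x p ⊗ G₁ ⊖ (G₁ ⊖ x p ⊗ G₀) ≡⟨ lem G₂ G₁ G₀ (x p) ⟩
    (G₂ ⊖ G₁) ⊖ x p ⊗ (G₁ ⊖ G₀) ≡⟨ cong₂ (λ u v → u ⊖ x p ⊗ v) (incl-excl-step (suc t) ps) (incl-excl-step t ps) ⟩
    (⊖ sgn t) ⊗ esym (suc t) x ps ⊖ x p ⊗ (sgn t ⊗ esym t x ps) ≡⟨ lem′ (sgn t) (esym (suc t) x ps) (x p) (esym t x ps) ⟩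
    (⊖ sgn t) ⊗ (esym (suc t) x ps ⊕ x p ⊗ esym t x ps) ∎
    where
    open ≡-Reasoning
    G₂ = incl-excl (suc (suc t)) x ps
    G₁ = incl-excl (suc t) x ps
    G₀ = incl-excl t x ps
    lem : ∀ a b c p → a ⊖ p ⊗ b ⊖ (b ⊖ p ⊗ c) ≡ (a ⊖ b) ⊖ p ⊗ (b ⊖ c)
    lem = solve-∀ ℚ-ring
    lem′ : ∀ s e p f → (⊖ s) ⊗ e ⊖ p ⊗ (s ⊗ f) ≡ (⊖ s) ⊗ (e ⊕ p ⊗ f)
    lem′ = solve-∀ ℚ-ring

  -- Taking out p with x p = 1 leaves the difference of two consecutive partial sums over the other
  -- primes, which is one term; its sign is positive because the index 2r is even.
  incl-excl-hit : ∀ r as p bs → x p ≡ 1ℚ →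
    incl-excl (suc (double r)) x (as ++ p ∷ bs) ≡ esym (double r) x (as ++ bs)
  incl-excl-hit r as p bs xp = begin
    incl-excl (suc t) x (as ++ p ∷ bs) ≡⟨ incl-excl-remove t as p bs ⟩
    incl-excl (suc t) x (as ++ bs) ⊖ x p ⊗ incl-excl t x (as ++ bs)
      ≡⟨ cong (λ a → incl-excl (suc t) x (as ++ bs) ⊖ a) (trans (cong (_⊗ incl-excl t x (as ++ bs)) xp) (ℚ.*-identityˡ (incl-excl t x (as ++ bs)))) ⟩
    incl-excl (suc t) x (as ++ bs) ⊖ incl-excl t x (as ++ bs) ≡⟨ incl-excl-step t (as ++ bs) ⟩
    sgn t ⊗ esym t x (as ++ bs) ≡⟨ trans (cong (_⊗ esym t x (as ++ bs)) (sgn-double r)) (ℚ.*-identityˡ (esym t x (as ++ bs))) ⟩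
    esym t x (as ++ bs) ∎
    where
    open ≡-Reasoning
    t = double r

  module _ (0≼x : ∀ p → 0ℚ ≼ x p) where

    esym-nonneg : ∀ t ps → 0ℚ ≼ esym t x ps
    esym-nonneg zero ps = 0≼1
    esym-nonneg (suc t) [] = ≼-refl
    esym-nonneg (suc t) (p ∷ ps) = 0≼⊕ (esym-nonneg (suc t) ps) (0≼⊗ (0≼x p) (esym-nonneg t ps))

    -- In e_1 e_t every product of t + 1 distinct entries occurs t + 1 times, and the terms with a
    -- repeated entry are non-negative. Iteration gives e_t ≤ e_1^t / t!.
    esym-suc : ∀ t ps → ι (suc t) ⊗ esym (suc t) x ps ≼ Σ ps x ⊗ esym t x ps
    esym-suc t [] = ≼-reflexive (trans (ℚ.*-zeroʳ (ι (suc t))) (sym (ℚ.*-zeroˡ (esym t x []))))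
    esym-suc zero (p ∷ ps) = ≼-by _ (0≼⊖ (esym-suc zero ps))
      (trans (lem (x p) (Σ ps x) (esym 1 x ps)) (cong (λ a → a ⊗ (esym 1 x ps ⊕ x p ⊗ 1ℚ) ⊕ (Σ ps x ⊗ 1ℚ ⊖ a ⊗ esym 1 x ps)) (sym ι1)))
      where
      lem : ∀ p s e → (p ⊕ s) ⊗ 1ℚ ≡ 1ℚ ⊗ (e ⊕ p ⊗ 1ℚ) ⊕ (s ⊗ 1ℚ ⊖ 1ℚ ⊗ e)
      lem = solve-∀ ℚ-ring
    esym-suc (suc t) (p ∷ ps) = ≼-by _
      (0≼⊕ (0≼⊕ (0≼⊖ (esym-suc (suc t) ps)) (0≼⊗ (0≼x p) (0≼⊖ (esym-suc t ps))))
        (0≼⊗ (0≼⊗ (0≼x p) (0≼x p)) (esym-nonneg t ps)))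
      (trans (lem (x p) (Σ ps x) (esym (suc (suc t)) x ps) (esym (suc t) x ps) (esym t x ps) (ι (suc t)))
        (cong (λ a → a ⊗ (esym (suc (suc t)) x ps ⊕ x p ⊗ esym (suc t) x ps) ⊕
          (Σ ps x ⊗ esym (suc t) x ps ⊖ a ⊗ esym (suc (suc t)) x ps ⊕
          x p ⊗ (Σ ps x ⊗ esym t x ps ⊖ ι (suc t) ⊗ esym (suc t) x ps) ⊕ x p ⊗ x p ⊗ esym t x ps))
          (sym (ι-suc (suc t)))))
      where
      lem : ∀ p s e₂ e₁ e₀ k → (p ⊕ s) ⊗ (e₁ ⊕ p ⊗ e₀) ≡ (1ℚ ⊕ k) ⊗ (e₂ ⊕ p ⊗ e₁) ⊕
        (s ⊗ e₁ ⊖ (1ℚ ⊕ k) ⊗ e₂ ⊕ p ⊗ (s ⊗ e₀ ⊖ k ⊗ e₁) ⊕ p ⊗ p ⊗ e₀)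
      lem = solve-∀ ℚ-ring

    module _ (x≼1 : ∀ {p} → Prime p → x p ≼ 1ℚ) where

      survive-nonneg : ∀ ps → All Prime ps → 0ℚ ≼ survive x ps
      survive-nonneg [] _ = 0≼1
      survive-nonneg (p ∷ ps) (pr ∷ prs) = subst (0ℚ ≼_) (lem (x p) (survive x ps)) (0≼⊗ (0≼⊖ (x≼1 pr)) (survive-nonneg ps prs))
        where
        lem : ∀ p s → (1ℚ ⊖ p) ⊗ s ≡ s ⊖ p ⊗ s
        lem = solve-∀ ℚ-ring

      -- Bonferroni's inequalities. A new prime adds x p times the deviation of the sum with one
      -- term fewer, whose opposite sign is offset by the minus in the recursion. Allowing any x in
      -- [0, 1] covers the means `χ̂` as well as the indicators `χ`.
      incl-excl-sign : ∀ t ps → All Prime ps → 0ℚ ≼ sgn t ⊗ (incl-excl (suc t) x ps ⊖ survive x ps)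
      incl-excl-sign t [] _ = ≼-reflexive (sym (ℚ.*-zeroʳ (sgn t)))
      incl-excl-sign zero (p ∷ ps) (pr ∷ prs) = subst (0ℚ ≼_) (lem (incl-excl 1 x ps) (survive x ps) (x p))
        (0≼⊕ (incl-excl-sign zero ps prs) (0≼⊗ (0≼x p) (survive-nonneg ps prs)))
        where
        lem : ∀ g s p → 1ℚ ⊗ (g ⊖ s) ⊕ p ⊗ s ≡ 1ℚ ⊗ (g ⊖ p ⊗ 0ℚ ⊖ (s ⊖ p ⊗ s))
        lem = solve-∀ ℚ-ring
      incl-excl-sign (suc t) (p ∷ ps) (pr ∷ prs) =
        subst (0ℚ ≼_) (lem (sgn t) (incl-excl (suc (suc t)) x ps) (incl-excl (suc t) x ps) (survive x ps) (x p))
        (0≼⊕ (incl-excl-sign (suc t) ps prs) (0≼⊗ (0≼x p) (incl-excl-sign t ps prs)))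
        where
        lem : ∀ u g₂ g₁ s p → (⊖ u) ⊗ (g₂ ⊖ s) ⊕ p ⊗ (u ⊗ (g₁ ⊖ s)) ≡ (⊖ u) ⊗ (g₂ ⊖ p ⊗ g₁ ⊖ (s ⊖ p ⊗ s))
        lem = solve-∀ ℚ-ring

      survive-≼ : ∀ r ps → All Prime ps → survive x ps ≼ incl-excl (suc (double r)) x ps
      survive-≼ r ps prs = ≼-by _ (incl-excl-sign (double r) ps prs)
        (trans (lem (incl-excl (suc (double r)) x ps) (survive x ps))
          (cong (λ a → survive x ps ⊕ a ⊗ (incl-excl (suc (double r)) x ps ⊖ survive x ps)) (sym (sgn-double r))))
        where
        lem : ∀ g s → g ≡ s ⊕ 1ℚ ⊗ (g ⊖ s)
        lem = solve-∀ ℚ-ring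

-- 3^t / t!, where 3 bounds the sum of `χ̂` over a block.
exp-term : ℕ → ℚ
exp-term zero = 1ℚ
exp-term (suc t) = ι 3 ⊗ inv (suc t) ⊗ exp-term t

exp-term-nonneg : ∀ t → 0ℚ ≼ exp-term t
exp-term-nonneg zero = 0≼1
exp-term-nonneg (suc t) = 0≼⊗ (0≼⊗ (ι-nonneg 3) (inv-nonneg (suc t))) (exp-term-nonneg t)

esym-≼ : ∀ {x ps} → (∀ p → 0ℚ ≼ x p) → Σ ps x ≼ ι 3 → ∀ t → esym t x ps ≼ exp-term t
esym-≼ 0≼x h zero = ≼-refl
esym-≼ {x} {ps} 0≼x h (suc t) = subst₂ _≼_ left right
  (⊗-monoˡ (inv-nonneg (suc t)) (≼-trans (esym-suc x 0≼x t ps)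
    (⊗-mono (esym-nonneg x 0≼x t ps) (ι-nonneg 3) h (esym-≼ 0≼x h t))))
  where
  left : inv (suc t) ⊗ (ι (suc t) ⊗ esym (suc t) x ps) ≡ esym (suc t) x ps
  left = trans (sym (ℚ.*-assoc (inv (suc t)) (ι (suc t)) (esym (suc t) x ps)))
    (trans (cong (_⊗ esym (suc t) x ps) (trans (ℚ.*-comm (inv (suc t)) (ι (suc t))) (inv-inverse (suc t)))) (ℚ.*-identityˡ _))
  lem : ∀ a b c → a ⊗ (b ⊗ c) ≡ b ⊗ a ⊗ c
  lem = solve-∀ ℚ-ring
  right : inv (suc t) ⊗ (ι 3 ⊗ exp-term t) ≡ exp-term (suc t)
  right = lem (inv (suc t)) (ι 3) (exp-term t)

prime-coprime : ∀ {p q} → Prime p → Prime q → p ≢ q → Coprime p q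
prime-coprime {p} {q} pr qr p≢q {k} (k∣p , k∣q) with prime⇒irreducible pr k∣p | prime⇒irreducible qr k∣q
... | inj₁ e | _ = e
... | inj₂ _ | inj₁ e = e
... | inj₂ refl | inj₂ refl = contradiction refl p≢q

-- Bounds the error of incl-excl t over l primes, in units of the error of the function it multiplies.
err : ℕ → ℕ → ℕ
err zero l = 0
err (suc t) l = suc (l + l) ^ t

-- A further prime keeps the old error and adds the error of the shorter sum once for each of two
-- residue classes. With b = 1 + 2l this is (b + 2) b^t ≤ (b + 2)^(t+1).
err-step : ∀ t l → err (suc t) l + (err t l + err t l) ≤ err (suc t) (suc l)
err-step zero l = s≤s z≤n
err-step (suc t) l = ≤-trans (≤-reflexive (lem (suc (l + l)) (suc (l + l) ^ t)))
  (*-mono-≤ (≤-reflexive (lem′ l)) (^-monoˡ-≤ t (≤-trans (m≤n+m (suc (l + l)) 2) (≤-reflexive (lem′ l)))))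
  where
  lem : ∀ b c → b * c + (c + c) ≡ (2 + b) * c
  lem = ℕ-Solver.solve-∀
  lem′ : ∀ l → 2 + suc (l + l) ≡ suc (suc l + suc l)
  lem′ = ℕ-Solver.solve-∀

module _ (N X : ℕ) where

  private
    coprime-head : ∀ {p L} → All Prime (p ∷ L) → Unique (p ∷ L) → ∀ {q} → q ∈ L → Coprime q p
    coprime-head (pr ∷ prs) (p≢ ∷ _) i = prime-coprime (All.lookup prs i) pr (λ e → All.lookup p≢ i (sym e))

    combine : ∀ t l {D} → 0ℚ ≼ D → ι (err (suc t) l) ⊗ D ⊕ (ι (err t l) ⊗ D ⊕ ι (err t l) ⊗ D) ≼ ι (err (suc t) (suc l)) ⊗ D
    combine t l {D} h = ≼-trans (≼-reflexive (sym (begin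
      ι (a + (b + b)) ⊗ D ≡⟨ cong (_⊗ D) (trans (ι-+ a (b + b)) (cong (ι a ⊕_) (ι-+ b b))) ⟩
      (ι a ⊕ (ι b ⊕ ι b)) ⊗ D ≡⟨ lem (ι a) (ι b) D ⟩
      ι a ⊗ D ⊕ (ι b ⊗ D ⊕ ι b ⊗ D) ∎))) (⊗-monoʳ h (ι-mono (err-step t l)))
      where
      open ≡-Reasoning
      a = err (suc t) l
      b = err t l
      lem : ∀ a b D → (a ⊕ (b ⊕ b)) ⊗ D ≡ a ⊗ D ⊕ (b ⊗ D ⊕ b ⊗ D)
      lem = solve-∀ ℚ-ring

    unit-≼ : ∀ {a D} → 1 ≤ a → 0ℚ ≼ D → D ≼ ι a ⊗ D
    unit-≼ {a} {D} h k = ≼-trans (≼-reflexive (sym (ℚ.*-identityˡ D))) (⊗-monoʳ k (subst (_≼ ι a) ι1 (ι-mono h)))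

    1≤err : ∀ t l → 1 ≤ err (suc t) l
    1≤err t l = m^n>0 (suc (l + l)) t

  Equi-incl-excl : ∀ t ps {S f d D} → 0ℚ ≼ D → All Prime (ps ++ S) → Unique (ps ++ S) → Equi X S f d D →
    Equi X (ps ++ S) (λ n → incl-excl t (χ N n) ps ⊗ f n) (incl-excl t (χ̂ N) ps ⊗ d) (ι (err t (length ps)) ⊗ D)
  Equi-incl-excl zero ps {S} {f} {d} {D} 0≼D prs uniq h =
    Equi-cong X id (λ n → refl) (sym (ℚ.*-zeroˡ d)) (Equi-weaken X (0≼⊗ (ι-nonneg 0) 0≼D) (Equi-0 X {f = f}))
  Equi-incl-excl (suc t) [] {S} {f} {d} {D} 0≼D prs uniq h =
    Equi-cong X id (λ n → sym (ℚ.*-identityˡ (f n))) (sym (ℚ.*-identityˡ d))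
      (Equi-weaken X (unit-≼ {err (suc t) 0} (1≤err t 0) 0≼D) h)
  Equi-incl-excl (suc t) (p ∷ ps) {S} {f} {d} {D} 0≼D prs@(pr ∷ prs′) uniq@(_ ∷ uniq′) h =
    Equi-weaken X (combine t (length ps) 0≼D)
      (Equi-cong X id (λ n → lem (incl-excl (suc t) (χ N n) ps) (χ N n p) (incl-excl t (χ N n) ps) (f n))
        (lem (incl-excl (suc t) (χ̂ N) ps) (χ̂ N p) (incl-excl t (χ̂ N) ps) d)
        (Equi-⊖ X
          (Equi-cong X there (λ n → refl) refl (Equi-incl-excl (suc t) ps 0≼D prs′ uniq′ h))
          (Equi-χ N {X} {p = p} (prime⇒nonZero pr) (0≼⊗ (ι-nonneg (err t (length ps))) 0≼D) (coprime-head prs uniq)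
            (Equi-incl-excl t ps 0≼D prs′ uniq′ h))))
    where
    lem : ∀ a x b f → a ⊗ f ⊖ x ⊗ (b ⊗ f) ≡ (a ⊖ x ⊗ b) ⊗ f
    lem = solve-∀ ℚ-ring

  Equi-esym : ∀ t ps {S f d D} → 0ℚ ≼ D → All Prime (ps ++ S) → Unique (ps ++ S) → Equi X S f d D →
    Equi X (ps ++ S) (λ n → esym t (χ N n) ps ⊗ f n) (esym t (χ̂ N) ps ⊗ d) (ι (err (suc t) (length ps)) ⊗ D)
  Equi-esym zero ps {S} {f} {d} {D} 0≼D prs uniq h =
    Equi-cong X (∈-++⁺ʳ ps) (λ n → sym (ℚ.*-identityˡ (f n))) (sym (ℚ.*-identityˡ d))
      (Equi-weaken X (unit-≼ {err 1 (length ps)} (1≤err 0 (length ps)) 0≼D) h)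
  Equi-esym (suc t) [] {S} {f} {d} {D} 0≼D prs uniq h =
    Equi-cong X id (λ n → refl) (sym (ℚ.*-zeroˡ d)) (Equi-weaken X (0≼⊗ (ι-nonneg (err (suc (suc t)) 0)) 0≼D) (Equi-0 X {f = f}))
  Equi-esym (suc t) (p ∷ ps) {S} {f} {d} {D} 0≼D prs@(pr ∷ prs′) uniq@(_ ∷ uniq′) h =
    Equi-weaken X (combine (suc t) (length ps) 0≼D)
      (Equi-cong X id (λ n → lem (esym (suc t) (χ N n) ps) (χ N n p) (esym t (χ N n) ps) (f n))
        (lem (esym (suc t) (χ̂ N) ps) (χ̂ N p) (esym t (χ̂ N) ps) d)
        (Equi-⊕ X
          (Equi-cong X there (λ n → refl) refl (Equi-esym (suc t) ps 0≼D prs′ uniq′ h))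
          (Equi-χ N {X} {p = p} (prime⇒nonZero pr) (0≼⊗ (ι-nonneg (err (suc t) (length ps))) 0≼D) (coprime-head prs uniq)
            (Equi-esym t ps 0≼D prs′ uniq′ h))))
    where
    lem : ∀ a x b f → a ⊗ f ⊕ x ⊗ (b ⊗ f) ≡ (a ⊕ x ⊗ b) ⊗ f
    lem = solve-∀ ℚ-ring

-- Chebyshev's estimate

∣!⇒≤ : ∀ {p} n → Prime p → p ∣ n ! → p ≤ n
∣!⇒≤ zero pr h = contradiction (subst Prime (∣1⇒≡1 h) pr) ¬prime[1]
∣!⇒≤ (suc n) pr h with euclidsLemma (suc n) (n !) pr h
... | inj₁ d = ∣⇒≤ d
... | inj₂ d = ≤-trans (∣!⇒≤ n pr d) (n≤1+n n)

∣! : ∀ {p n} → NonZero p → p ≤ n → p ∣ n !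
∣! {suc p} _ h = ∣-trans (m∣m*n (p !)) (m≤n⇒m!∣n! h)

C-* : ∀ n → ((n + n) C n) * (n ! * n !) ≡ (n + n) !
C-* n = trans (cong (_* (n ! * n !)) (nCk≡n!/k![n-k]! n≤))
  (subst (λ j → (_/_ ((n + n) !) (n ! * j !) {{n !* j !≢0}}) * (n ! * n !) ≡ (n + n) !) (sym (m+n∸n≡m n n))
    (m/n*n≡m {{n !* n !≢0}} (subst (λ j → n ! * j ! ∣ (n + n) !) (m+n∸n≡m n n) (k![n∸k]!∣n! n≤))))
  where
  n≤ = m≤m+n n n

C≤2^ : ∀ n k → n C k ≤ 2 ^ n
C≤2^ zero zero = ≤-refl
C≤2^ zero (suc k) = z≤n
C≤2^ (suc n) zero = subst (_≤ 2 ^ suc n) (sym (trans (nCk≡nC[n∸k] {0} {suc n} z≤n) (nCn≡1 (suc n)))) (m^n>0 2 (suc n))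
C≤2^ (suc n) (suc k) = subst₂ _≤_ (nCk+nC[k+1]≡[n+1]C[k+1] n k) (cong (2 ^ n +_) (sym (+-identityʳ (2 ^ n))))
  (+-mono-≤ (C≤2^ n k) (C≤2^ n (suc k)))

-- p divides (2n)! but, exceeding n, does not divide n!.
∣C : ∀ {p} n → Prime p → n < p → p ≤ n + n → p ∣ (n + n) C n
∣C {p} n pr n<p p≤2n with euclidsLemma ((n + n) C n) (n ! * n !) pr
    (subst (p ∣_) (sym (C-* n)) (∣! (prime⇒nonZero pr) p≤2n))
... | inj₁ h = h
... | inj₂ h with euclidsLemma (n !) (n !) pr h
...   | inj₁ d = contradiction (∣!⇒≤ n pr d) (<⇒≱ n<p)
...   | inj₂ d = contradiction (∣!⇒≤ n pr d) (<⇒≱ n<p)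

product-∣ : ∀ {M} ps → All Prime ps → Unique ps → All (_∣ M) ps → product ps ∣ M
product-∣ [] _ _ _ = 1∣ _
product-∣ (p ∷ ps) (pr ∷ prs) (p≢ ∷ uniq) (d ∷ ds) = coprime-∣-* cop d (product-∣ ps prs uniq ds)
  where
  cop : Coprime p (product ps)
  cop {k} (k∣p , k∣) with prime⇒irreducible pr k∣p
  ... | inj₁ e = e
  ... | inj₂ refl = contradiction refl (All.lookup p≢ (factorisationHasAllPrimeFactors pr k∣ prs))

shell : ℕ → List ℕ
shell k = filter prime? (map (2 ^ k +_) (downFrom (2 ^ k)))

2^suc : ∀ k → 2 ^ suc k ≡ 2 ^ k + 2 ^ k
2^suc k = cong (2 ^ k +_) (+-identityʳ (2 ^ k))

∈-shell : ∀ {k p} → p ∈ shell k → Prime p × 2 ^ k ≤ p × p < 2 ^ suc k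
∈-shell {k} i with ∈-filter⁻ prime? {xs = map (2 ^ k +_) (downFrom (2 ^ k))} i
... | j , pr with ∈-map⁻ (2 ^ k +_) j
...   | l , l∈ , refl = pr , m≤m+n (2 ^ k) l ,
        subst (2 ^ k + l <_) (sym (2^suc k)) (+-monoʳ-< (2 ^ k) (∈-downFrom⁻ l∈))

∈-shell⁺ : ∀ {k p} → Prime p → 2 ^ k ≤ p → p < 2 ^ suc k → p ∈ shell k
∈-shell⁺ {k} {p} pr lo hi with m≤n⇒∃[o]m+o≡n lo
... | l , refl = ∈-filter⁺ prime? (∈-map⁺ (2 ^ k +_) (∈-downFrom⁺
  (+-cancelˡ-< (2 ^ k) l (2 ^ k) (subst (2 ^ k + l <_) (2^suc k) hi)))) pr

shell-unique : ∀ k → Unique (shell k)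
shell-unique k = Unique.filter⁺ prime? (Unique.map⁺ (λ {x} {y} → +-cancelˡ-≡ (2 ^ k) x y) (Unique.downFrom⁺ (2 ^ k)))

-- For k ≥ 2 the power 2^k has the proper divisor 2. Strictness is wanted twice: in `∣C`, and to get
-- p - 1 ≥ 2^k.
prime>2^ : ∀ {k p} → 2 ≤ k → Prime p → 2 ^ k ≤ p → 2 ^ k < p
prime>2^ {k} 2≤k pr h with m≤n⇒m<n∨m≡n h
... | inj₁ lt = lt
prime>2^ {suc (suc k)} 2≤k pr h | inj₂ refl with prime⇒irreducible pr (m∣m*n {2} (2 ^ suc k))
... | inj₁ ()
... | inj₂ e = contradiction e (<⇒≢ (≤-trans (n≤1+n 3) (*-monoʳ-≤ 2 (^-monoʳ-≤ 2 (s≤s (z≤n {k}))))))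
prime>2^ {suc zero} (s≤s ()) pr h | inj₂ refl

All-shell : ∀ k → All Prime (shell k)
All-shell k = All.tabulate (λ i → proj₁ (∈-shell {k} i))

^-length≤product : ∀ {b} ps → All (b ≤_) ps → b ^ length ps ≤ product ps
^-length≤product [] _ = ≤-refl
^-length≤product (p ∷ ps) (h ∷ hs) = *-mono-≤ h (^-length≤product ps hs)

2^-cancel-≤ : ∀ {a b} → 2 ^ a ≤ 2 ^ b → a ≤ b
2^-cancel-≤ {a} {b} h with a ≤? b
... | yes p = p
... | no q = contradiction h (<⇒≱ (^-monoʳ-< 2 (s≤s (s≤s z≤n)) (≰⇒> q)))

2^-cancel-< : ∀ {a b} → 2 ^ a < 2 ^ b → a < b
2^-cancel-< {a} {b} h with b ≤? a
... | yes p = contradiction (^-monoʳ-≤ 2 p) (<⇒≱ h)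
... | no q = ≰⇒> q

-- Erdős's argument: the product of the primes in the shell divides a central binomial coefficient,
-- and the exponents of 2 are compared.
chebyshev : ∀ {k} → 2 ≤ k → k * length (shell k) ≤ 2 ^ suc k
chebyshev {k} 2≤k = 2^-cancel-≤ (begin
  2 ^ (k * length (shell k)) ≡⟨ sym (^-*-assoc 2 k (length (shell k))) ⟩
  (2 ^ k) ^ length (shell k) ≤⟨ ^-length≤product (shell k) (All.tabulate (λ i → proj₁ (proj₂ (∈-shell {k} i)))) ⟩
  product (shell k) ≤⟨ ∣⇒≤ {{C≢0}} (product-∣ (shell k) (All-shell k) (shell-unique k) (All.tabulate divs)) ⟩
  (2 ^ k + 2 ^ k) C 2 ^ k ≤⟨ C≤2^ (2 ^ k + 2 ^ k) (2 ^ k) ⟩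
  2 ^ (2 ^ k + 2 ^ k) ≡⟨ cong (2 ^_) (sym (2^suc k)) ⟩
  2 ^ (2 ^ suc k) ∎)
  where
  open ≤-Reasoning
  C≢0 : NonZero ((2 ^ k + 2 ^ k) C 2 ^ k)
  C≢0 = m*n≢0⇒m≢0 _ {{subst NonZero (sym (C-* (2 ^ k))) ((2 ^ k + 2 ^ k) !≢0)}}
  divs : ∀ {p} → p ∈ shell k → p ∣ (2 ^ k + 2 ^ k) C 2 ^ k
  divs {p} i with ∈-shell {k} i
  ... | pr , lo , hi = ∣C (2 ^ k) pr (prime>2^ 2≤k pr lo) (subst (p ≤_) (2^suc k) (<⇒≤ hi))

-- 1/(p-1) rather than 1/p, because it is the sum of the series p^-1 + p^-2 + ... that bounds the
-- mean of v_p.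
Σ-shell : ∀ {k} → 2 ≤ k → Σ (shell k) (λ p → inv (pred p)) ≼ ι 2 ⊗ inv k
Σ-shell {k} 2≤k = ≼-trans (Σ-mono (shell k) bound)
  (≼-trans (≼-reflexive (Σ-const (shell k) (inv (2 ^ k))))
    (frac-≼ (length (shell k)) 2 (2 ^ k) k {{m^n≢0 2 k}} {{>-nonZero (≤-trans (s≤s z≤n) 2≤k)}}
      (subst (_≤ 2 * 2 ^ k) (*-comm k (length (shell k))) (chebyshev 2≤k))))
  where
  bound : ∀ {p} → p ∈ shell k → inv (pred p) ≼ inv (2 ^ k)
  bound i with ∈-shell {k} i
  ... | pr , lo , hi = inv-anti {{m^n≢0 2 k}} (<⇒≤pred (prime>2^ 2≤k pr lo))

range : ℕ → ℕ → List ℕ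
range a zero = []
range a (suc l) = shell (a + l) ++ range a l

∈-range : ∀ {a} l {p} → p ∈ range a l → Prime p × 2 ^ a ≤ p × p < 2 ^ (a + l)
∈-range {a} (suc l) {p} i with ∈-++⁻ (shell (a + l)) i
... | inj₁ j with ∈-shell {a + l} j
...   | pr , lo , hi = pr , ≤-trans (^-monoʳ-≤ 2 (m≤m+n a l)) lo , subst (λ e → p < 2 ^ e) (sym (+-suc a l)) hi
∈-range {a} (suc l) {p} i | inj₂ j with ∈-range {a} l j
...   | pr , lo , hi = pr , lo , <-≤-trans hi (^-monoʳ-≤ 2 (+-monoʳ-≤ a (n≤1+n l)))

∈-range⁺ : ∀ {a} l {p} → Prime p → 2 ^ a ≤ p → p < 2 ^ (a + l) → p ∈ range a l
∈-range⁺ {a} zero {p} pr lo hi = contradiction lo (<⇒≱ (subst (λ e → p < 2 ^ e) (+-identityʳ a) hi))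
∈-range⁺ {a} (suc l) {p} pr lo hi with p <? 2 ^ (a + l)
... | yes lt = ∈-++⁺ʳ (shell (a + l)) (∈-range⁺ l pr lo lt)
... | no ge = ∈-++⁺ˡ (∈-shell⁺ {a + l} pr (≮⇒≥ ge) (subst (λ e → p < 2 ^ e) (+-suc a l) hi))

All-range : ∀ a l → All Prime (range a l)
All-range a l = All.tabulate (λ i → proj₁ (∈-range {a} l i))

range-unique : ∀ a l → Unique (range a l)
range-unique a zero = []
range-unique a (suc l) = Unique.++⁺ (shell-unique (a + l)) (range-unique a l)
  (λ (i , j) → contradiction (proj₁ (proj₂ (∈-shell {a + l} i))) (<⇒≱ (proj₂ (proj₂ (∈-range {a} l j)))))

length-shell : ∀ k → 4 ≤ k → 2 * length (shell k) ≤ 2 ^ k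
length-shell k 4≤k = *-cancelˡ-≤ 2 (begin
  2 * (2 * length (shell k)) ≡⟨ sym (*-assoc 2 2 (length (shell k))) ⟩
  4 * length (shell k) ≤⟨ *-monoˡ-≤ (length (shell k)) 4≤k ⟩
  k * length (shell k) ≤⟨ chebyshev (≤-trans (s≤s (s≤s z≤n)) 4≤k) ⟩
  2 * 2 ^ k ∎)
  where open ≤-Reasoning

-- The factor 2 and the summand 2^a are there for `err-block`, where 1 + 2l must fit below 2^(2a).
length-range : ∀ a l → 4 ≤ a → 2 * length (range a l) + 2 ^ a ≤ 2 ^ (a + l)
length-range a zero h = ≤-reflexive (cong (2 ^_) (sym (+-identityʳ a)))
length-range a (suc l) h = begin
  2 * length (shell (a + l) ++ range a l) + 2 ^ a ≡⟨ cong (λ n → 2 * n + 2 ^ a) (length-++ (shell (a + l))) ⟩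
  2 * (length (shell (a + l)) + length (range a l)) + 2 ^ a ≡⟨ lem (length (shell (a + l))) (length (range a l)) (2 ^ a) ⟩
  2 * length (shell (a + l)) + (2 * length (range a l) + 2 ^ a)
    ≤⟨ +-mono-≤ (length-shell (a + l) (≤-trans h (m≤m+n a l))) (length-range a l h) ⟩
  2 ^ (a + l) + 2 ^ (a + l) ≡⟨ sym (2^suc (a + l)) ⟩
  2 ^ suc (a + l) ≡⟨ cong (2 ^_) (sym (+-suc a l)) ⟩
  2 ^ (a + suc l) ∎
  where
  open ≤-Reasoning
  lem : ∀ x y z → 2 * (x + y) + z ≡ 2 * x + (2 * y + z)
  lem = ℕ-Solver.solve-∀

log₂-bounds : ∀ n .{{_ : NonZero n}} → ∃ λ k → 2 ^ k ≤ n × n < 2 ^ suc k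
log₂-bounds (suc zero) = 0 , ≤-refl , s≤s (s≤s z≤n)
log₂-bounds (suc (suc n)) with log₂-bounds (suc n)
... | k , lo , hi with suc (suc n) <? 2 ^ suc k
...   | yes lt = k , ≤-trans lo (n≤1+n _) , lt
...   | no ge = suc k , ≮⇒≥ ge , <-≤-trans (s≤s hi)
        (≤-trans (m<m+n (2 ^ suc k) (m^n>0 2 (suc k))) (≤-reflexive (sym (2^suc (suc k)))))

-- Harmonic sums

harm : ℕ → ℕ → ℚ
harm a zero = 0ℚ
harm a (suc l) = inv (a + l) ⊕ harm a l

Σ-range : ∀ a l → 2 ≤ a → Σ (range a l) (λ p → inv (pred p)) ≼ ι 2 ⊗ harm a l
Σ-range a zero h = ≼-reflexive (sym (ℚ.*-zeroʳ (ι 2)))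
Σ-range a (suc l) h = subst₂ _≼_ (sym (Σ-++ (shell (a + l)) (range a l))) (sym (ℚ.*-distribˡ-+ (ι 2) (inv (a + l)) (harm a l)))
  (⊕-mono (Σ-shell {a + l} (≤-trans h (m≤m+n a l))) (Σ-range a l h))

harm-first : ∀ a l → harm a (suc l) ≡ inv a ⊕ harm (suc a) l
harm-first a zero = cong (λ b → inv b ⊕ 0ℚ) (+-identityʳ a)
harm-first a (suc l) = begin
  inv (a + suc l) ⊕ harm a (suc l) ≡⟨ cong₂ _⊕_ (cong inv (+-suc a l)) (harm-first a l) ⟩
  inv (suc a + l) ⊕ (inv a ⊕ harm (suc a) l) ≡⟨ lem (inv (suc a + l)) (inv a) (harm (suc a) l) ⟩
  inv a ⊕ (inv (suc a + l) ⊕ harm (suc a) l) ∎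
  where
  open ≡-Reasoning
  lem : ∀ x y z → x ⊕ (y ⊕ z) ≡ y ⊕ (x ⊕ z)
  lem = solve-∀ ℚ-ring

harm-tail : ∀ b .{{_ : NonZero b}} m l → harm b (m + l) ≼ ι m ⊗ inv (b + l) ⊕ harm b l
harm-tail b zero l = ≼-reflexive (sym (trans (cong (λ z → z ⊗ inv (b + l) ⊕ harm b l) ι0) (lem (inv (b + l)) (harm b l))))
  where
  lem : ∀ v h → 0ℚ ⊗ v ⊕ h ≡ h
  lem = solve-∀ ℚ-ring
harm-tail b (suc m) l = ≼-trans
  (⊕-mono (inv-anti {{>-nonZero (≤-trans (>-nonZero⁻¹ b) (m≤m+n b l))}} (+-monoʳ-≤ b (m≤n+m l m))) (harm-tail b m l))
  (≼-reflexive (trans (lem (inv (b + l)) (ι m) (harm b l)) (cong (λ z → z ⊗ inv (b + l) ⊕ harm b l) (sym (ι-suc m)))))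
  where
  lem : ∀ v m h → v ⊕ (m ⊗ v ⊕ h) ≡ (1ℚ ⊕ m) ⊗ v ⊕ h
  lem = solve-∀ ℚ-ring

-- Passing from a to a+1 drops 1/a and adds r+1 terms, each at most 1/((r+1)a).
harm-decreasing : ∀ r a .{{_ : NonZero r}} .{{_ : NonZero a}} → harm (suc a) (r * suc a) ≼ harm a (r * a)
harm-decreasing r a = go (pred (r * a)) (sym (suc-pred (r * a) {{m*n≢0 r a}}))
  where
  go : ∀ l → r * a ≡ suc l → harm (suc a) (r * suc a) ≼ harm a (r * a)
  go l eq = subst₂ (λ m n → harm (suc a) m ≼ harm a n) len (sym eq)
    (≼-trans (harm-tail (suc a) (suc r) l) (≼-reflexive (trans (cong (_⊕ harm (suc a) l) unit) (sym (harm-first a l)))))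
    where
    len : suc r + l ≡ r * suc a
    len = trans (sym (+-suc r l)) (trans (cong (r +_) (sym eq)) (sym (*-suc r a)))
    unit : ι (suc r) ⊗ inv (suc a + l) ≡ inv a
    unit = begin
      ι (suc r) ⊗ inv (suc a + l) ≡⟨ cong (λ n → ι (suc r) ⊗ inv n) (trans (sym (+-suc a l)) (cong (a +_) (sym eq))) ⟩
      ι (suc r) ⊗ inv (suc r * a) ≡⟨ cong (ι (suc r) ⊗_) (inv-* (suc r) a) ⟩
      ι (suc r) ⊗ (inv (suc r) ⊗ inv a) ≡⟨ sym (ℚ.*-assoc (ι (suc r)) (inv (suc r)) (inv a)) ⟩
      ι (suc r) ⊗ inv (suc r) ⊗ inv a ≡⟨ cong (_⊗ inv a) (inv-inverse (suc r)) ⟩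
      1ℚ ⊗ inv a ≡⟨ ℚ.*-identityˡ (inv a) ⟩
      inv a ∎
      where open ≡-Reasoning

-- Reduces all scales to the smallest one, 6, where the sum is a finite computation.
harm-anti : ∀ r {a b} .{{_ : NonZero r}} .{{_ : NonZero a}} → a ≤ b → harm b (r * b) ≼ harm a (r * a)
harm-anti r {a@(suc _)} h with m≤n⇒∃[o]m+o≡n h
... | k , refl = go k
  where
  go : ∀ k → harm (a + k) (r * (a + k)) ≼ harm a (r * a)
  go zero = ≼-reflexive (cong (λ b → harm b (r * b)) (+-identityʳ a))
  go (suc k) = ≼-trans (≼-reflexive (cong (λ b → harm b (r * b)) (+-suc a k)))
    (≼-trans (harm-decreasing r (a + k)) (go k))

inv-ceil : ∀ k s .{{_ : NonZero k}} .{{_ : NonZero s}} → inv k ≼ ι (suc (s / k)) ⊗ inv s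
inv-ceil k s = ≼-trans (≼-reflexive (sym (trans (cong (_⊗ inv k) ι1) (ℚ.*-identityˡ (inv k)))))
  (frac-≼ 1 (suc (s / k)) k s (begin
    1 * s ≡⟨ *-identityˡ s ⟩
    s ≡⟨ m≡m%n+[m/n]*n s k ⟩
    s % k + s / k * k ≤⟨ +-monoˡ-≤ (s / k * k) (<⇒≤ (m%n<n s k)) ⟩
    suc (s / k) * k ∎))
  where open ≤-Reasoning

-- Every term is rounded up to a multiple of 1/s, which turns the sum into a natural number that can
-- be evaluated.
harm-ceil : ℕ → ℕ → ℕ → ℕ
harm-ceil s a zero = 0
harm-ceil s a (suc l) = suc (s / suc (a + l)) + harm-ceil s a l

harm-≼-ceil : ∀ s .{{_ : NonZero s}} a l → harm (suc a) l ≼ ι (harm-ceil s a l) ⊗ inv s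
harm-≼-ceil s a zero = ≼-reflexive (sym (trans (cong (_⊗ inv s) ι0) (ℚ.*-zeroˡ (inv s))))
harm-≼-ceil s a (suc l) = ≼-trans (⊕-mono (inv-ceil (suc (a + l)) s) (harm-≼-ceil s a l))
  (≼-reflexive (sym (trans (cong (_⊗ inv s) (ι-+ (suc (s / suc (a + l))) (harm-ceil s a l)))
    (ℚ.*-distribʳ-+ (inv s) (ι (suc (s / suc (a + l)))) (ι (harm-ceil s a l))))))

frac-decide : ∀ a b m n .{{_ : NonZero m}} .{{_ : NonZero n}} → True (a * n ≤? b * m) → ι a ⊗ inv m ≼ ι b ⊗ inv n
frac-decide a b m n t = frac-≼ a b m n (toWitness t)

-- The worst case is a = 6, where 1/6 + ... + 1/11 is about 0.737.
harm-block : ∀ {a} → 6 ≤ a → harm a a ≼ ι 3 ⊗ inv 4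
harm-block {a} h = ≼-trans (≼-reflexive (cong (harm a) (sym (+-identityʳ a))))
  (≼-trans (harm-anti 1 h) (≼-trans (harm-≼-ceil 10000 5 6) (frac-decide (harm-ceil 10000 5 6) 3 10000 4 _)))

Σ-range-block : ∀ {a} → 6 ≤ a → Σ (range a a) (λ p → inv (pred p)) ≼ ι 3 ⊗ inv 2
Σ-range-block {a} h = ≼-trans (Σ-range a a (≤-trans (s≤s (s≤s z≤n)) h))
  (≼-trans (⊗-monoˡ (ι-nonneg 2) (harm-block h))
    (≼-trans (≼-reflexive (trans (sym (ℚ.*-assoc (ι 2) (ι 3) (inv 4))) (cong (_⊗ inv 4) (sym (ι-* 2 3)))))
      (frac-decide 6 3 4 2 _)))

-- Mass and survival probability of a block

module _ (N : ℕ) where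

  χ̂≼inv-pred : ∀ {p} → Prime p → χ̂ N p ≼ inv (pred p) ⊕ inv (pred p)
  χ̂≼inv-pred {p} pr = ≼-trans (χ̂-≼ N p) (⊕-mono le le)
    where
    le : inv p ≼ inv (pred p)
    le = inv-anti {{>-nonZero (<⇒≤pred (nonTrivial⇒n>1 p {{prime⇒nonTrivial pr}}))}} pred[n]≤n

  Σ-χ̂ : ∀ ps → All Prime ps → Σ ps (χ̂ N) ≼ Σ ps (λ p → inv (pred p)) ⊕ Σ ps (λ p → inv (pred p))
  Σ-χ̂ ps prs = ≼-trans (Σ-mono ps (λ i → χ̂≼inv-pred (All.lookup prs i))) (≼-reflexive (Σ-⊕ ps))

  Σ-χ̂-block : ∀ {a} → 6 ≤ a → Σ (range a a) (χ̂ N) ≼ ι 3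
  Σ-χ̂-block {a} h = ≼-trans (Σ-χ̂ (range a a) (All-range a a)) (≼-trans (⊕-mono (Σ-range-block h) (Σ-range-block h))
    (≼-reflexive (trans (lem (ι 3) (inv 2)) (trans (cong (λ z → ι 3 ⊗ (z ⊗ inv 2)) two) (trans (cong (ι 3 ⊗_) (inv-inverse 2)) (ℚ.*-identityʳ (ι 3)))))))
    where
    lem : ∀ a b → a ⊗ b ⊕ a ⊗ b ≡ a ⊗ ((1ℚ ⊕ 1ℚ) ⊗ b)
    lem = solve-∀ ℚ-ring
    two : 1ℚ ⊕ 1ℚ ≡ ι 2
    two = sym (trans (ι-suc 1) (cong (1ℚ ⊕_) ι1))

  χ̂≼1 : ∀ {p} → Prime p → χ̂ N p ≼ 1ℚ
  χ̂≼1 {p} pr = ≼-trans (χ̂-≼ N p) (≼-trans (⊕-mono half half) (≼-reflexive (trans (lem (inv 2)) (trans (cong (_⊗ inv 2) two) (inv-inverse 2)))))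
    where
    half : inv p ≼ inv 2
    half = inv-anti (nonTrivial⇒n>1 p {{prime⇒nonTrivial pr}})
    lem : ∀ b → b ⊕ b ≡ (1ℚ ⊕ 1ℚ) ⊗ b
    lem = solve-∀ ℚ-ring
    two : 1ℚ ⊕ 1ℚ ≡ ι 2
    two = sym (trans (ι-suc 1) (cong (1ℚ ⊕_) ι1))

survive-++ : ∀ x ps qs → survive x (ps ++ qs) ≡ survive x ps ⊗ survive x qs
survive-++ x [] qs = sym (ℚ.*-identityˡ (survive x qs))
survive-++ x (p ∷ ps) qs = trans (cong (λ z → z ⊖ x p ⊗ z) (survive-++ x ps qs)) (lem (survive x ps) (survive x qs) (x p))
  where
  lem : ∀ a b p → a ⊗ b ⊖ p ⊗ (a ⊗ b) ≡ (a ⊖ p ⊗ a) ⊗ b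
  lem = solve-∀ ℚ-ring

module _ {x : ℕ → ℚ} (0≼x : ∀ p → 0ℚ ≼ x p) (x≼1 : ∀ {p} → Prime p → x p ≼ 1ℚ) where

  survive≼1 : ∀ ps → All Prime ps → survive x ps ≼ 1ℚ
  survive≼1 [] _ = ≼-refl
  survive≼1 (p ∷ ps) (pr ∷ prs) = ≼-by _
    (0≼⊕ (0≼⊖ (survive≼1 ps prs)) (0≼⊗ (0≼x p) (survive-nonneg x 0≼x x≼1 ps prs))) (lem (survive x ps) (x p))
    where
    lem : ∀ s p → 1ℚ ≡ s ⊖ p ⊗ s ⊕ (1ℚ ⊖ s ⊕ p ⊗ s)
    lem = solve-∀ ℚ-ring

  survive-bernoulli : ∀ ps → All Prime ps → 1ℚ ⊖ Σ ps x ≼ survive x ps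
  survive-bernoulli [] _ = ≼-reflexive (ℚ.+-identityʳ 1ℚ)
  survive-bernoulli (p ∷ ps) (pr ∷ prs) = ≼-by _
    (0≼⊕ (0≼⊖ (survive-bernoulli ps prs)) (0≼⊗ (0≼x p) (0≼⊖ (survive≼1 ps prs)))) (lem (survive x ps) (x p) (Σ ps x))
    where
    lem : ∀ s p t → s ⊖ p ⊗ s ≡ 1ℚ ⊖ (p ⊕ t) ⊕ (s ⊖ (1ℚ ⊖ t) ⊕ p ⊗ (1ℚ ⊖ s))
    lem = solve-∀ ℚ-ring

-- The product of c / (c + 4) over b ≤ c < b + l is `rising₄ b` divided by `rising₄ (b + l)`.
rising₄ : ℕ → ℕ
rising₄ b = b * (1 + b) * (2 + b) * (3 + b)

rising₄≢0 : ∀ b .{{_ : NonZero b}} → NonZero (rising₄ b)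
rising₄≢0 (suc b) = _

module _ (N : ℕ) where

  -- Each shell survives with probability at least 1 - 4/k = (k-4)/k, and the product over k telescopes.
  survive-range : ∀ b .{{_ : NonZero b}} l →
    ι (rising₄ b) ⊗ inv (rising₄ (l + b)) ≼ survive (χ̂ N) (range (4 + b) l)
  survive-range b zero = ≼-reflexive (inv-inverse (rising₄ b) {{rising₄≢0 b}})
  survive-range b (suc l) = ≼-trans (≼-reflexive split) (≼-trans
    (⊗-mono (0≼⊗ (ι-nonneg (rising₄ b)) (inv-nonneg (rising₄ c))) (survive-nonneg (χ̂ N) (χ̂-nonneg N) (χ̂≼1 N) (shell k) (All-shell k))
      one-shell (survive-range b l))
    (≼-reflexive (sym (survive-++ (χ̂ N) (shell k) (range (4 + b) l)))))
    where
    c = l + b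
    k = 4 + b + l
    k≡ : k ≡ 4 + c
    k≡ = cong (4 +_) (+-comm b l)
    instance
      c≢0 : NonZero c
      c≢0 = >-nonZero (≤-trans (>-nonZero⁻¹ b) (m≤n+m b l))
      rc≢0 : NonZero (rising₄ c)
      rc≢0 = rising₄≢0 c
      rsc≢0 : NonZero (rising₄ (suc c))
      rsc≢0 = rising₄≢0 (suc c)
    shell-mass : Σ (shell k) (χ̂ N) ≼ ι 4 ⊗ inv k
    shell-mass = ≼-trans (Σ-χ̂ N (shell k) (All-shell k)) (≼-trans (⊕-mono (Σ-shell {k} (s≤s (s≤s z≤n))) (Σ-shell {k} (s≤s (s≤s z≤n))))
      (≼-reflexive (trans (sym (ℚ.*-distribʳ-+ (inv k) (ι 2) (ι 2))) (cong (_⊗ inv k) (sym (ι-+ 2 2))))))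
    one-shell : ι c ⊗ inv k ≼ survive (χ̂ N) (shell k)
    one-shell = ≼-trans (≼-by _ (0≼⊖ shell-mass) (trans (cong (_⊖ Σ (shell k) (χ̂ N)) (sym (inv-inverse k)))
        (trans (cong (λ z → z ⊗ inv k ⊖ Σ (shell k) (χ̂ N)) (trans (cong ι k≡) (ι-+ 4 c))) (lem (ι 4) (ι c) (inv k) (Σ (shell k) (χ̂ N))))))
      (survive-bernoulli (χ̂-nonneg N) (χ̂≼1 N) (shell k) (All-shell k))
      where
      lem : ∀ f c v s → (f ⊕ c) ⊗ v ⊖ s ≡ c ⊗ v ⊕ (f ⊗ v ⊖ s)
      lem = solve-∀ ℚ-ring
    telescope : c * rising₄ (suc c) ≡ (4 + c) * rising₄ c
    telescope = lem c
      where
      lem : ∀ c → c * ((1 + c) * (1 + (1 + c)) * (2 + (1 + c)) * (3 + (1 + c))) ≡ (4 + c) * (c * (1 + c) * (2 + c) * (3 + c))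
      lem = ℕ-Solver.solve-∀
    frac : inv (rising₄ (suc c)) ≡ ι c ⊗ inv k ⊗ inv (rising₄ c)
    frac = begin
      inv (rising₄ (suc c)) ≡⟨ sym (ℚ.*-identityˡ (inv (rising₄ (suc c)))) ⟩
      1ℚ ⊗ inv (rising₄ (suc c)) ≡⟨ cong (_⊗ inv (rising₄ (suc c))) (sym (inv-inverse c)) ⟩
      ι c ⊗ inv c ⊗ inv (rising₄ (suc c)) ≡⟨ ℚ.*-assoc (ι c) (inv c) (inv (rising₄ (suc c))) ⟩
      ι c ⊗ (inv c ⊗ inv (rising₄ (suc c))) ≡⟨ cong (ι c ⊗_) (sym (inv-* c (rising₄ (suc c)))) ⟩
      ι c ⊗ inv (c * rising₄ (suc c)) ≡⟨ cong (λ z → ι c ⊗ inv z) telescope ⟩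
      ι c ⊗ inv ((4 + c) * rising₄ c) ≡⟨ cong (ι c ⊗_) (inv-* (4 + c) (rising₄ c)) ⟩
      ι c ⊗ (inv (4 + c) ⊗ inv (rising₄ c)) ≡⟨ cong (λ z → ι c ⊗ (inv z ⊗ inv (rising₄ c))) (sym k≡) ⟩
      ι c ⊗ (inv k ⊗ inv (rising₄ c)) ≡⟨ sym (ℚ.*-assoc (ι c) (inv k) (inv (rising₄ c))) ⟩
      ι c ⊗ inv k ⊗ inv (rising₄ c) ∎
      where open ≡-Reasoning
    split : ι (rising₄ b) ⊗ inv (rising₄ (suc c)) ≡ ι c ⊗ inv k ⊗ (ι (rising₄ b) ⊗ inv (rising₄ c))
    split = trans (cong (ι (rising₄ b) ⊗_) frac) (lem (ι (rising₄ b)) (ι c ⊗ inv k) (inv (rising₄ c)))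
      where
      lem : ∀ r a v → r ⊗ (a ⊗ v) ≡ a ⊗ (r ⊗ v)
      lem = solve-∀ ℚ-ring

  -- 66 = (8 · 9 · 10 · 11) / (2 · 3 · 4 · 5) is exact at a = 6. For a = 6 + j the difference of the
  -- two sides, cleared of denominators, is a polynomial in j with non-negative coefficients.
  survive-block : ∀ {a} → 6 ≤ a → inv 66 ≼ survive (χ̂ N) (range a a)
  survive-block {a} h with m≤n⇒∃[o]m+o≡n h
  ... | j , refl = ≼-trans (≼-trans (≼-reflexive (sym (trans (cong (_⊗ inv 66) ι1) (ℚ.*-identityˡ (inv 66)))))
      (frac-≼ 1 (rising₄ b) 66 (rising₄ (a + b)) {{_}} {{rising₄≢0 (a + b)}} (≤-by _ (lem j))))
      (survive-range b a)
    where
    b = 2 + j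
    lem : ∀ j → (2 + j) * (3 + j) * (4 + j) * (5 + j) * 66 ≡
      1 * ((6 + j + (2 + j)) * (1 + (6 + j + (2 + j))) * (2 + (6 + j + (2 + j))) * (3 + (6 + j + (2 + j)))) +
      j * (50 * (j * (j * j)) + 620 * (j * j) + 2530 * j + 3400)
    lem = ℕ-Solver.solve-∀

-- The sieve weight

module _ (w : ℕ) where

  scale : ℕ → ℕ
  scale i = w * 2 ^ i

  block : ℕ → List ℕ
  block i = range (scale i) (scale i)

  sieving : ℕ → List ℕ
  sieving zero = []
  sieving (suc i) = block i ++ sieving i

  -- Cutting one term pair later on each lower block makes the losses of the blocks a geometric series.
  θ : ℕ → ℕ → (ℕ → ℚ) → ℚ
  θ zero r x = 1ℚ
  θ (suc i) r x = incl-excl (suc (double r)) x (block i) ⊗ θ i (suc r) x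

  -- Base-2 logarithm of the error of the weight: at scale a a block multiplies the error by at most
  -- (1 + 2l)^(2r) ≤ (2^(2a))^(2r), l being its number of primes.
  level : ℕ → ℕ → ℕ
  level zero r = 0
  level (suc i) r = (scale i + scale i) * double r + level i (suc r)

  scale-suc : ∀ i → scale (suc i) ≡ scale i + scale i
  scale-suc i = trans (cong (w *_) (2^suc i)) (*-distribˡ-+ w (2 ^ i) (2 ^ i))

  w≤scale : ∀ i → w ≤ scale i
  w≤scale i = m≤m*n w (2 ^ i) {{m^n≢0 2 i}}

  ∈-block : ∀ i {p} → p ∈ block i → Prime p × 2 ^ scale i ≤ p × p < 2 ^ scale (suc i)
  ∈-block i {p} j with ∈-range {scale i} (scale i) j
  ... | pr , lo , hi = pr , lo , subst (λ e → p < 2 ^ e) (sym (scale-suc i)) hi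

  ∈-sieving : ∀ i {p} → p ∈ sieving i → Prime p × 2 ^ w ≤ p × p < 2 ^ scale i
  ∈-sieving (suc i) j with ∈-++⁻ (block i) j
  ... | inj₁ k with ∈-block i k
  ...   | pr , lo , hi = pr , ≤-trans (^-monoʳ-≤ 2 (w≤scale i)) lo , hi
  ∈-sieving (suc i) j | inj₂ k with ∈-sieving i k
  ...   | pr , lo , hi = pr , lo , <-≤-trans hi (^-monoʳ-≤ 2 (≤-trans (m≤m+n (scale i) (scale i)) (≤-reflexive (sym (scale-suc i)))))

  ∈-sieving⁺ : ∀ i {p} → Prime p → 2 ^ w ≤ p → p < 2 ^ scale i → p ∈ sieving i
  ∈-sieving⁺ zero {p} pr lo hi = contradiction lo (<⇒≱ (subst (λ e → p < 2 ^ e) (*-identityʳ w) hi))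
  ∈-sieving⁺ (suc i) {p} pr lo hi with p <? 2 ^ scale i
  ... | yes lt = ∈-++⁺ʳ (block i) (∈-sieving⁺ i pr lo lt)
  ... | no ge = ∈-++⁺ˡ (∈-range⁺ (scale i) pr (≮⇒≥ ge) (subst (λ e → p < 2 ^ e) (scale-suc i) hi))

  All-sieving : ∀ i → All Prime (sieving i)
  All-sieving i = All.tabulate (λ j → proj₁ (∈-sieving i j))

  block-disjoint : ∀ i {p} → p ∈ block i → p ∉ sieving i
  block-disjoint i j k = <⇒≱ (proj₂ (proj₂ (∈-sieving i k))) (proj₁ (proj₂ (∈-block i j)))

  sieving-unique : ∀ i → Unique (sieving i)
  sieving-unique zero = []
  sieving-unique (suc i) = Unique.++⁺ (range-unique (scale i) (scale i)) (sieving-unique i) (λ (j , k) → block-disjoint i j k)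

  module _ {x : ℕ → ℚ} (0≼x : ∀ p → 0ℚ ≼ x p) (x≼1 : ∀ {p} → Prime p → x p ≼ 1ℚ) where

    incl-excl-nonneg : ∀ r a l → 0ℚ ≼ incl-excl (suc (double r)) x (range a l)
    incl-excl-nonneg r a l = ≼-trans (survive-nonneg x 0≼x x≼1 (range a l) (All-range a l))
      (survive-≼ x 0≼x x≼1 r (range a l) (All-range a l))

    θ-nonneg : ∀ i r → 0ℚ ≼ θ i r x
    θ-nonneg zero r = 0≼1
    θ-nonneg (suc i) r = 0≼⊗ (incl-excl-nonneg r (scale i) (scale i)) (θ-nonneg i (suc r))

  err-block : ∀ i r l → 4 ≤ scale i → l ≤ length (block i) → err (suc (double r)) l ≤ 2 ^ ((scale i + scale i) * double r)
  err-block i r l h l≤ = ≤-trans (^-monoˡ-≤ (double r) base) (≤-reflexive (^-*-assoc 2 (scale i + scale i) (double r)))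
    where
    open ≤-Reasoning
    a = scale i
    base : suc (l + l) ≤ 2 ^ (a + a)
    base = begin
      suc (l + l) ≤⟨ s≤s (+-mono-≤ l≤ l≤) ⟩
      suc (length (block i) + length (block i)) ≡⟨ cong (λ n → suc (length (block i) + n)) (sym (+-identityʳ (length (block i)))) ⟩
      1 + 2 * length (block i) ≤⟨ +-monoˡ-≤ (2 * length (block i)) (m^n>0 2 a) ⟩
      2 ^ a + 2 * length (block i) ≡⟨ +-comm (2 ^ a) (2 * length (block i)) ⟩
      2 * length (block i) + 2 ^ a ≤⟨ length-range a a h ⟩
      2 ^ (a + a) ∎

  module _ (6≤w : 6 ≤ w) (N X : ℕ) where

    6≤scale : ∀ i → 6 ≤ scale i
    6≤scale i = ≤-trans 6≤w (w≤scale i)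

    θ̂ : ℕ → ℕ → ℚ
    θ̂ i r = θ i r (χ̂ N)

    θ̂-nonneg : ∀ i r → 0ℚ ≼ θ̂ i r
    θ̂-nonneg = θ-nonneg (χ̂-nonneg N) (χ̂≼1 N)

    private
      4≤scale : ∀ i → 4 ≤ scale i
      4≤scale i = ≤-trans (s≤s (s≤s (s≤s (s≤s z≤n)))) (6≤scale i)

      error-≼ : ∀ i r l → l ≤ length (block i) →
        ι (err (suc (double r)) l) ⊗ ι (2 ^ level i (suc r)) ≼ ι (2 ^ level (suc i) r)
      error-≼ i r l h = ≼-trans (⊗-monoʳ (ι-nonneg (2 ^ level i (suc r))) (ι-mono (err-block i r l (4≤scale i) h)))
        (≼-reflexive (sym (trans (cong ι (^-distribˡ-+-* 2 ((scale i + scale i) * double r) (level i (suc r))))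
          (ι-* (2 ^ ((scale i + scale i) * double r)) (2 ^ level i (suc r))))))

    Equi-θ : ∀ i r → Equi X (sieving i) (λ n → θ i r (χ N n)) (θ̂ i r) (ι (2 ^ level i r))
    Equi-θ zero r = Equi-weaken X (≼-reflexive (sym ι1)) (Equi-1 X)
    Equi-θ (suc i) r = Equi-weaken X (error-≼ i r (length (block i)) ≤-refl)
      (Equi-incl-excl N X (suc (double r)) (block i) (ι-nonneg (2 ^ level i (suc r))) (All-sieving (suc i)) (sieving-unique (suc i)) (Equi-θ i (suc r)))

    -- Bounds the mean of the weight over multiples of a sieving prime p, relative to its overall mean.
    leak-at : ∀ {P : Set} → Dec P → ℕ → ℚ → ℚ
    leak-at (yes _) r c = ι 66 ⊗ exp-term (double r)
    leak-at (no _) r c = c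

    leak : ℕ → ℕ → ℕ → ℚ
    leak zero r p = 0ℚ
    leak (suc i) r p = leak-at (2 ^ scale i ≤? p) r (leak i (suc r) p)

    -- Nothing is known about `θ` on classes modulo powers of p, since p is one of its own primes.
    -- But where p hits, `θ` agrees with a weight free of p, for which these moduli are admissible.
    record Masked (i r p : ℕ) : Set where
      field
        support : List ℕ
        weight : ℕ → ℚ
        density : ℚ
        unique : Unique support
        ⊆-sieving : ∀ {q} → q ∈ support → q ∈ sieving i
        ∉-support : p ∉ support
        agree : ∀ n → χ N n p ≡ 1ℚ → θ i r (χ N n) ≡ weight n
        equidistributed : Equi X support weight density (ι (2 ^ level i r))
        density-≼ : density ≼ leak i r p ⊗ θ̂ i r

    open Masked

    block-mass : ∀ r i → 1ℚ ≼ ι 66 ⊗ incl-excl (suc (double r)) (χ̂ N) (block i)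
    block-mass r i = ≼-trans (≼-reflexive (sym (inv-inverse 66))) (⊗-monoˡ (ι-nonneg 66)
      (≼-trans (survive-block N (6≤scale i)) (survive-≼ (χ̂ N) (χ̂-nonneg N) (χ̂≼1 N) r (block i) (All-range (scale i) (scale i)))))

    -- The factor of the block becomes e_2r over its other primes, of mean at most
    -- `exp-term (double r)`. The inequality 1 ≤ 66 F, with F the mean of the factor replaced, turns
    -- this into a bound relative to `θ̂`.
    mask-top : ∀ i r p as bs → block i ≡ as ++ p ∷ bs → Masked (suc i) r p
    mask-top i r p as bs eq = record
      { support = (as ++ bs) ++ sieving i
      ; weight = λ n → esym (double r) (χ N n) (as ++ bs) ⊗ θ i (suc r) (χ N n)
      ; density = esym (double r) (χ̂ N) (as ++ bs) ⊗ θ̂ i (suc r)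
      ; unique = uniq
      ; ⊆-sieving = sub
      ; ∉-support = not-in
      ; agree = λ n h → cong (_⊗ θ i (suc r) (χ N n))
          (trans (cong (incl-excl (suc (double r)) (χ N n)) eq) (incl-excl-hit (χ N n) r as p bs h))
      ; equidistributed = Equi-weaken X (error-≼ i r (length (as ++ bs)) len)
          (Equi-esym N X (double r) (as ++ bs) (ι-nonneg (2 ^ level i (suc r)))
            (All.tabulate (λ j → proj₁ (∈-sieving (suc i) (sub j)))) uniq (Equi-θ i (suc r)))
      ; density-≼ = dens
      }
      where
      p∈ : p ∈ block i
      p∈ = subst (p ∈_) (sym eq) (∈-++⁺ʳ as (here refl))
      sub-block : ∀ {q} → q ∈ as ++ bs → q ∈ block i
      sub-block j with ∈-++⁻ as j
      ... | inj₁ k = subst (_ ∈_) (sym eq) (∈-++⁺ˡ k)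
      ... | inj₂ k = subst (_ ∈_) (sym eq) (∈-++⁺ʳ as (there k))
      sub : ∀ {q} → q ∈ (as ++ bs) ++ sieving i → q ∈ sieving (suc i)
      sub j with ∈-++⁻ (as ++ bs) j
      ... | inj₁ k = ∈-++⁺ˡ (sub-block k)
      ... | inj₂ k = ∈-++⁺ʳ (block i) k
      remove-unique : ∀ as → Unique (as ++ p ∷ bs) → Unique (as ++ bs) × p ∉ as ++ bs
      remove-unique [] (h ∷ u) = u , λ j → All.lookup h j refl
      remove-unique (a ∷ as) (h ∷ u) with remove-unique as u
      ... | u′ , p∉ = (All.tabulate (λ j → All.lookup h (insert j)) ∷ u′) ,
        λ { (here e) → All.lookup h (∈-++⁺ʳ as (here refl)) (sym e) ; (there j) → p∉ j }
        where
        insert : ∀ {q} → q ∈ as ++ bs → q ∈ as ++ p ∷ bs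
        insert j with ∈-++⁻ as j
        ... | inj₁ k = ∈-++⁺ˡ k
        ... | inj₂ k = ∈-++⁺ʳ as (there k)
      removed = remove-unique as (subst Unique eq (range-unique (scale i) (scale i)))
      uniq : Unique ((as ++ bs) ++ sieving i)
      uniq = Unique.++⁺ (proj₁ removed) (sieving-unique i) (λ (j , k) → block-disjoint i (sub-block j) k)
      not-in : p ∉ (as ++ bs) ++ sieving i
      not-in j with ∈-++⁻ (as ++ bs) j
      ... | inj₁ k = proj₂ removed k
      ... | inj₂ k = block-disjoint i p∈ k
      len : length (as ++ bs) ≤ length (block i)
      len = subst₂ _≤_ (sym (length-++ as)) (sym (trans (cong length eq) (length-++ as))) (+-monoʳ-≤ (length as) (n≤1+n (length bs)))
      mass : Σ (as ++ bs) (χ̂ N) ≼ ι 3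
      mass = ≼-trans (≼-by (χ̂ N p) (χ̂-nonneg N p) (trans (cong (λ l → Σ l (χ̂ N)) eq) (trans (Σ-++ as (p ∷ bs))
        (trans (lem (Σ as (χ̂ N)) (χ̂ N p) (Σ bs (χ̂ N))) (cong (_⊕ χ̂ N p) (sym (Σ-++ as bs))))))) (Σ-χ̂-block N (6≤scale i))
        where
        lem : ∀ a p b → a ⊕ (p ⊕ b) ≡ a ⊕ b ⊕ p
        lem = solve-∀ ℚ-ring
      leak≡ : leak (suc i) r p ≡ ι 66 ⊗ exp-term (double r)
      leak≡ with 2 ^ scale i ≤? p
      ... | yes _ = refl
      ... | no q = contradiction (proj₁ (proj₂ (∈-block i p∈))) q
      dens : esym (double r) (χ̂ N) (as ++ bs) ⊗ θ̂ i (suc r) ≼ leak (suc i) r p ⊗ θ̂ (suc i) r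
      dens = ≼-trans (⊗-monoʳ (θ̂-nonneg i (suc r)) (≼-trans (esym-≼ (χ̂-nonneg N) mass (double r))
          (subst (_≼ exp-term (double r) ⊗ (ι 66 ⊗ F)) (ℚ.*-identityʳ (exp-term (double r)))
            (⊗-monoˡ (exp-term-nonneg (double r)) (block-mass r i)))))
        (≼-reflexive (trans (lem (exp-term (double r)) (ι 66) F (θ̂ i (suc r))) (cong (_⊗ (F ⊗ θ̂ i (suc r))) (sym leak≡))))
        where
        F = incl-excl (suc (double r)) (χ̂ N) (block i)
        lem : ∀ e s f t → e ⊗ (s ⊗ f) ⊗ t ≡ s ⊗ e ⊗ (f ⊗ t)
        lem = solve-∀ ℚ-ring

    mask-below : ∀ i r p → p ∈ sieving i → Masked i (suc r) p → Masked (suc i) r p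
    mask-below i r p p∈ M = record
      { support = block i ++ support M
      ; weight = λ n → incl-excl (suc (double r)) (χ N n) (block i) ⊗ weight M n
      ; density = incl-excl (suc (double r)) (χ̂ N) (block i) ⊗ density M
      ; unique = uniq
      ; ⊆-sieving = sub
      ; ∉-support = not-in
      ; agree = λ n h → cong (incl-excl (suc (double r)) (χ N n) (block i) ⊗_) (agree M n h)
      ; equidistributed = Equi-weaken X (error-≼ i r (length (block i)) ≤-refl)
          (Equi-incl-excl N X (suc (double r)) (block i) (ι-nonneg (2 ^ level i (suc r)))
            (All.tabulate (λ j → proj₁ (∈-sieving (suc i) (sub j)))) uniq (equidistributed M))
      ; density-≼ = ≼-trans (⊗-monoˡ (incl-excl-nonneg (χ̂-nonneg N) (χ̂≼1 N) r (scale i) (scale i)) (density-≼ M))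
          (≼-reflexive (trans (lem F (leak i (suc r) p) (θ̂ i (suc r))) (cong (_⊗ (F ⊗ θ̂ i (suc r))) (sym leak≡))))
      }
      where
      F = incl-excl (suc (double r)) (χ̂ N) (block i)
      lem : ∀ f l t → f ⊗ (l ⊗ t) ≡ l ⊗ (f ⊗ t)
      lem = solve-∀ ℚ-ring
      sub : ∀ {q} → q ∈ block i ++ support M → q ∈ sieving (suc i)
      sub j with ∈-++⁻ (block i) j
      ... | inj₁ k = ∈-++⁺ˡ k
      ... | inj₂ k = ∈-++⁺ʳ (block i) (⊆-sieving M k)
      uniq : Unique (block i ++ support M)
      uniq = Unique.++⁺ (range-unique (scale i) (scale i)) (unique M) (λ (j , k) → block-disjoint i j (⊆-sieving M k))
      not-in : p ∉ block i ++ support M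
      not-in j with ∈-++⁻ (block i) j
      ... | inj₁ k = block-disjoint i k p∈
      ... | inj₂ k = ∉-support M k
      leak≡ : leak (suc i) r p ≡ leak i (suc r) p
      leak≡ with 2 ^ scale i ≤? p
      ... | yes q = contradiction q (<⇒≱ (proj₂ (proj₂ (∈-sieving i p∈))))
      ... | no _ = refl

    mask : ∀ i r p → p ∈ sieving i → Masked i r p
    mask (suc i) r p j with ∈-++⁻ (block i) j
    ... | inj₂ k = mask-below i r p k (mask i (suc r) p k)
    ... | inj₁ k with ∈-∃++ k
    ...   | as , bs , eq = mask-top i r p as bs eq

    -- 99 = 66 · 3/2: the constant in the leak of a block times the bound for its Σ 1/(p-1).
    cost : ℕ → ℕ → ℚ
    cost zero r = 0ℚ
    cost (suc i) r = ι 99 ⊗ exp-term (double r) ⊕ cost i (suc r)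

    Σ-leak : ∀ i r → Σ (sieving i) (λ p → inv (pred p) ⊗ leak i r p) ≼ cost i r
    Σ-leak zero r = ≼-refl
    Σ-leak (suc i) r = ≼-trans (≼-reflexive (Σ-++ (block i) (sieving i))) (⊕-mono top below)
      where
      top-leak : ∀ {p} → p ∈ block i → leak (suc i) r p ≡ ι 66 ⊗ exp-term (double r)
      top-leak {p} j with 2 ^ scale i ≤? p
      ... | yes _ = refl
      ... | no q = contradiction (proj₁ (proj₂ (∈-block i j))) q
      below-leak : ∀ {p} → p ∈ sieving i → leak (suc i) r p ≡ leak i (suc r) p
      below-leak {p} j with 2 ^ scale i ≤? p
      ... | yes q = contradiction q (<⇒≱ (proj₂ (proj₂ (∈-sieving i j))))
      ... | no _ = refl
      top : Σ (block i) (λ p → inv (pred p) ⊗ leak (suc i) r p) ≼ ι 99 ⊗ exp-term (double r)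
      top = ≼-trans (≼-reflexive (trans (Σ-cong (block i) (λ {p} j → cong (inv (pred p) ⊗_) (top-leak j)))
          (Σ-⊗ʳ (block i) (ι 66 ⊗ exp-term (double r)))))
        (≼-trans (⊗-monoʳ (0≼⊗ (ι-nonneg 66) (exp-term-nonneg (double r))) (Σ-range-block (6≤scale i)))
          (≼-reflexive (trans (sym (ℚ.*-assoc (ι 3 ⊗ inv 2) (ι 66) (exp-term (double r)))) (cong (_⊗ exp-term (double r)) num))))
        where
        lem : ∀ a v b c → a ⊗ v ⊗ (b ⊗ c) ≡ a ⊗ c ⊗ (b ⊗ v)
        lem = solve-∀ ℚ-ring
        num : ι 3 ⊗ inv 2 ⊗ ι 66 ≡ ι 99
        num = trans (cong (ι 3 ⊗ inv 2 ⊗_) (ι-* 2 33)) (trans (lem (ι 3) (inv 2) (ι 2) (ι 33))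
          (trans (cong (ι 3 ⊗ ι 33 ⊗_) (inv-inverse 2)) (trans (ℚ.*-identityʳ (ι 3 ⊗ ι 33)) (sym (ι-* 3 33)))))
      below : Σ (sieving i) (λ p → inv (pred p) ⊗ leak (suc i) r p) ≼ cost i (suc r)
      below = ≼-trans (≼-reflexive (Σ-cong (sieving i) (λ {p} j → cong (inv (pred p) ⊗_) (below-leak j)))) (Σ-leak i (suc r))

    -- Crude but sufficient: 66^i is only a fixed power of 2^i, whereas the errors are exponential
    -- in w 2^i.
    θ̂-lower : ∀ i r → 1ℚ ≼ ι (66 ^ i) ⊗ θ̂ i r
    θ̂-lower zero r = ≼-reflexive (sym (trans (cong (_⊗ 1ℚ) ι1) (ℚ.*-identityˡ 1ℚ)))
    θ̂-lower (suc i) r = ≼-trans (≼-reflexive (sym (ℚ.*-identityˡ 1ℚ)))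
      (≼-trans (⊗-mono 0≼1 (0≼⊗ (ι-nonneg 66) (incl-excl-nonneg (χ̂-nonneg N) (χ̂≼1 N) r (scale i) (scale i))) (block-mass r i) (θ̂-lower i (suc r)))
        (≼-reflexive (trans (lem (ι 66) F (ι (66 ^ i)) (θ̂ i (suc r))) (cong (_⊗ (F ⊗ θ̂ i (suc r))) (sym (ι-* 66 (66 ^ i)))))))
      where
      F = incl-excl (suc (double r)) (χ̂ N) (block i)
      lem : ∀ s f t u → s ⊗ f ⊗ (t ⊗ u) ≡ s ⊗ t ⊗ (f ⊗ u)
      lem = solve-∀ ℚ-ring

-- Total leak of the sieving primes

exp-term-closed : ∀ t → exp-term t ≡ ι (3 ^ t) ⊗ inv (t !)
exp-term-closed zero = sym (inv-inverse 1)
exp-term-closed (suc t) = begin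
  ι 3 ⊗ inv (suc t) ⊗ exp-term t ≡⟨ cong (ι 3 ⊗ inv (suc t) ⊗_) (exp-term-closed t) ⟩
  ι 3 ⊗ inv (suc t) ⊗ (ι (3 ^ t) ⊗ inv (t !)) ≡⟨ lem (ι 3) (inv (suc t)) (ι (3 ^ t)) (inv (t !)) ⟩
  ι 3 ⊗ ι (3 ^ t) ⊗ (inv (suc t) ⊗ inv (t !)) ≡⟨ cong₂ _⊗_ (sym (ι-* 3 (3 ^ t))) (sym (inv-* (suc t) (t !) {{_}} {{t !≢0}})) ⟩
  ι (3 ^ suc t) ⊗ inv (suc t !) ∎
  where
  open ≡-Reasoning
  lem : ∀ a b c d → a ⊗ b ⊗ (c ⊗ d) ≡ a ⊗ c ⊗ (b ⊗ d)
  lem = solve-∀ ℚ-ring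

double-≥ : ∀ {r} → 6 ≤ r → 12 ≤ double r
double-≥ = mono {6}
  where
  mono : ∀ {a b} → a ≤ b → double a ≤ double b
  mono z≤n = z≤n
  mono (s≤s h) = s≤s (s≤s (mono h))

-- For 2r ≥ 12 each of the two new factors is at most 3/13, and 16 · 9 = 144 ≤ 169.
exp-term-decay : ∀ {r} → 6 ≤ r → ι 16 ⊗ exp-term (double (suc r)) ≼ exp-term (double r)
exp-term-decay {r} h = ≼-trans (≼-reflexive (lem (ι 16) (ι 3) (inv (suc (suc (double r)))) (inv (suc (double r))) (exp-term (double r))))
  (≼-trans (⊗-monoʳ (exp-term-nonneg (double r)) factor) (≼-reflexive (ℚ.*-identityˡ (exp-term (double r)))))
  where
  lem : ∀ s t u v e → s ⊗ (t ⊗ u ⊗ (t ⊗ v ⊗ e)) ≡ s ⊗ (t ⊗ t) ⊗ (u ⊗ v) ⊗ e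
  lem = solve-∀ ℚ-ring
  12≤ = double-≥ h
  i₁ : inv (suc (double r)) ≼ inv 13
  i₁ = inv-anti (s≤s 12≤)
  i₂ : inv (suc (suc (double r))) ≼ inv 13
  i₂ = inv-anti (m≤n⇒m≤1+n (s≤s 12≤))
  factor : ι 16 ⊗ (ι 3 ⊗ ι 3) ⊗ (inv (suc (suc (double r))) ⊗ inv (suc (double r))) ≼ 1ℚ
  factor = ≼-trans (⊗-monoˡ (0≼⊗ (ι-nonneg 16) (0≼⊗ (ι-nonneg 3) (ι-nonneg 3)))
      (⊗-mono (inv-nonneg (suc (double r))) (inv-nonneg 13) i₂ i₁))
    (≼-trans (≼-reflexive (cong₂ _⊗_ (trans (cong (ι 16 ⊗_) (sym (ι-* 3 3))) (sym (ι-* 16 9))) (sym (inv-* 13 13))))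
      (≼-trans (frac-decide 144 1 169 1 _) (≼-reflexive (inv-inverse 1))))

module _ (w : ℕ) (6≤w : 6 ≤ w) (N X : ℕ) where

  -- A geometric series of ratio 1/16 sums to at most 16/15 of its first term, and 1584 = 99 · 16.
  cost-geometric : ∀ i r → 6 ≤ r → ι 15 ⊗ cost w 6≤w N X i r ≼ ι 1584 ⊗ exp-term (double r)
  cost-geometric zero r h = ≼-trans (≼-reflexive (ℚ.*-zeroʳ (ι 15))) (0≼⊗ (ι-nonneg 1584) (exp-term-nonneg (double r)))
  cost-geometric (suc i) r h = ≼-trans (≼-reflexive (ℚ.*-distribˡ-+ (ι 15) (ι 99 ⊗ exp-term (double r)) (cost w 6≤w N X i (suc r))))
    (≼-trans (⊕-mono (≼-refl {ι 15 ⊗ (ι 99 ⊗ exp-term (double r))}) (≼-trans (cost-geometric i (suc r) (m≤n⇒m≤1+n h))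
        (≼-trans (≼-reflexive (trans (cong (_⊗ exp-term (double (suc r))) (ι-* 99 16)) (ℚ.*-assoc (ι 99) (ι 16) (exp-term (double (suc r))))))
          (⊗-monoˡ (ι-nonneg 99) (exp-term-decay h)))))
      (≼-reflexive (trans (lem (ι 15) (ι 99) (exp-term (double r)))
        (cong (_⊗ exp-term (double r)) (trans (cong (λ z → z ⊗ ι 99) (trans (cong (ι 15 ⊕_) (sym ι1)) (sym (ι-+ 15 1)))) (sym (ι-* 16 99)))))))
    where
    lem : ∀ a b e → a ⊗ (b ⊗ e) ⊕ b ⊗ e ≡ (a ⊕ 1ℚ) ⊗ b ⊗ e
    lem = solve-∀ ℚ-ring

  -- Here the initial r = 6 of the top block pays off: 3^12 / 12! ≤ 1/900, and 1584 / (15 · 900) ≤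
  -- 1/8.
  cost-≼ : ∀ i → cost w 6≤w N X i 6 ≼ inv 8
  cost-≼ i = ≼-trans (≼-reflexive (sym (trans (sym (ℚ.*-assoc (inv 15) (ι 15) c)) (trans (cong (_⊗ c)
      (trans (ℚ.*-comm (inv 15) (ι 15)) (inv-inverse 15))) (ℚ.*-identityˡ c)))))
    (≼-trans (⊗-monoˡ (inv-nonneg 15) (cost-geometric i 6 ≤-refl))
    (≼-trans (⊗-monoˡ (inv-nonneg 15) (⊗-monoˡ (ι-nonneg 1584) (≼-trans (≼-reflexive (exp-term-closed 12))
      (frac-decide (3 ^ 12) 1 (12 !) 900 _))))
    (≼-trans (≼-reflexive (trans (lem (inv 15) (ι 1584) (ι 1) (inv 900)) (cong₂ _⊗_ (sym (ι-* 1584 1)) (sym (inv-* 15 900)))))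
      (≼-trans (frac-decide (1584 * 1) 1 (15 * 900) 8 _) (≼-reflexive (trans (cong (_⊗ inv 8) ι1) (ℚ.*-identityˡ (inv 8))))))))
    where
    c = cost w 6≤w N X i 6
    lem : ∀ v a b u → v ⊗ (a ⊗ (b ⊗ u)) ≡ a ⊗ b ⊗ (v ⊗ u)
    lem = solve-∀ ℚ-ring

-- Prime factors

-- min(L, v_p(n)) for p > 1, n > 0.
val : ℕ → ℕ → ℕ → ℚ
val L p n = Σ (downFrom L) (λ j → δ (p ^ suc j) n)

Σ-downFrom-first : ∀ L (f : ℕ → ℚ) → Σ (downFrom (suc L)) f ≡ f 0 ⊕ Σ (downFrom L) (f ∘ suc)
Σ-downFrom-first zero f = refl
Σ-downFrom-first (suc L) f = trans (cong (f (suc L) ⊕_) (Σ-downFrom-first L f)) (lem (f (suc L)) (f 0) (Σ (downFrom L) (f ∘ suc)))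
  where
  lem : ∀ a b c → a ⊕ (b ⊕ c) ≡ b ⊕ (a ⊕ c)
  lem = solve-∀ ℚ-ring

val-nonneg : ∀ L p n → 0ℚ ≼ val L p n
val-nonneg L p n = Σ-nonneg (downFrom L) (λ {j} _ → 𝟙-nonneg (p ^ suc j ∣? n))

-- Multiplying by p turns p^j ∣ n into p^(j+1) ∣ p n and adds the condition for j = 0, which always
-- holds; hence the additional place in the truncation.
val-multiply : ∀ L p f n .{{_ : NonZero f}} → val L p n ⊕ 𝟙 (p ≟ f) ≼ val (suc L) p (f * n)
val-multiply L p f n with p ≟ f
... | yes refl = ≼-reflexive (begin
  val L p n ⊕ 1ℚ ≡⟨ ℚ.+-comm (val L p n) 1ℚ ⟩
  1ℚ ⊕ val L p n ≡⟨ cong₂ _⊕_ (sym (𝟙-yes (p ^ 1 ∣? p * n) (subst (_∣ p * n) (sym (^-identityʳ p)) (m∣m*n n))))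
    (Σ-cong (downFrom L) (λ {j} _ → 𝟙-⇔ (p ^ suc j ∣? n) (p ^ suc (suc j) ∣? p * n) (*-monoʳ-∣ p) (*-cancelˡ-∣ p))) ⟩
  δ (p ^ 1) (p * n) ⊕ Σ (downFrom L) (λ j → δ (p ^ suc (suc j)) (p * n)) ≡⟨ sym (Σ-downFrom-first L (λ j → δ (p ^ suc j) (p * n))) ⟩
  val (suc L) p (p * n) ∎)
  where open ≡-Reasoning
... | no _ = ≼-trans (≼-reflexive (ℚ.+-identityʳ (val L p n))) (≼-trans (Σ-mono (downFrom L) (λ {j} _ → le j))
  (≼-by _ (𝟙-nonneg (p ^ suc L ∣? f * n)) (ℚ.+-comm (δ (p ^ suc L) (f * n)) (val L p (f * n)))))
  where
  le : ∀ j → δ (p ^ suc j) n ≼ δ (p ^ suc j) (f * n)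
  le j with p ^ suc j ∣? n
  ... | yes d = ≼-reflexive (sym (𝟙-yes (p ^ suc j ∣? f * n) (∣n⇒∣m*n f d)))
  ... | no _ = 𝟙-nonneg (p ^ suc j ∣? f * n)

-- Regroups the list of factors by primes. Truncation at L loses nothing, as no exponent exceeds the
-- number of factors.
Σ-factors : ∀ (ps : List ℕ) {c : ℕ → ℚ} → (∀ p → 0ℚ ≼ c p) → (∀ {p} → Prime p → p ∈ ps ⊎ c p ≡ 0ℚ) →
  ∀ L fs → All Prime fs → length fs ≤ L → Σ fs c ≼ Σ ps (λ p → c p ⊗ val L p (product fs))
Σ-factors ps {c} 0≼c cover L [] _ _ = Σ-nonneg ps (λ {p} _ → 0≼⊗ (0≼c p) (val-nonneg L p 1))
Σ-factors ps {c} 0≼c cover (suc L) (f ∷ fs) (pr ∷ prs) (s≤s h) = ≼-trans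
  (⊕-mono first (Σ-factors ps 0≼c cover L fs prs h))
  (≼-trans (≼-reflexive (sym (Σ-⊕ ps))) (Σ-mono ps (λ {p} _ → ≼-trans
    (≼-reflexive (lem (c p) (𝟙 (p ≟ f)) (val L p (product fs))))
    (⊗-monoˡ (0≼c p) (val-multiply L p f (product fs) {{prime⇒nonZero pr}})))))
  where
  lem : ∀ c i v → c ⊗ i ⊕ c ⊗ v ≡ c ⊗ (v ⊕ i)
  lem = solve-∀ ℚ-ring
  0≼ : ∀ {p} → p ∈ ps → 0ℚ ≼ c p ⊗ 𝟙 (p ≟ f)
  0≼ {p} _ = 0≼⊗ (0≼c p) (𝟙-nonneg (p ≟ f))
  first : c f ≼ Σ ps (λ p → c p ⊗ 𝟙 (p ≟ f))
  first with cover pr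
  ... | inj₁ i = ≼-trans (≼-reflexive (sym (trans (cong (c f ⊗_) (𝟙-yes (f ≟ f) refl)) (ℚ.*-identityʳ (c f))))) (Σ-∈ ps 0≼ i)
  ... | inj₂ e = ≼-trans (≼-reflexive e) (Σ-nonneg ps 0≼)

lg : ℕ → ℕ
lg zero = 0
lg (suc n) = proj₁ (log₂-bounds (suc n))

lg-lower : ∀ n .{{_ : NonZero n}} → 2 ^ lg n ≤ n
lg-lower (suc n) = proj₁ (proj₂ (log₂-bounds (suc n)))

lg-upper : ∀ n → n < 2 ^ suc (lg n)
lg-upper zero = s≤s z≤n
lg-upper (suc n) = proj₂ (proj₂ (log₂-bounds (suc n)))

lg-≥ : ∀ {k} n → 2 ^ k ≤ n → k ≤ lg n
lg-≥ n h = s≤s⁻¹ (2^-cancel-< (≤-<-trans h (lg-upper n)))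

Σ-lg : ∀ fs → All Prime fs → ∃ λ e → Σ fs (ι ∘ lg) ≡ ι e × 2 ^ e ≤ product fs
Σ-lg [] _ = 0 , sym ι0 , ≤-refl
Σ-lg (f ∷ fs) (pr ∷ prs) with Σ-lg fs prs
... | e , eq , le = lg f + e , trans (cong (ι (lg f) ⊕_) eq) (sym (ι-+ (lg f) e)) ,
  ≤-trans (≤-reflexive (^-distribˡ-+-* 2 (lg f) e)) (*-mono-≤ (lg-lower f {{prime⇒nonZero pr}}) le)

module _ (n : ℕ) .{{n≢0 : NonZero n}} where

  private
    fs = factors (factorise n)
    fs-prime = PrimeFactorisation.factorsPrime (factorise n)
    product-fs = PrimeFactorisation.isFactorisation (factorise n)

  2^Ω≤ : 2 ^ Ω n ≤ n
  2^Ω≤ = subst (2 ^ length fs ≤_) (sym product-fs)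
    (^-length≤product fs (All.map (λ {p} pr → nonTrivial⇒n>1 p {{prime⇒nonTrivial pr}}) fs-prime))

  Ω≤ : ∀ {L} → n < 2 ^ suc L → Ω n ≤ L
  Ω≤ h = s≤s⁻¹ (2^-cancel-< (≤-<-trans 2^Ω≤ h))

  -- Every prime factor p contributes z ≤ lg p + (z ∸ lg p), and the lg p add up to at most log₂ n.
  Ω-weighted : ∀ z L (ps : List ℕ) → (∀ {p} → Prime p → p < 2 ^ z → p ∈ ps) → n < 2 ^ suc L →
    ι z ⊗ ι (Ω n) ≼ ι L ⊕ Σ ps (λ p → ι (z ∸ lg p) ⊗ val L p n)
  Ω-weighted z L ps cover n< = ≼-trans split (⊕-mono logs rest)
    where
    split : ι z ⊗ ι (Ω n) ≼ Σ fs (ι ∘ lg) ⊕ Σ fs (λ p → ι (z ∸ lg p))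
    split = ≼-trans (≼-reflexive (trans (ℚ.*-comm (ι z) (ι (Ω n))) (sym (Σ-const fs (ι z)))))
      (≼-trans (Σ-mono fs (λ {p} _ → ≼-trans (ι-mono (m≤n+m∸n z (lg p))) (≼-reflexive (ι-+ (lg p) (z ∸ lg p)))))
        (≼-reflexive (Σ-⊕ fs)))
    logs : Σ fs (ι ∘ lg) ≼ ι L
    logs with Σ-lg fs fs-prime
    ... | e , eq , le = ≼-trans (≼-reflexive eq)
      (ι-mono (s≤s⁻¹ (2^-cancel-< (≤-<-trans (subst (2 ^ e ≤_) (sym product-fs) le) n<))))
    cover′ : ∀ {p} → Prime p → p ∈ ps ⊎ ι (z ∸ lg p) ≡ 0ℚ
    cover′ {p} pr with p <? 2 ^ z
    ... | yes lt = inj₁ (cover pr lt)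
    ... | no ge = inj₂ (trans (cong ι (m≤n⇒m∸n≡0 (lg-≥ p (≮⇒≥ ge)))) ι0)
    rest : Σ fs (λ p → ι (z ∸ lg p)) ≼ Σ ps (λ p → ι (z ∸ lg p) ⊗ val L p n)
    rest = subst (λ m → Σ fs (λ p → ι (z ∸ lg p)) ≼ Σ ps (λ p → ι (z ∸ lg p) ⊗ val L p m)) (sym product-fs)
      (Σ-factors ps (λ p → ι-nonneg (z ∸ lg p)) cover′ L fs fs-prime (Ω≤ n<))

Ω-* : ∀ a b → Ω (suc a * suc b) ≡ Ω (suc a) + Ω (suc b)
Ω-* a b = trans (↭-length (factorisationUnique (factorise (suc a * suc b)) both)) (length-++ (factors fa))
  where
  fa = factorise (suc a)
  fb = factorise (suc b)
  open PrimeFactorisation using (isFactorisation; factorsPrime)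
  both : PrimeFactorisation (suc a * suc b)
  both = record
    { factors = factors fa ++ factors fb
    ; isFactorisation = trans (cong₂ _*_ (isFactorisation fa) (isFactorisation fb)) (sym (product-++ (factors fa) (factors fb)))
    ; factorsPrime = All.++⁺ (factorsPrime fa) (factorsPrime fb)
    }

-- Averaging

geometric : ∀ q .{{_ : NonZero q}} L → Σ (downFrom L) (λ j → inv (suc q ^ suc j)) ⊕ inv (suc q ^ L) ⊗ inv q ≡ inv q
geometric q zero = trans (ℚ.+-identityˡ (inv 1 ⊗ inv q)) (trans (cong (_⊗ inv q) (trans (sym (ℚ.*-identityˡ (inv 1))) (trans (cong (_⊗ inv 1) (sym ι1)) (inv-inverse 1)))) (ℚ.*-identityˡ (inv q)))
geometric q (suc L) = trans (cong (λ a → a ⊕ S ⊕ a ⊗ inv q) (inv-* (suc q) (suc q ^ L) {{_}} {{m^n≢0 (suc q) L}}))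
  (trans (lem (inv (suc q)) (inv (suc q ^ L)) S (inv q)) (trans (cong (λ a → S ⊕ inv (suc q ^ L) ⊗ a) step) (geometric q L)))
  where
  S = Σ (downFrom L) (λ j → inv (suc q ^ suc j))
  lem : ∀ a b s v → a ⊗ b ⊕ s ⊕ a ⊗ b ⊗ v ≡ s ⊕ b ⊗ (a ⊗ (1ℚ ⊕ v))
  lem = solve-∀ ℚ-ring
  lem′ : ∀ a k v → a ⊗ (k ⊗ v ⊕ v) ≡ (1ℚ ⊕ k) ⊗ a ⊗ v
  lem′ = solve-∀ ℚ-ring
  step : inv (suc q) ⊗ (1ℚ ⊕ inv q) ≡ inv q
  step = begin
    inv (suc q) ⊗ (1ℚ ⊕ inv q) ≡⟨ cong (λ a → inv (suc q) ⊗ (a ⊕ inv q)) (sym (inv-inverse q)) ⟩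
    inv (suc q) ⊗ (ι q ⊗ inv q ⊕ inv q) ≡⟨ lem′ (inv (suc q)) (ι q) (inv q) ⟩
    (1ℚ ⊕ ι q) ⊗ inv (suc q) ⊗ inv q ≡⟨ cong (λ a → a ⊗ inv (suc q) ⊗ inv q) (sym (ι-suc q)) ⟩
    ι (suc q) ⊗ inv (suc q) ⊗ inv q ≡⟨ cong (_⊗ inv q) (inv-inverse (suc q)) ⟩
    1ℚ ⊗ inv q ≡⟨ ℚ.*-identityˡ (inv q) ⟩
    inv q ∎
    where open ≡-Reasoning

geometric-≼ : ∀ {p} → Prime p → ∀ L → Σ (downFrom L) (λ j → inv (p ^ suc j)) ≼ inv (pred p)
geometric-≼ {p} pr L with p | nonTrivial⇒n>1 p {{prime⇒nonTrivial pr}}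
... | suc zero | s≤s ()
... | suc q@(suc _) | _ = ≼-by (inv (suc q ^ L) ⊗ inv q) (0≼⊗ (inv-nonneg (suc q ^ L)) (inv-nonneg q)) (sym (geometric q L))

prime-∣-^ : ∀ {q p} k → Prime q → q ∣ p ^ k → q ∣ p
prime-∣-^ zero qr h = contradiction (subst Prime (∣1⇒≡1 h) qr) ¬prime[1]
prime-∣-^ {q} {p} (suc k) qr h with euclidsLemma p (p ^ k) qr h
... | inj₁ d = d
... | inj₂ d = prime-∣-^ k qr d

coprime-^ : ∀ {q p} k → Prime q → Prime p → q ≢ p → Coprime q (p ^ k)
coprime-^ k qr pr q≢p (d∣q , d∣) with prime⇒irreducible qr d∣q
... | inj₁ e = e
... | inj₂ refl with prime⇒irreducible pr (prime-∣-^ k qr d∣)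
...   | inj₁ e = e
...   | inj₂ e = contradiction e q≢p

module Expectation (w : ℕ) (6≤w : 6 ≤ w) (I l L X : ℕ) where

  N = suc X

  Θ : ℕ → ℚ
  Θ n = θ w I 6 (χ N n)

  Θ-nonneg : ∀ n → 0ℚ ≼ Θ n
  Θ-nonneg n = θ-nonneg w (χ-nonneg N n) (λ {p} pr → χ≼1 N n (prime⇒nonZero pr)) I 6

  Θ̂ : ℚ
  Θ̂ = θ̂ w 6≤w N X I 6

  Θ̂≽0 : 0ℚ ≼ Θ̂
  Θ̂≽0 = θ̂-nonneg w 6≤w N X I 6

  D : ℚ
  D = ι (2 ^ level w I 6)

  Θ-equi : Equi X (sieving w I) Θ Θ̂ D
  Θ-equi = Equi-θ w 6≤w N X I 6

  class-sum : ℕ → ℕ → ℚ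
  class-sum m c = Σ (downFrom X) (λ i → δ m (suc i + c) ⊗ Θ (suc i))

  MeanBound : ℕ → ℚ → Set
  MeanBound p κ = ∀ j c → (∀ n → p ^ suc j ∣ n + c → χ N n p ≡ 1ℚ) →
    class-sum (p ^ suc j) c ≼ inv (p ^ suc j) ⊗ ι X ⊗ (κ ⊗ Θ̂) ⊕ D

  mean-free : ∀ {p} → Prime p → p ∉ sieving w I → MeanBound p 1ℚ
  mean-free {p} pr p∉ j c _ = ≼-trans (Near.above (Equi.near Θ-equi (p ^ suc j) c (m^n≢0 p (suc j) {{prime⇒nonZero pr}})
      (λ {q} q∈ → coprime-^ (suc j) (All.lookup (All-sieving w I) q∈) pr (λ { refl → p∉ q∈ }))))
    (≼-reflexive (cong (λ a → inv (p ^ suc j) ⊗ ι X ⊗ a ⊕ D) (sym (ℚ.*-identityˡ Θ̂))))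

  mean-sieved : ∀ {p} → p ∈ sieving w I → MeanBound p (leak w 6≤w N X I 6 p)
  mean-sieved {p} p∈ j c hits = ≼-trans (≼-reflexive (Σ-cong (downFrom X) (λ {i} _ → same i)))
    (≼-trans (Near.above (Equi.near equidistributed (p ^ suc j) c (m^n≢0 p (suc j) {{prime⇒nonZero pr}})
      (λ {q} q∈ → coprime-^ (suc j) (All.lookup (All-sieving w I) (⊆-sieving q∈)) pr (λ { refl → ∉-support q∈ }))))
    (⊕-mono (⊗-monoˡ (0≼⊗ (inv-nonneg (p ^ suc j)) (ι-nonneg X)) density-≼) ≼-refl))
    where
    open Masked (mask w 6≤w N X I 6 p p∈)
    pr : Prime p
    pr = proj₁ (∈-sieving w I p∈)
    same : ∀ i → δ (p ^ suc j) (suc i + c) ⊗ Θ (suc i) ≡ δ (p ^ suc j) (suc i + c) ⊗ weight (suc i)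
    same i with p ^ suc j ∣? (suc i + c)
    ... | yes d = cong (1ℚ ⊗_) (agree (suc i) (hits (suc i) d))
    ... | no _ = trans (ℚ.*-zeroˡ (Θ (suc i))) (sym (ℚ.*-zeroˡ (weight (suc i))))

  module _ (cls : ℕ → ℕ) (hits : ∀ {p} → Prime p → ∀ j n → p ^ suc j ∣ n + cls (p ^ suc j) → χ N n p ≡ 1ℚ) where

    -- The truncated v_p of n when `cls m` is 0, and of N - n when it is (m - 1) N; one argument
    -- thus serves both summands.
    cval : ℕ → ℕ → ℚ
    cval p n = Σ (downFrom L) (λ j → δ (p ^ suc j) (n + cls (p ^ suc j)))

    cval-mean : ∀ {p κ} → Prime p → 0ℚ ≼ κ → MeanBound p κ →
      Σ (downFrom X) (λ i → Θ (suc i) ⊗ cval p (suc i)) ≼ inv (pred p) ⊗ κ ⊗ (ι X ⊗ Θ̂) ⊕ ι L ⊗ D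
    cval-mean {p} {κ} pr 0≼κ mean = begin
      Σ (downFrom X) (λ i → Θ (suc i) ⊗ cval p (suc i))
        ≡⟨ Σ-cong (downFrom X) (λ {i} _ → trans (sym (Σ-⊗ˡ (downFrom L) (Θ (suc i))))
             (Σ-cong (downFrom L) (λ {j} _ → ℚ.*-comm (Θ (suc i)) (δ (p ^ suc j) (suc i + cls (p ^ suc j)))))) ⟩
      Σ (downFrom X) (λ i → Σ (downFrom L) (λ j → δ (p ^ suc j) (suc i + cls (p ^ suc j)) ⊗ Θ (suc i)))
        ≡⟨ Σ-swap (downFrom X) (downFrom L) ⟩
      Σ (downFrom L) (λ j → class-sum (p ^ suc j) (cls (p ^ suc j)))
        ≤⟨ Σ-mono (downFrom L) (λ {j} _ → mean j (cls (p ^ suc j)) (hits pr j)) ⟩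
      Σ (downFrom L) (λ j → inv (p ^ suc j) ⊗ ι X ⊗ (κ ⊗ Θ̂) ⊕ D)
        ≡⟨ Σ-⊕ (downFrom L) ⟩
      Σ (downFrom L) (λ j → inv (p ^ suc j) ⊗ ι X ⊗ (κ ⊗ Θ̂)) ⊕ Σ (downFrom L) (λ _ → D)
        ≡⟨ cong₂ _⊕_ (trans (Σ-cong (downFrom L) (λ {j} _ → ℚ.*-assoc (inv (p ^ suc j)) (ι X) (κ ⊗ Θ̂))) (Σ-⊗ʳ (downFrom L) (ι X ⊗ (κ ⊗ Θ̂))))
             (trans (Σ-const (downFrom L) D) (cong (λ n → ι n ⊗ D) (length-downFrom L))) ⟩
      Σ (downFrom L) (λ j → inv (p ^ suc j)) ⊗ (ι X ⊗ (κ ⊗ Θ̂)) ⊕ ι L ⊗ D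
        ≤⟨ ⊕-mono (⊗-monoʳ (0≼⊗ (ι-nonneg X) (0≼⊗ 0≼κ Θ̂≽0)) (geometric-≼ pr L)) ≼-refl ⟩
      inv (pred p) ⊗ (ι X ⊗ (κ ⊗ Θ̂)) ⊕ ι L ⊗ D
        ≡⟨ cong (_⊕ ι L ⊗ D) (lem (inv (pred p)) (ι X) κ Θ̂) ⟩
      inv (pred p) ⊗ κ ⊗ (ι X ⊗ Θ̂) ⊕ ι L ⊗ D ∎
      where
      open ℚ.≤-Reasoning
      lem : ∀ v x k t → v ⊗ (x ⊗ (k ⊗ t)) ≡ v ⊗ k ⊗ (x ⊗ t)
      lem = solve-∀ ℚ-ring

    weighted-mean : ∀ ps {c κ : ℕ → ℚ} → (∀ p → 0ℚ ≼ c p) → (∀ {p} → p ∈ ps → Prime p × 0ℚ ≼ κ p × MeanBound p (κ p)) →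
      Σ (downFrom X) (λ i → Θ (suc i) ⊗ Σ ps (λ p → c p ⊗ cval p (suc i))) ≼
      Σ ps (λ p → c p ⊗ (inv (pred p) ⊗ κ p)) ⊗ (ι X ⊗ Θ̂) ⊕ Σ ps c ⊗ (ι L ⊗ D)
    weighted-mean ps {c} {κ} 0≼c h = begin
      Σ (downFrom X) (λ i → Θ (suc i) ⊗ Σ ps (λ p → c p ⊗ cval p (suc i)))
        ≡⟨ Σ-cong (downFrom X) (λ {i} _ → trans (sym (Σ-⊗ˡ ps (Θ (suc i)))) (Σ-cong ps (λ {p} _ → lem (Θ (suc i)) (c p) (cval p (suc i))))) ⟩
      Σ (downFrom X) (λ i → Σ ps (λ p → c p ⊗ (Θ (suc i) ⊗ cval p (suc i))))
        ≡⟨ Σ-swap (downFrom X) ps ⟩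
      Σ ps (λ p → Σ (downFrom X) (λ i → c p ⊗ (Θ (suc i) ⊗ cval p (suc i))))
        ≡⟨ Σ-cong ps (λ {p} _ → Σ-⊗ˡ (downFrom X) (c p)) ⟩
      Σ ps (λ p → c p ⊗ Σ (downFrom X) (λ i → Θ (suc i) ⊗ cval p (suc i)))
        ≤⟨ Σ-mono ps (λ {p} p∈ → ⊗-monoˡ (0≼c p) (cval-mean (proj₁ (h p∈)) (proj₁ (proj₂ (h p∈))) (proj₂ (proj₂ (h p∈))))) ⟩
      Σ ps (λ p → c p ⊗ (inv (pred p) ⊗ κ p ⊗ (ι X ⊗ Θ̂) ⊕ ι L ⊗ D))
        ≡⟨ Σ-cong ps (λ {p} _ → lem′ (c p) (inv (pred p) ⊗ κ p) (ι X ⊗ Θ̂) (ι L ⊗ D)) ⟩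
      Σ ps (λ p → c p ⊗ (inv (pred p) ⊗ κ p) ⊗ (ι X ⊗ Θ̂) ⊕ c p ⊗ (ι L ⊗ D))
        ≡⟨ Σ-⊕ ps ⟩
      Σ ps (λ p → c p ⊗ (inv (pred p) ⊗ κ p) ⊗ (ι X ⊗ Θ̂)) ⊕ Σ ps (λ p → c p ⊗ (ι L ⊗ D))
        ≡⟨ cong₂ _⊕_ (Σ-⊗ʳ ps (ι X ⊗ Θ̂)) (Σ-⊗ʳ ps (ι L ⊗ D)) ⟩
      Σ ps (λ p → c p ⊗ (inv (pred p) ⊗ κ p)) ⊗ (ι X ⊗ Θ̂) ⊕ Σ ps c ⊗ (ι L ⊗ D) ∎
      where
      open ℚ.≤-Reasoning
      lem : ∀ t c v → t ⊗ (c ⊗ v) ≡ c ⊗ (t ⊗ v)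
      lem = solve-∀ ℚ-ring
      lem′ : ∀ c k x e → c ⊗ (k ⊗ x ⊕ e) ≡ c ⊗ k ⊗ x ⊕ c ⊗ e
      lem′ = solve-∀ ℚ-ring

  a z : ℕ
  a = scale w I
  z = a + l

  high low primes : List ℕ
  high = range a l
  low = range 0 w
  primes = high ++ (sieving w I ++ low)

  weight-of : ℕ → ℚ
  weight-of p = ι (z ∸ lg p)

  weight-of-nonneg : ∀ p → 0ℚ ≼ weight-of p
  weight-of-nonneg p = ι-nonneg (z ∸ lg p)

  weight-of-≼ : ∀ p → weight-of p ≼ ι z
  weight-of-≼ p = ι-mono (m∸n≤m z (lg p))

  cover : ∀ {p} → Prime p → p < 2 ^ z → p ∈ primes
  cover {p} pr hi with 2 ^ a ≤? p
  ... | yes lo = ∈-++⁺ˡ (∈-range⁺ l pr lo hi)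
  ... | no p<2^a with 2 ^ w ≤? p
  ...   | yes lo = ∈-++⁺ʳ high (∈-++⁺ˡ (∈-sieving⁺ w I pr lo (≰⇒> p<2^a)))
  ...   | no p<2^w = ∈-++⁺ʳ high (∈-++⁺ʳ (sieving w I) (∈-range⁺ w pr (>-nonZero⁻¹ p {{prime⇒nonZero pr}}) (≰⇒> p<2^w)))

  -- The mean of Σ (z ∸ lg p) v_p(n) over the primes below 2^z.
  K-high K-sieved K-low K : ℚ
  K-high = Σ high (λ p → weight-of p ⊗ (inv (pred p) ⊗ 1ℚ))
  K-sieved = Σ (sieving w I) (λ p → weight-of p ⊗ (inv (pred p) ⊗ leak w 6≤w N X I 6 p))
  K-low = Σ low (λ p → weight-of p ⊗ (inv (pred p) ⊗ 1ℚ))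
  K = K-high ⊕ (K-sieved ⊕ K-low)

  W : ℚ
  W = Σ primes weight-of

  leak-nonneg : ∀ i r p → 0ℚ ≼ leak w 6≤w N X i r p
  leak-nonneg zero r p = ≼-refl
  leak-nonneg (suc i) r p with 2 ^ scale w i ≤? p
  ... | yes _ = 0≼⊗ (ι-nonneg 66) (exp-term-nonneg (double r))
  ... | no _ = leak-nonneg i (suc r) p

  high-free : ∀ {p} → p ∈ high → Prime p × 0ℚ ≼ 1ℚ × MeanBound p 1ℚ
  high-free p∈ with ∈-range {a} l p∈
  ... | pr , lo , _ = pr , 0≼1 , mean-free pr (λ i → <⇒≱ (proj₂ (proj₂ (∈-sieving w I i))) lo)

  low-free : ∀ {p} → p ∈ low → Prime p × 0ℚ ≼ 1ℚ × MeanBound p 1ℚ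
  low-free p∈ with ∈-range {0} w p∈
  ... | pr , _ , hi = pr , 0≼1 , mean-free pr (λ i → <⇒≱ hi (proj₁ (proj₂ (∈-sieving w I i))))

  total-mean : ∀ cls (hits : ∀ {p} → Prime p → ∀ j n → p ^ suc j ∣ n + cls (p ^ suc j) → χ N n p ≡ 1ℚ) →
    Σ (downFrom X) (λ i → Θ (suc i) ⊗ Σ primes (λ p → weight-of p ⊗ cval cls hits p (suc i))) ≼
    K ⊗ (ι X ⊗ Θ̂) ⊕ W ⊗ (ι L ⊗ D)
  total-mean cls hits = ≼-trans (≼-reflexive expand)
    (≼-trans (⊕-mono (weighted-mean cls hits high weight-of-nonneg high-free)
      (⊕-mono (weighted-mean cls hits (sieving w I) weight-of-nonneg
        (λ {p} p∈ → All.lookup (All-sieving w I) p∈ , leak-nonneg I 6 p , mean-sieved p∈))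
        (weighted-mean cls hits low weight-of-nonneg low-free)))
    (≼-reflexive (trans (lem K-high K-sieved K-low (ι X ⊗ Θ̂) (Σ high weight-of) (Σ (sieving w I) weight-of) (Σ low weight-of) (ι L ⊗ D))
      (cong (λ v → K ⊗ (ι X ⊗ Θ̂) ⊕ v ⊗ (ι L ⊗ D))
        (sym (trans (Σ-++ high (sieving w I ++ low)) (cong (Σ high weight-of ⊕_) (Σ-++ (sieving w I) low))))))))
    where
    lem : ∀ a b c x d e f y → a ⊗ x ⊕ d ⊗ y ⊕ (b ⊗ x ⊕ e ⊗ y ⊕ (c ⊗ x ⊕ f ⊗ y)) ≡ (a ⊕ (b ⊕ c)) ⊗ x ⊕ (d ⊕ (e ⊕ f)) ⊗ y
    lem = solve-∀ ℚ-ring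
    g : ℕ → ℕ → ℚ
    g i p = weight-of p ⊗ cval cls hits p (suc i)
    part : List ℕ → ℚ
    part ps = Σ (downFrom X) (λ i → Θ (suc i) ⊗ Σ ps (g i))
    split : ∀ ps qs → part (ps ++ qs) ≡ part ps ⊕ part qs
    split ps qs = trans (Σ-cong (downFrom X) (λ {i} _ → trans (cong (Θ (suc i) ⊗_) (Σ-++ ps qs)) (ℚ.*-distribˡ-+ (Θ (suc i)) (Σ ps (g i)) (Σ qs (g i)))))
      (Σ-⊕ (downFrom X))
    expand : part primes ≡ part high ⊕ (part (sieving w I) ⊕ part low)
    expand = trans (split high (sieving w I ++ low)) (cong (part high ⊕_) (split (sieving w I) low))

length-range-≤ : ∀ a l → length (range a l) + 2 ^ a ≤ 2 ^ (a + l)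
length-range-≤ a zero = ≤-reflexive (cong (2 ^_) (sym (+-identityʳ a)))
length-range-≤ a (suc l) = begin
  length (shell (a + l) ++ range a l) + 2 ^ a ≡⟨ cong (_+ 2 ^ a) (length-++ (shell (a + l))) ⟩
  length (shell (a + l)) + length (range a l) + 2 ^ a ≡⟨ +-assoc (length (shell (a + l))) (length (range a l)) (2 ^ a) ⟩
  length (shell (a + l)) + (length (range a l) + 2 ^ a) ≤⟨ +-mono-≤ shell-≤ (length-range-≤ a l) ⟩
  2 ^ (a + l) + 2 ^ (a + l) ≡⟨ sym (2^suc (a + l)) ⟩
  2 ^ suc (a + l) ≡⟨ cong (2 ^_) (sym (+-suc a l)) ⟩
  2 ^ (a + suc l) ∎
  where
  open ≤-Reasoning
  shell-≤ : length (shell (a + l)) ≤ 2 ^ (a + l)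
  shell-≤ = ≤-trans (length-filter prime? (map (2 ^ (a + l) +_) (downFrom (2 ^ (a + l)))))
    (≤-reflexive (trans (length-map (2 ^ (a + l) +_) (downFrom (2 ^ (a + l)))) (length-downFrom (2 ^ (a + l)))))

length-sieving-≤ : ∀ w i → length (sieving w i) + 2 ^ w ≤ 2 ^ scale w i
length-sieving-≤ w zero = ≤-reflexive (cong (2 ^_) (sym (*-identityʳ w)))
length-sieving-≤ w (suc i) = begin
  length (block w i ++ sieving w i) + 2 ^ w ≡⟨ cong (_+ 2 ^ w) (length-++ (block w i)) ⟩
  length (block w i) + length (sieving w i) + 2 ^ w ≡⟨ +-assoc (length (block w i)) (length (sieving w i)) (2 ^ w) ⟩
  length (block w i) + (length (sieving w i) + 2 ^ w) ≤⟨ +-monoʳ-≤ (length (block w i)) (length-sieving-≤ w i) ⟩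
  length (block w i) + 2 ^ scale w i ≤⟨ length-range-≤ (scale w i) (scale w i) ⟩
  2 ^ (scale w i + scale w i) ≡⟨ cong (2 ^_) (sym (scale-suc w i)) ⟩
  2 ^ scale w (suc i) ∎
  where open ≤-Reasoning

halve-≼ : ∀ {a b} → a ⊕ a ≼ b ⊕ b → a ≼ b
halve-≼ {a} {b} h = subst₂ _≼_ (half a) (half b) (⊗-monoˡ (inv-nonneg 2) h)
  where
  lem : ∀ v a → v ⊗ (a ⊕ a) ≡ (1ℚ ⊕ 1ℚ) ⊗ v ⊗ a
  lem = solve-∀ ℚ-ring
  half : ∀ a → inv 2 ⊗ (a ⊕ a) ≡ a
  half a = trans (lem (inv 2) a) (trans (cong (λ t → t ⊗ inv 2 ⊗ a) (sym (trans (ι-suc 1) (cong (1ℚ ⊕_) ι1))))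
    (trans (cong (_⊗ a) (inv-inverse 2)) (ℚ.*-identityˡ a)))

GoodSplit : ℕ → Set
GoodSplit N = ∃₂ λ (x y : ℕ) → N ≡ suc x + suc y × Ω (suc x * suc y) ≤ 21

module Averaging (w : ℕ) (6≤w : 6 ≤ w) (I l L X : ℕ) where

  open Expectation w 6≤w I l L X

  private
    small-class large-class : ℕ → ℕ
    small-class _ = 0
    large-class m = pred m * N

    p∣p^ : ∀ p j → p ∣ p ^ suc j
    p∣p^ p j = m∣m*n (p ^ j)

    small-hits : ∀ {p} → Prime p → ∀ j n → p ^ suc j ∣ n + small-class (p ^ suc j) → χ N n p ≡ 1ℚ
    small-hits {p} pr j n h = χ≡1 N (prime⇒nonZero pr) (inj₁ (∣-trans (p∣p^ p j) (subst (p ^ suc j ∣_) (+-identityʳ n) h)))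

    large-hits : ∀ {p} → Prime p → ∀ j n → p ^ suc j ∣ n + large-class (p ^ suc j) → χ N n p ≡ 1ℚ
    large-hits {p} pr j n h = χ≡1 N (prime⇒nonZero pr) (inj₂
      (∣m+n∣m⇒∣n (subst (p ∣_) eq (∣m∣n⇒∣m+n (∣-trans (p∣p^ p j) h) (m∣m*n N))) (∣-trans (p∣p^ p j) (m∣m*n N))))
      where
      m = p ^ suc j
      lem : ∀ n m p N → n + m * N + suc p * N ≡ suc m * N + (n + p * N)
      lem = ℕ-Solver.solve-∀
      eq : n + pred m * N + p * N ≡ m * N + (n + pred p * N)
      eq = subst₂ (λ m′ p′ → n + pred m * N + p′ * N ≡ m′ * N + (n + pred p * N))
        (suc-pred m {{m^n≢0 p (suc j) {{prime⇒nonZero pr}}}}) (suc-pred p {{prime⇒nonZero pr}}) (lem n (pred m) (pred p) N)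

    complement-∣ : ∀ {m n b} .{{_ : NonZero m}} → n + b ≡ N → δ m b ≡ δ m (n + pred m * N)
    complement-∣ {m} {n} {b} eq = 𝟙-⇔ (m ∣? b) (m ∣? (n + pred m * N))
      (λ h → ∣m+n∣m⇒∣n (subst (m ∣_) (sym (trans (+-comm b (n + pred m * N)) total)) (m∣m*n N)) h)
      (λ h → ∣m+n∣m⇒∣n (subst (m ∣_) (sym total) (m∣m*n N)) h)
      where
      lem : ∀ n b m → n + m * (n + b) + b ≡ suc m * (n + b)
      lem = ℕ-Solver.solve-∀
      total : n + pred m * N + b ≡ m * N
      total = trans (cong (λ M → n + pred m * M + b) (sym eq)) (trans (lem n b (pred m)) (cong₂ _*_ (suc-pred m) eq))

    tally : (cls : ℕ → ℕ) (hits : ∀ {p} → Prime p → ∀ j n → p ^ suc j ∣ n + cls (p ^ suc j) → χ N n p ≡ 1ℚ) → ℕ → ℚ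
    tally cls hits n = Σ primes (λ p → weight-of p ⊗ cval cls hits p n)

    primes-prime : ∀ {p} → p ∈ primes → Prime p
    primes-prime i with ∈-++⁻ high i
    ... | inj₁ j = proj₁ (∈-range {a} l j)
    ... | inj₂ j with ∈-++⁻ (sieving w I) j
    ...   | inj₁ k = All.lookup (All-sieving w I) k
    ...   | inj₂ k = proj₁ (∈-range {0} w k)

    -- `M` is the actual total weight and `Y` the predicted one.
    M Y E : ℚ
    M = Σ (downFrom X) (λ i → Θ (suc i))
    Y = ι X ⊗ Θ̂
    E = ι L ⊗ D

    Y≼M : Y ≼ M ⊕ D
    Y≼M = subst₂ (λ x y → x ≼ y ⊕ D)
      (cong (_⊗ Θ̂) (trans (cong (_⊗ ι X) inv1) (ℚ.*-identityˡ (ι X))))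
      (Σ-cong (downFrom X) (λ {i} _ → trans (cong (_⊗ Θ (suc i)) (𝟙-yes (1 ∣? (suc i + 0)) (1∣ _))) (ℚ.*-identityˡ (Θ (suc i)))))
      (Near.below (Equi.near Θ-equi 1 0 _ (λ _ → λ (_ , d) → ∣1⇒≡1 d)))
      where
      inv1 : inv 1 ≡ 1ℚ
      inv1 = trans (sym (ℚ.*-identityˡ (inv 1))) (trans (cong (_⊗ inv 1) (sym ι1)) (inv-inverse 1))

  -- If every split is bad, z (Ω(n) + Ω(N - n)) ≥ 22 z for all n. Weighting by Θ and summing bounds
  -- both summands by the same quantity, so the inequality can be halved.
  average : N < 2 ^ suc L → (∀ x y → suc x + suc y ≡ N → 22 ≤ Ω (suc x) + Ω (suc y)) →
    ι (11 * z) ⊗ M ≼ ι L ⊗ M ⊕ (K ⊗ Y ⊕ W ⊗ E)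
  average N< bad = halve-≼ (begin
    ι (11 * z) ⊗ M ⊕ ι (11 * z) ⊗ M ≡⟨ trans (sym (ℚ.*-distribʳ-+ M (ι (11 * z)) (ι (11 * z)))) (cong (_⊗ M) (sym (ι-+ (11 * z) (11 * z)))) ⟩
    ι (11 * z + 11 * z) ⊗ M ≡⟨ trans (sym (Σ-⊗ˡ (downFrom X) (ι (11 * z + 11 * z)))) (Σ-cong (downFrom X) (λ {i} _ → ℚ.*-comm (ι (11 * z + 11 * z)) (Θ (suc i)))) ⟩
    Σ (downFrom X) (λ i → Θ (suc i) ⊗ ι (11 * z + 11 * z)) ≤⟨ Σ-mono (downFrom X) (λ {i} i∈ → ⊗-monoˡ (Θ-nonneg (suc i)) (pointwise i (∈-downFrom⁻ i∈))) ⟩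
    Σ (downFrom X) (λ i → Θ (suc i) ⊗ (ι L ⊕ T₁ (suc i) ⊕ (ι L ⊕ T₂ (suc i))))
      ≡⟨ trans (Σ-cong (downFrom X) (λ {i} _ → lem (Θ (suc i)) (ι L) (T₁ (suc i)) (T₂ (suc i))))
           (trans (Σ-⊕ (downFrom X)) (cong₂ _⊕_ (trans (Σ-⊕ (downFrom X)) (cong (λ s → s ⊕ s) (Σ-⊗ˡ (downFrom X) (ι L)))) (Σ-⊕ (downFrom X)))) ⟩
    ι L ⊗ M ⊕ ι L ⊗ M ⊕ (Σ (downFrom X) (λ i → Θ (suc i) ⊗ T₁ (suc i)) ⊕ Σ (downFrom X) (λ i → Θ (suc i) ⊗ T₂ (suc i)))
      ≤⟨ ⊕-monoʳ (ι L ⊗ M ⊕ ι L ⊗ M) (⊕-mono (total-mean small-class small-hits) (total-mean large-class large-hits)) ⟩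
    ι L ⊗ M ⊕ ι L ⊗ M ⊕ (K ⊗ Y ⊕ W ⊗ E ⊕ (K ⊗ Y ⊕ W ⊗ E)) ≡⟨ lem′ (ι L ⊗ M) (K ⊗ Y ⊕ W ⊗ E) ⟩
    ι L ⊗ M ⊕ (K ⊗ Y ⊕ W ⊗ E) ⊕ (ι L ⊗ M ⊕ (K ⊗ Y ⊕ W ⊗ E)) ∎)
    where
    open ℚ.≤-Reasoning
    T₁ = tally small-class small-hits
    T₂ = tally large-class large-hits
    lem : ∀ t l a b → t ⊗ (l ⊕ a ⊕ (l ⊕ b)) ≡ (l ⊗ t ⊕ l ⊗ t) ⊕ (t ⊗ a ⊕ t ⊗ b)
    lem = solve-∀ ℚ-ring
    lem′ : ∀ a b → a ⊕ a ⊕ (b ⊕ b) ≡ a ⊕ b ⊕ (a ⊕ b)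
    lem′ = solve-∀ ℚ-ring
    lem″ : ∀ z → 11 * z + 11 * z ≡ z * 22
    lem″ = ℕ-Solver.solve-∀
    pointwise : ∀ i → i < X → ι (11 * z + 11 * z) ≼ ι L ⊕ T₁ (suc i) ⊕ (ι L ⊕ T₂ (suc i))
    pointwise i i<X with m≤n⇒∃[o]m+o≡n i<X
    ... | y , eq = ≼-trans (≼-reflexive (trans (cong ι (lem″ z)) (ι-* z 22)))
      (≼-trans (⊗-monoˡ (ι-nonneg z) (ι-mono (bad i y total)))
      (≼-trans (≼-reflexive (trans (cong (ι z ⊗_) (ι-+ (Ω (suc i)) (Ω (suc y)))) (ℚ.*-distribˡ-+ (ι z) (ι (Ω (suc i))) (ι (Ω (suc y))))))
      (⊕-mono
        (≼-trans (Ω-weighted (suc i) z L primes cover (≤-<-trans i≤ N<)) (⊕-monoʳ (ι L) (≼-reflexive (Σ-cong primes (λ {p} _ →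
          cong (weight-of p ⊗_) (Σ-cong (downFrom L) (λ {j} _ → cong (δ (p ^ suc j)) (sym (+-identityʳ (suc i))))))))))
        (≼-trans (Ω-weighted (suc y) z L primes cover (≤-<-trans y≤ N<)) (⊕-monoʳ (ι L) (≼-reflexive (Σ-cong primes (λ {p} p∈ →
          cong (weight-of p ⊗_) (Σ-cong (downFrom L) (λ {j} _ → complement-∣ {n = suc i} {b = suc y} {{m^n≢0 p (suc j) {{prime⇒nonZero (primes-prime p∈)}}}} total))))))))))
      where
      total : suc i + suc y ≡ N
      total = trans (+-suc (suc i) y) (cong suc eq)
      i≤ : suc i ≤ N
      i≤ = ≤-trans (m≤m+n (suc i) (suc y)) (≤-reflexive total)
      y≤ : suc y ≤ N
      y≤ = ≤-trans (m≤n+m (suc y) (suc i)) (≤-reflexive total)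

  K-nonneg : 0ℚ ≼ K
  K-nonneg = 0≼⊕ (part (λ p → weight-of p ⊗ (inv (pred p) ⊗ 1ℚ)) high (λ p → free p))
    (0≼⊕ (part (λ p → weight-of p ⊗ (inv (pred p) ⊗ leak w 6≤w N X I 6 p)) (sieving w I)
        (λ p → 0≼⊗ (weight-of-nonneg p) (0≼⊗ (inv-nonneg (pred p)) (leak-nonneg I 6 p))))
      (part (λ p → weight-of p ⊗ (inv (pred p) ⊗ 1ℚ)) low (λ p → free p)))
    where
    free : ∀ p → 0ℚ ≼ weight-of p ⊗ (inv (pred p) ⊗ 1ℚ)
    free p = 0≼⊗ (weight-of-nonneg p) (0≼⊗ (inv-nonneg (pred p)) 0≼1)
    part : ∀ f ps → (∀ p → 0ℚ ≼ f p) → 0ℚ ≼ Σ ps f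
    part f ps h = Σ-nonneg ps (λ {p} _ → h p)

  W-≼ : W ≼ ι (z * 2 ^ z)
  W-≼ = ≼-trans (Σ-mono primes (λ {p} _ → weight-of-≼ p)) (≼-trans (≼-reflexive (Σ-const primes (ι z)))
    (≼-trans (≼-reflexive (trans (sym (ι-* (length primes) z)) (cong ι (*-comm (length primes) z)))) (ι-mono (*-monoʳ-≤ z len))))
    where
    open ≤-Reasoning
    len : length primes ≤ 2 ^ z
    len = begin
      length primes ≡⟨ trans (length-++ high) (cong (length high +_) (length-++ (sieving w I))) ⟩
      length high + (length (sieving w I) + length low)
        ≤⟨ +-monoʳ-≤ (length high) (+-monoʳ-≤ (length (sieving w I)) (≤-trans (m≤m+n (length low) 1) (length-range-≤ 0 w))) ⟩
      length high + (length (sieving w I) + 2 ^ w) ≤⟨ +-monoʳ-≤ (length high) (length-sieving-≤ w I) ⟩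
      length high + 2 ^ a ≤⟨ length-range-≤ a l ⟩
      2 ^ z ∎

  -- The slack z/40 leaves a part Y z/40 of the main term that the errors alone would have to cover.
  -- As Θ̂ is at least 66^-I, this bounds X.
  contradiction-bound : .{{_ : NonZero z}} → N < 2 ^ suc L → (∀ x y → suc x + suc y ≡ N → 22 ≤ Ω (suc x) + Ω (suc y)) →
    K ⊕ ι L ⊕ ι z ⊗ inv 40 ≼ ι (11 * z) → X ≤ 40 * (66 ^ I * (2 ^ level w I 6 * (11 + 2 ^ z * L)))
  contradiction-bound N< bad room = *-cancelʳ-≤ X _ z (ι-cancel-≤ (begin
    ι (X * z) ≡⟨ ι-* X z ⟩
    ι X ⊗ ι z ≡⟨ trans (sym (ℚ.*-identityʳ (ι X ⊗ ι z))) (cong (ι X ⊗ ι z ⊗_) (sym (inv-inverse 40))) ⟩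
    ι X ⊗ ι z ⊗ (ι 40 ⊗ inv 40) ≡⟨ sym (ℚ.*-identityˡ _) ⟩
    1ℚ ⊗ (ι X ⊗ ι z ⊗ (ι 40 ⊗ inv 40)) ≤⟨ ⊗-monoʳ (0≼⊗ (0≼⊗ (ι-nonneg X) (ι-nonneg z)) (0≼⊗ (ι-nonneg 40) (inv-nonneg 40))) (θ̂-lower w 6≤w N X I 6) ⟩
    ι (66 ^ I) ⊗ Θ̂ ⊗ (ι X ⊗ ι z ⊗ (ι 40 ⊗ inv 40)) ≡⟨ lem (ι (66 ^ I)) Θ̂ (ι X) (ι z) (ι 40) (inv 40) ⟩
    ι 40 ⊗ ι (66 ^ I) ⊗ (Y ⊗ η) ≤⟨ ⊗-monoˡ (0≼⊗ (ι-nonneg 40) (ι-nonneg (66 ^ I))) squeeze ⟩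
    ι 40 ⊗ ι (66 ^ I) ⊗ (ι (11 * z) ⊗ D ⊕ W ⊗ E) ≤⟨ ⊗-monoˡ (0≼⊗ (ι-nonneg 40) (ι-nonneg (66 ^ I))) (⊕-monoʳ (ι (11 * z) ⊗ D) (⊗-monoʳ (0≼⊗ (ι-nonneg L) (ι-nonneg (2 ^ level w I 6))) W-≼)) ⟩
    ι 40 ⊗ ι (66 ^ I) ⊗ (ι (11 * z) ⊗ D ⊕ ι (z * 2 ^ z) ⊗ E) ≡⟨ numerals ⟩
    ι (40 * (66 ^ I * (2 ^ level w I 6 * (11 + 2 ^ z * L))) * z) ∎))
    where
    open ℚ.≤-Reasoning
    η = ι z ⊗ inv 40
    lem : ∀ s t x z f v → s ⊗ t ⊗ (x ⊗ z ⊗ (f ⊗ v)) ≡ f ⊗ s ⊗ (x ⊗ t ⊗ (z ⊗ v))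
    lem = solve-∀ ℚ-ring
    -- The sum of the averaged inequality, 11 z - L times M ≥ Y - D, Y times the inequality `room`,
    -- and L D ≥ 0.
    certificate : ∀ e Y η L M k WE D → e ⊗ D ⊕ WE ≡ Y ⊗ η ⊕
      ((L ⊗ M ⊕ (k ⊗ Y ⊕ WE) ⊖ e ⊗ M) ⊕ (e ⊖ L) ⊗ (M ⊕ D ⊖ Y) ⊕ (Y ⊗ (e ⊖ (k ⊕ L ⊕ η)) ⊕ L ⊗ D))
    certificate = solve-∀ ℚ-ring
    L≼ : ι L ≼ ι (11 * z)
    L≼ = ≼-trans (≼-by (K ⊕ η) (0≼⊕ K-nonneg (0≼⊗ (ι-nonneg z) (inv-nonneg 40))) (lem′ K (ι L) η)) room
      where
      lem′ : ∀ k l e → k ⊕ l ⊕ e ≡ l ⊕ (k ⊕ e)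
      lem′ = solve-∀ ℚ-ring
    squeeze : Y ⊗ η ≼ ι (11 * z) ⊗ D ⊕ W ⊗ E
    squeeze = ≼-by _ (0≼⊕ (0≼⊕ (0≼⊖ (average N< bad)) (0≼⊗ (0≼⊖ L≼) (0≼⊖ Y≼M)))
        (0≼⊕ (0≼⊗ (0≼⊗ (ι-nonneg X) Θ̂≽0) (0≼⊖ room)) (0≼⊗ (ι-nonneg L) (ι-nonneg (2 ^ level w I 6)))))
      (certificate (ι (11 * z)) Y η (ι L) M K (W ⊗ E) D)
    numerals : ι 40 ⊗ ι (66 ^ I) ⊗ (ι (11 * z) ⊗ D ⊕ ι (z * 2 ^ z) ⊗ E) ≡ ι (40 * (66 ^ I * (2 ^ level w I 6 * (11 + 2 ^ z * L))) * z)
    numerals = sym (trans (cong ι (lemℕ 40 (66 ^ I) (2 ^ level w I 6) z (2 ^ z) L)) (trans (ι-* (40 * 66 ^ I) _)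
      (cong₂ _⊗_ (ι-* 40 (66 ^ I)) (trans (ι-+ (11 * z * 2 ^ level w I 6) _) (cong₂ _⊕_ (ι-* (11 * z) (2 ^ level w I 6))
        (trans (ι-* (z * 2 ^ z) _) (cong (ι (z * 2 ^ z) ⊗_) (ι-* L (2 ^ level w I 6)))))))))
      where
      lemℕ : ∀ f s d z t L → f * (s * (d * (11 + t * L))) * z ≡ f * s * (11 * z * d + z * t * (L * d))
      lemℕ = ℕ-Solver.solve-∀

  good-split : .{{_ : NonZero z}} → N < 2 ^ suc L → K ⊕ ι L ⊕ ι z ⊗ inv 40 ≼ ι (11 * z) →
    40 * (66 ^ I * (2 ^ level w I 6 * (11 + 2 ^ z * L))) < X → GoodSplit N
  good-split N< room large with anyUpTo? (λ i → Ω (suc i * suc (X ∸ suc i)) ≤? 21) X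
  ... | yes (i , i<X , h) = i , X ∸ suc i , sym (trans (+-suc (suc i) (X ∸ suc i)) (cong suc (m+[n∸m]≡n i<X))) , h
  ... | no none = contradiction large (≤⇒≯ (contradiction-bound N< bad room))
    where
    bad : ∀ x y → suc x + suc y ≡ N → 22 ≤ Ω (suc x) + Ω (suc y)
    bad x y eq with 22 ≤? Ω (suc x) + Ω (suc y)
    ... | yes h = h
    ... | no h = contradiction (x , x<X , subst (λ k → Ω (suc x * suc k) ≤ 21) y≡ (subst (_≤ 21) (sym (Ω-* x y)) (s≤s⁻¹ (≰⇒> h)))) none
      where
      eq′ : suc x + y ≡ X
      eq′ = suc-injective (trans (sym (+-suc (suc x) y)) eq)
      x<X : x < X
      x<X = ≤-trans (m≤m+n (suc x) y) (≤-reflexive eq′)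
      y≡ : y ≡ X ∸ suc x
      y≡ = trans (sym (m+n∸m≡n (suc x) y)) (cong (_∸ suc x) eq′)

-- Numerical estimates

-- `suc (pred (pred p))` is p - 1 in a form that is visibly non-zero.
inv-pred-sum-ceil : ℕ → List ℕ → ℕ
inv-pred-sum-ceil s [] = 0
inv-pred-sum-ceil s (p ∷ ps) = suc (s / suc (pred (pred p))) + inv-pred-sum-ceil s ps

Σ-inv-pred-≼-ceil : ∀ s .{{_ : NonZero s}} ps → All Prime ps → Σ ps (λ p → inv (pred p)) ≼ ι (inv-pred-sum-ceil s ps) ⊗ inv s
Σ-inv-pred-≼-ceil s [] _ = ≼-reflexive (sym (trans (cong (_⊗ inv s) ι0) (ℚ.*-zeroˡ (inv s))))
Σ-inv-pred-≼-ceil s (p ∷ ps) (pr ∷ prs) = ≼-trans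
  (⊕-mono (≼-trans (≼-reflexive (cong inv (sym (suc-pred (pred p) {{>-nonZero (<⇒≤pred (nonTrivial⇒n>1 p {{prime⇒nonTrivial pr}}))}}))))
    (inv-ceil (suc (pred (pred p))) s)) (Σ-inv-pred-≼-ceil s ps prs))
  (≼-reflexive (sym (trans (cong (_⊗ inv s) (ι-+ (suc (s / suc (pred (pred p)))) (inv-pred-sum-ceil s ps)))
    (ℚ.*-distribʳ-+ (inv s) (ι (suc (s / suc (pred (pred p))))) (ι (inv-pred-sum-ceil s ps))))))

-- Below 2^6 the primes are listed and summed one by one, which is much sharper than Chebyshev's
-- estimate.
Σ-range-split : ∀ v {f} → Σ (range 0 (v + 6)) f ≡ Σ (range 6 v) f ⊕ Σ (range 0 6) f
Σ-range-split zero {f} = sym (ℚ.+-identityˡ (Σ (range 0 6) f))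
Σ-range-split (suc v) {f} = begin
  Σ (shell (v + 6) ++ range 0 (v + 6)) f ≡⟨ Σ-++ (shell (v + 6)) (range 0 (v + 6)) ⟩
  Σ (shell (v + 6)) f ⊕ Σ (range 0 (v + 6)) f ≡⟨ cong₂ _⊕_ (cong (λ k → Σ (shell k) f) (+-comm v 6)) (Σ-range-split v) ⟩
  Σ (shell (6 + v)) f ⊕ (Σ (range 6 v) f ⊕ Σ (range 0 6) f) ≡⟨ sym (ℚ.+-assoc (Σ (shell (6 + v)) f) (Σ (range 6 v) f) (Σ (range 0 6) f)) ⟩
  Σ (shell (6 + v)) f ⊕ Σ (range 6 v) f ⊕ Σ (range 0 6) f ≡⟨ cong (_⊕ Σ (range 0 6) f) (sym (Σ-++ (shell (6 + v)) (range 6 v))) ⟩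
  Σ (range 6 (suc v)) f ⊕ Σ (range 0 6) f ∎
  where open ≡-Reasoning

inv-ceil-decide : ∀ k n s .{{_ : NonZero k}} .{{_ : NonZero s}} → True (1 * s ≤? n * k) → inv k ≼ ι n ⊗ inv s
inv-ceil-decide k n s t = ≼-trans (≼-reflexive (sym (trans (cong (_⊗ inv k) ι1) (ℚ.*-identityˡ (inv k))))) (frac-decide 1 n k s t)

-- Abstract, lest Agda unfold these numerals to unary.
abstract
  unit : ℕ
  unit = 10000

  unit≢0 : NonZero unit
  unit≢0 = _

  small-primes : ℕ
  small-primes = inv-pred-sum-ceil unit (range 0 6)

  small-primes-≼ : Σ (range 0 6) (λ p → inv (pred p)) ≼ ι small-primes ⊗ inv unit
  small-primes-≼ = Σ-inv-pred-≼-ceil unit (range 0 6) (All-range 0 6)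

  harm₆ : ℕ → ℕ
  harm₆ = harm-ceil unit 5

  harm₆-≼ : ∀ l → harm 6 l ≼ ι (harm₆ l) ⊗ inv unit
  harm₆-≼ = harm-≼-ceil unit 5

  eighth fortieth : ℕ
  eighth = 1250
  fortieth = 250

  eighth-≼ : inv 8 ≼ ι eighth ⊗ inv unit
  eighth-≼ = inv-ceil-decide 8 eighth unit _

  fortieth-≼ : inv 40 ≼ ι fortieth ⊗ inv unit
  fortieth-≼ = inv-ceil-decide 40 fortieth unit _

-- The mean of Ω(n), in units of 1/unit, apart from the contribution -2l/z of the weights z ∸ lg p: primes
-- below 64, primes in [64, 2^w), unsieved primes above (twice h), then 1/8 for the sieved primes and 1/40 to spare.
budget : ℕ → ℕ → ℕ
budget w h = small-primes + (2 * harm₆ (w ∸ 6) + (2 * h + (eighth + fortieth)))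

abstract
  -- The numerical hypothesis of `Budget.room` for a = w 2^I, l = 14 a, L = 45 (w + 1) 2^I, divided
  -- by 2^I. Here 193 = 11 · 15 + 2 · 14, and 84 = 14 · 6 is the length of the harmonic sum moved
  -- down to a = 6.
  room-scale : ∀ v → v < 6 → 15 * (6 + v) * budget (6 + v) (harm₆ 84) + 45 * (7 + v) * unit ≤ 193 * (6 + v) * unit
  room-scale 0 _ = toWitness {a? = _ ≤? _} _
  room-scale 1 _ = toWitness {a? = _ ≤? _} _
  room-scale 2 _ = toWitness {a? = _ ≤? _} _
  room-scale 3 _ = toWitness {a? = _ ≤? _} _
  room-scale 4 _ = toWitness {a? = _ ≤? _} _
  room-scale 5 _ = toWitness {a? = _ ≤? _} _
  room-scale (suc (suc (suc (suc (suc (suc v)))))) (s≤s (s≤s (s≤s (s≤s (s≤s (s≤s ()))))))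

  -- The same for I = 0 and w = 6, with z = 6 + l: here l = 4 and L = 80, below l = 58 and L = 300.
  room-10 : 10 * budget 6 (harm₆ 4) + 80 * unit ≤ (11 * 10 + 4 * 2) * unit
  room-10 = toWitness {a? = _ ≤? _} _

  room-64 : 64 * budget 6 (harm₆ 58) + 300 * unit ≤ (11 * 64 + 58 * 2) * unit
  room-64 = toWitness {a? = _ ≤? _} _

module Budget (w : ℕ) (6≤w : 6 ≤ w) (I l L X : ℕ) where

  open Expectation w 6≤w I l L X

  private
    6≤a : 6 ≤ a
    6≤a = ≤-trans 6≤w (w≤scale w I)

    2≤a : 2 ≤ a
    2≤a = ≤-trans (s≤s (s≤s z≤n)) 6≤a

    drop-1 : ∀ ps → Σ ps (λ p → weight-of p ⊗ (inv (pred p) ⊗ 1ℚ)) ≡ Σ ps (λ p → weight-of p ⊗ inv (pred p))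
    drop-1 ps = Σ-cong ps (λ {p} _ → cong (weight-of p ⊗_) (ℚ.*-identityʳ (inv (pred p))))

    trivial-weight : ∀ ps (f : ℕ → ℚ) → (∀ p → 0ℚ ≼ f p) → Σ ps (λ p → weight-of p ⊗ f p) ≼ ι z ⊗ Σ ps f
    trivial-weight ps f 0≼f = ≼-trans (Σ-mono ps (λ {p} _ → ⊗-monoʳ (0≼f p) (weight-of-≼ p))) (≼-reflexive (Σ-⊗ˡ ps (ι z)))

  -- The weight z - k times the mass 2/k is 2z/k - 2, so every shell of [2^a, 2^z) saves 2. This is
  -- the source of the term `l * 2` in `room`.
  shell-weighted : ∀ m → m < l → Σ (shell (a + m)) (λ p → weight-of p ⊗ inv (pred p)) ⊕ ι 2 ≼ ι z ⊗ (ι 2 ⊗ inv (a + m))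
  shell-weighted m m<l = ≼-trans (ℚ.+-monoˡ-≤ (ι 2) (≼-trans (Σ-mono (shell k) (λ {p} p∈ → ⊗-monoʳ (inv-nonneg (pred p))
      (ι-mono (∸-monoʳ-≤ z (lg-≥ {k} p (proj₁ (proj₂ (∈-shell {k} p∈))))))))
      (≼-trans (≼-reflexive (Σ-⊗ˡ (shell k) (ι (z ∸ k)))) (⊗-monoˡ (ι-nonneg (z ∸ k)) (Σ-shell {k} (≤-trans 2≤a (m≤m+n a m)))))))
    (≼-reflexive (begin
      ι (z ∸ k) ⊗ (ι 2 ⊗ inv k) ⊕ ι 2 ≡⟨ cong (ι (z ∸ k) ⊗ (ι 2 ⊗ inv k) ⊕_) (sym (trans (cong (ι 2 ⊗_) (inv-inverse k {{k≢0}})) (ℚ.*-identityʳ (ι 2)))) ⟩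
      ι (z ∸ k) ⊗ (ι 2 ⊗ inv k) ⊕ ι 2 ⊗ (ι k ⊗ inv k) ≡⟨ lem (ι (z ∸ k)) (ι 2) (inv k) (ι k) ⟩
      (ι (z ∸ k) ⊕ ι k) ⊗ (ι 2 ⊗ inv k) ≡⟨ cong (_⊗ (ι 2 ⊗ inv k)) (trans (sym (ι-+ (z ∸ k) k)) (cong ι (m∸n+n≡m (+-monoʳ-≤ a (<⇒≤ m<l))))) ⟩
      ι z ⊗ (ι 2 ⊗ inv k) ∎))
    where
    open ≡-Reasoning
    k = a + m
    k≢0 : NonZero k
    k≢0 = >-nonZero (≤-trans (s≤s z≤n) (≤-trans 2≤a (m≤m+n a m)))
    lem : ∀ x t v k → x ⊗ (t ⊗ v) ⊕ t ⊗ (k ⊗ v) ≡ (x ⊕ k) ⊗ (t ⊗ v)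
    lem = solve-∀ ℚ-ring

  high-weighted : ∀ m → m ≤ l → Σ (range a m) (λ p → weight-of p ⊗ inv (pred p)) ⊕ ι (m * 2) ≼ ι z ⊗ (ι 2 ⊗ harm a m)
  high-weighted zero _ = ≼-reflexive (trans (cong (0ℚ ⊕_) ι0) (lem (ι z) (ι 2)))
    where
    lem : ∀ z t → 0ℚ ⊕ 0ℚ ≡ z ⊗ (t ⊗ 0ℚ)
    lem = solve-∀ ℚ-ring
  high-weighted (suc m) m<l = ≼-trans (≼-reflexive (trans
      (cong₂ _⊕_ (Σ-++ (shell (a + m)) (range a m)) (ι-+ 2 (m * 2))) (lem (Σ (shell (a + m)) f) (Σ (range a m) f) (ι 2) (ι (m * 2)))))
    (≼-trans (⊕-mono (shell-weighted m m<l) (high-weighted m (<⇒≤ m<l))) (≼-reflexive (lem′ (ι z) (ι 2) (inv (a + m)) (harm a m))))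
    where
    f = λ p → weight-of p ⊗ inv (pred p)
    lem : ∀ x y t u → x ⊕ y ⊕ (t ⊕ u) ≡ x ⊕ t ⊕ (y ⊕ u)
    lem = solve-∀ ℚ-ring
    lem′ : ∀ z t v h → z ⊗ (t ⊗ v) ⊕ z ⊗ (t ⊗ h) ≡ z ⊗ (t ⊗ (v ⊕ h))
    lem′ = solve-∀ ℚ-ring

  K-sieved-≼ : K-sieved ≼ ι z ⊗ inv 8
  K-sieved-≼ = ≼-trans (trivial-weight (sieving w I) _ (λ p → 0≼⊗ (inv-nonneg (pred p)) (leak-nonneg I 6 p)))
    (⊗-monoˡ (ι-nonneg z) (≼-trans (Σ-leak w 6≤w N X I 6) (cost-≼ w 6≤w N X I)))

  K-low-≼ : K-low ≼ ι z ⊗ (ι 2 ⊗ harm 6 (w ∸ 6) ⊕ Σ (range 0 6) (λ p → inv (pred p)))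
  K-low-≼ = ≼-trans (≼-reflexive (drop-1 low)) (≼-trans (trivial-weight low _ (λ p → inv-nonneg (pred p)))
    (⊗-monoˡ (ι-nonneg z) (≼-trans (≼-reflexive (trans (cong (λ m → Σ (range 0 m) (λ p → inv (pred p))) (sym (m∸n+n≡m 6≤w)))
      (Σ-range-split (w ∸ 6)))) (ℚ.+-monoˡ-≤ (Σ (range 0 6) (λ p → inv (pred p))) (Σ-range 6 (w ∸ 6) (s≤s (s≤s z≤n)))))))

  -- All fractions are rounded up to multiples of 1/unit, which leaves an inequality in ℕ. The
  -- saving 2l is added to both sides and cancelled at the end, so that `high-weighted` applies as
  -- it stands.
  room : ∀ h → harm a l ≼ ι h ⊗ inv unit → z * budget w h + L * unit ≤ (11 * z + l * 2) * unit →
    K ⊕ ι L ⊕ ι z ⊗ inv 40 ≼ ι (11 * z)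
  room h harm≼ num = ≼-by _ (0≼⊖ total) (cancel (ι (11 * z)) K-high K-sieved K-low (ι L) (ι z ⊗ inv 40) (ι (l * 2)))
    where
    open ℚ.≤-Reasoning
    v = inv unit
    c₀ = small-primes
    hw = harm₆ (w ∸ 6)
    instance
      unit≢0′ : NonZero unit
      unit≢0′ = unit≢0
    cancel : ∀ e a b c L η t → e ≡ a ⊕ (b ⊕ c) ⊕ L ⊕ η ⊕ (e ⊕ t ⊖ (a ⊕ t ⊕ (b ⊕ c) ⊕ L ⊕ η))
    cancel = solve-∀ ℚ-ring
    collect : ∀ z L s v h e w c f → z ⊗ (h ⊗ v) ⊕ (z ⊗ (e ⊗ v) ⊕ z ⊗ (w ⊗ v ⊕ c ⊗ v)) ⊕ L ⊗ (s ⊗ v) ⊕ z ⊗ (f ⊗ v) ≡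
      (z ⊗ (c ⊕ (w ⊕ (h ⊕ (e ⊕ f)))) ⊕ L ⊗ s) ⊗ v
    collect = solve-∀ ℚ-ring
    twice : ∀ {x} n → x ≼ ι n ⊗ v → ι 2 ⊗ x ≼ ι (2 * n) ⊗ v
    twice n h = ≼-trans (⊗-monoˡ (ι-nonneg 2) h) (≼-reflexive (trans (sym (ℚ.*-assoc (ι 2) (ι n) v)) (cong (_⊗ v) (sym (ι-* 2 n)))))
    total : K-high ⊕ ι (l * 2) ⊕ (K-sieved ⊕ K-low) ⊕ ι L ⊕ ι z ⊗ inv 40 ≼ ι (11 * z) ⊕ ι (l * 2)
    total = begin
      K-high ⊕ ι (l * 2) ⊕ (K-sieved ⊕ K-low) ⊕ ι L ⊕ ι z ⊗ inv 40
        ≤⟨ ⊕-mono (⊕-mono (⊕-mono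
             (≼-trans (ℚ.+-monoˡ-≤ (ι (l * 2)) (≼-reflexive (drop-1 high))) (≼-trans (high-weighted l ≤-refl) (⊗-monoˡ (ι-nonneg z) (twice h harm≼))))
             (⊕-mono (≼-trans K-sieved-≼ (⊗-monoˡ (ι-nonneg z) eighth-≼))
               (≼-trans K-low-≼ (⊗-monoˡ (ι-nonneg z) (⊕-mono (twice hw (harm₆-≼ (w ∸ 6))) small-primes-≼)))))
             (≼-reflexive (sym (trans (cong (ι L ⊗_) (inv-inverse unit)) (ℚ.*-identityʳ (ι L))))))
             (⊗-monoˡ (ι-nonneg z) fortieth-≼) ⟩
      ι z ⊗ (ι (2 * h) ⊗ v) ⊕ (ι z ⊗ (ι eighth ⊗ v) ⊕ ι z ⊗ (ι (2 * hw) ⊗ v ⊕ ι c₀ ⊗ v)) ⊕ ι L ⊗ (ι unit ⊗ v) ⊕ ι z ⊗ (ι fortieth ⊗ v)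
        ≡⟨ collect (ι z) (ι L) (ι unit) v (ι (2 * h)) (ι eighth) (ι (2 * hw)) (ι c₀) (ι fortieth) ⟩
      (ι z ⊗ (ι c₀ ⊕ (ι (2 * hw) ⊕ (ι (2 * h) ⊕ (ι eighth ⊕ ι fortieth)))) ⊕ ι L ⊗ ι unit) ⊗ v
        ≡⟨ cong (_⊗ v) (sym (trans (ι-+ (z * budget w h) (L * unit)) (cong₂ _⊕_ (trans (ι-* z (budget w h)) (cong (ι z ⊗_)
             (trans (ι-+ c₀ _) (cong (ι c₀ ⊕_) (trans (ι-+ (2 * hw) _) (cong (ι (2 * hw) ⊕_) (trans (ι-+ (2 * h) _) (cong (ι (2 * h) ⊕_) (ι-+ eighth fortieth)))))))))
             (ι-* L unit)))) ⟩
      ι (z * budget w h + L * unit) ⊗ v ≤⟨ ⊗-monoʳ (inv-nonneg unit) (ι-mono num) ⟩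
      ι ((11 * z + l * 2) * unit) ⊗ v ≡⟨ trans (cong (_⊗ v) (ι-* (11 * z + l * 2) unit)) (trans (ℚ.*-assoc (ι (11 * z + l * 2)) (ι unit) v)
           (trans (cong (ι (11 * z + l * 2) ⊗_) (inv-inverse unit)) (ℚ.*-identityʳ (ι (11 * z + l * 2))))) ⟩
      ι (11 * z + l * 2) ≡⟨ ι-+ (11 * z) (l * 2) ⟩
      ι (11 * z) ⊕ ι (l * 2) ∎

-- Choice of parameters

n≤2^n : ∀ n → n ≤ 2 ^ n
n≤2^n zero = z≤n
n≤2^n (suc n) = ≤-trans (+-mono-≤ (m^n>0 2 n) (n≤2^n n)) (≤-reflexive (sym (2^suc n)))

double≡ : ∀ r → double r ≡ r + r
double≡ zero = refl
double≡ (suc r) = cong suc (trans (cong suc (double≡ r)) (sym (+-suc r r)))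

-- As the scale halves while r grows by one, a bound c(r) times the scale needs c(r) = 2r +
-- c(r+1)/2, solved by c(r) = 4r + 4. The term in w starts the induction and later absorbs
-- constants.
level-≤ : ∀ w i r → level w i r + w * (4 * r + 4) ≤ scale w i * (4 * r + 4)
level-≤ w zero r = ≤-reflexive (cong (_* (4 * r + 4)) (sym (*-identityʳ w)))
level-≤ w (suc i) r = begin
  (a + a) * double r + level w i (suc r) + w * (4 * r + 4) ≡⟨ cong (λ d → (a + a) * d + level w i (suc r) + w * (4 * r + 4)) (double≡ r) ⟩
  (a + a) * (r + r) + level w i (suc r) + w * (4 * r + 4)
    ≡⟨ +-assoc ((a + a) * (r + r)) (level w i (suc r)) (w * (4 * r + 4)) ⟩
  (a + a) * (r + r) + (level w i (suc r) + w * (4 * r + 4))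
    ≤⟨ +-monoʳ-≤ ((a + a) * (r + r)) (+-monoʳ-≤ (level w i (suc r)) (*-monoʳ-≤ w (+-monoˡ-≤ 4 (*-monoʳ-≤ 4 (n≤1+n r))))) ⟩
  (a + a) * (r + r) + (level w i (suc r) + w * (4 * suc r + 4)) ≤⟨ +-monoʳ-≤ ((a + a) * (r + r)) (level-≤ w i (suc r)) ⟩
  (a + a) * (r + r) + a * (4 * suc r + 4) ≡⟨ lem a r ⟩
  (a + a) * (4 * r + 4) ≡⟨ cong (_* (4 * r + 4)) (sym (scale-suc w i)) ⟩
  scale w (suc i) * (4 * r + 4) ∎
  where
  open ≤-Reasoning
  a = scale w i
  lem : ∀ a r → (a + a) * (r + r) + a * (4 * suc r + 4) ≡ (a + a) * (4 * r + 4)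
  lem = ℕ-Solver.solve-∀

-- Letting w run from 6 to 11 keeps the gap between successive values of w 2^I down to the factor (w
-- + 1)/w. With w = 6 alone it would be 2, and L / z would be too large.
dyadic : ∀ k → ∃₂ λ I v → v < 6 × (6 + v) * 2 ^ I ≤ 6 + k × 6 + k < (7 + v) * 2 ^ I
dyadic zero = 0 , 0 , s≤s z≤n , ≤-refl , ≤-refl
dyadic (suc k) with dyadic k
... | I , v , v<6 , lo , hi with suc (6 + k) <? (7 + v) * 2 ^ I
...   | yes lt = I , v , v<6 , ≤-trans lo (n≤1+n (6 + k)) , lt
...   | no ge with suc v <? 6
...     | yes v<5 = I , suc v , v<5 , ≮⇒≥ ge , <-≤-trans (s≤s hi) (+-monoˡ-≤ ((7 + v) * 2 ^ I) (m^n>0 2 I))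
...     | no v≥5 = suc I , 0 , s≤s z≤n , ≤-trans (≤-reflexive same) (≮⇒≥ ge) ,
          <-≤-trans (s≤s hi) (≤-trans (+-monoˡ-≤ ((7 + v) * 2 ^ I) (m^n>0 2 I)) (≤-trans (≤-reflexive step) (≤-by (2 ^ I) extra)))
  where
  v≡5 : v ≡ 5
  v≡5 = ≤-antisym (s≤s⁻¹ v<6) (s≤s⁻¹ (≮⇒≥ v≥5))
  lem : ∀ t → 6 * (2 * t) ≡ 12 * t
  lem = ℕ-Solver.solve-∀
  same : 6 * 2 ^ suc I ≡ (7 + v) * 2 ^ I
  same = trans (lem (2 ^ I)) (cong (λ v → (7 + v) * 2 ^ I) (sym v≡5))
  step : 2 ^ I + (7 + v) * 2 ^ I ≡ 13 * 2 ^ I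
  step = cong (λ v → 2 ^ I + (7 + v) * 2 ^ I) v≡5
  lem′ : ∀ t → 7 * (2 * t) ≡ 13 * t + t
  lem′ = ℕ-Solver.solve-∀
  extra : 7 * 2 ^ suc I ≡ 13 * 2 ^ I + 2 ^ I
  extra = lem′ (2 ^ I)

large-case : ∀ X → 2 ^ 270 ≤ suc X → GoodSplit (suc X)
large-case X big with log₂-bounds (suc X)
... | e , lo , hi with m≤n⇒∃[o]m+o≡n 6≤q
  where
  -- 270 = 6 · 45. The scale a will be the largest w 2^I not exceeding e / 45.
  6≤q : 6 ≤ e / 45
  6≤q = *-cancelʳ-< 45 5 (e / 45) (+-cancelˡ-< 45 225 (e / 45 * 45) (begin-strict
    270 ≤⟨ s≤s⁻¹ (2^-cancel-< (≤-<-trans big hi)) ⟩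
    e ≡⟨ m≡m%n+[m/n]*n e 45 ⟩
    e % 45 + e / 45 * 45 <⟨ +-monoˡ-< (e / 45 * 45) (m%n<n e 45) ⟩
    45 + e / 45 * 45 ∎))
    where open ≤-Reasoning
... | k , q≡ with dyadic k
... | I , v , v<6 , loq , hiq = Averaging.good-split w 6≤w I l L X {{z≢0}} N< room′ enough
  where
  w = 6 + v
  6≤w : 6 ≤ w
  6≤w = m≤m+n 6 v
  a = scale w I
  l = 14 * a
  L = 45 * (7 + v) * 2 ^ I
  z = a + l
  6≤a : 6 ≤ a
  6≤a = ≤-trans 6≤w (w≤scale w I)
  z≢0 : NonZero z
  z≢0 = >-nonZero (≤-trans (s≤s z≤n) (≤-trans 6≤a (m≤m+n a l)))
  open ≤-Reasoning
  N< : suc X < 2 ^ suc L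
  N< = <-≤-trans hi (^-monoʳ-≤ 2 (s≤s (begin
    e ≡⟨ m≡m%n+[m/n]*n e 45 ⟩
    e % 45 + e / 45 * 45 ≤⟨ +-monoˡ-≤ (e / 45 * 45) (<⇒≤ (m%n<n e 45)) ⟩
    45 + e / 45 * 45 ≡⟨ cong (λ q → 45 + q * 45) {x = e / 45} {y = 6 + k} (sym q≡) ⟩
    suc (6 + k) * 45 ≤⟨ *-monoˡ-≤ 45 hiq ⟩
    (7 + v) * 2 ^ I * 45 ≡⟨ lem (7 + v) (2 ^ I) ⟩
    L ∎)))
    where
    lem : ∀ x t → x * t * 45 ≡ 45 * x * t
    lem = ℕ-Solver.solve-∀
  room′ = Budget.room w 6≤w I l L X (harm₆ 84)
    (≼-trans (harm-anti 14 6≤a) (harm₆-≼ 84))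
    (begin
      z * b + L * unit ≡⟨ lem w (2 ^ I) b unit (7 + v) ⟩
      (15 * w * b + 45 * (7 + v) * unit) * 2 ^ I ≤⟨ *-monoˡ-≤ (2 ^ I) (room-scale v v<6) ⟩
      193 * w * unit * 2 ^ I ≡⟨ lem′ w (2 ^ I) unit ⟩
      (11 * z + l * 2) * unit ∎)
    where
    b = budget w (harm₆ 84)
    lem : ∀ w t b s x → (w * t + 14 * (w * t)) * b + 45 * x * t * s ≡ (15 * w * b + 45 * x * s) * t
    lem = ℕ-Solver.solve-∀
    lem′ : ∀ w t s → 193 * w * s * t ≡ (11 * (w * t + 14 * (w * t)) + 14 * (w * t) * 2) * s
    lem′ = ℕ-Solver.solve-∀
  lev = level w I 6
  lev≤ : lev + w * 28 ≤ a * 28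
  lev≤ = level-≤ w I 6
  -- Exponents of the bounds 40 ≤ 2^6, 66^I ≤ 2^(7 I), 2^lev, 2^z and 11 + L ≤ 2^(10 + I).
  T = 6 + (7 * I + (lev + (z + (10 + I))))
  2≤2^T : 2 ≤ 2 ^ T
  2≤2^T = ^-monoʳ-≤ 2 {1} {T} (s≤s z≤n)
  -- 540 = 45 · 12 bounds 45 (7 + v), as v ≤ 5.
  L+11 : 11 + L ≤ 2 ^ (10 + I)
  L+11 = begin
    11 + L ≤⟨ +-mono-≤ (m≤m*n 11 (2 ^ I) {{m^n≢0 2 I}}) (*-monoˡ-≤ (2 ^ I) (*-monoʳ-≤ 45 (+-monoʳ-≤ 7 (s≤s⁻¹ v<6)))) ⟩
    11 * 2 ^ I + 540 * 2 ^ I ≡⟨ sym (*-distribʳ-+ (2 ^ I) 11 540) ⟩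
    551 * 2 ^ I ≤⟨ *-monoˡ-≤ (2 ^ I) (toWitness {a? = 551 ≤? 2 ^ 10} _) ⟩
    2 ^ 10 * 2 ^ I ≡⟨ sym (^-distribˡ-+-* 2 10 I) ⟩
    2 ^ (10 + I) ∎
  upper : 40 * (66 ^ I * (2 ^ lev * (11 + 2 ^ z * L))) ≤ 2 ^ T
  upper = begin
    40 * (66 ^ I * (2 ^ lev * (11 + 2 ^ z * L)))
      ≤⟨ *-mono-≤ (toWitness {a? = 40 ≤? 2 ^ 6} _) (*-mono-≤ 66^I (*-monoʳ-≤ (2 ^ lev) inner)) ⟩
    2 ^ 6 * (2 ^ (7 * I) * (2 ^ lev * (2 ^ z * 2 ^ (10 + I))))
      ≡⟨ cong (2 ^ 6 *_) (trans (cong (2 ^ (7 * I) *_) (trans (cong (2 ^ lev *_) (sym (^-distribˡ-+-* 2 z (10 + I))))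
           (sym (^-distribˡ-+-* 2 lev (z + (10 + I)))))) (sym (^-distribˡ-+-* 2 (7 * I) (lev + (z + (10 + I)))))) ⟩
    2 ^ 6 * 2 ^ (7 * I + (lev + (z + (10 + I)))) ≡⟨ sym (^-distribˡ-+-* 2 6 (7 * I + (lev + (z + (10 + I))))) ⟩
    2 ^ T ∎
    where
    66^I : 66 ^ I ≤ 2 ^ (7 * I)
    66^I = ≤-trans (^-monoˡ-≤ I (toWitness {a? = 66 ≤? 2 ^ 7} _)) (≤-reflexive (^-*-assoc 2 7 I))
    inner : 11 + 2 ^ z * L ≤ 2 ^ z * 2 ^ (10 + I)
    inner = ≤-trans (+-monoˡ-≤ (2 ^ z * L) (m≤n*m 11 (2 ^ z) {{m^n≢0 2 z}}))
      (≤-trans (≤-reflexive (sym (*-distribˡ-+ (2 ^ z) 11 L))) (*-monoʳ-≤ (2 ^ z) L+11))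
  -- The level is at most 28 a - 28 w, z is 15 a, and 8 I ≤ 2 a; the constant 17 is paid by 28 w.
  -- The additional 1 provides a second 2^T, which makes the final inequality strict.
  exponent : suc T ≤ 45 * a
  exponent = +-cancelʳ-≤ (w * 28) (suc T) (45 * a) (begin
    suc T + w * 28 ≡⟨ lem I lev a (w * 28) ⟩
    (lev + w * 28) + (15 * a + (17 + 8 * I)) ≤⟨ +-mono-≤ lev≤ (+-monoʳ-≤ (15 * a) (+-mono-≤ 17≤ 8I≤)) ⟩
    a * 28 + (15 * a + (w * 28 + 2 * a)) ≡⟨ lem′ a (w * 28) ⟩
    45 * a + w * 28 ∎)
    where
    lem : ∀ I e a c → suc (6 + (7 * I + (e + (a + 14 * a + (10 + I))))) + c ≡ (e + c) + (15 * a + (17 + 8 * I))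
    lem = ℕ-Solver.solve-∀
    lem′ : ∀ a c → a * 28 + (15 * a + (c + 2 * a)) ≡ 45 * a + c
    lem′ = ℕ-Solver.solve-∀
    17≤ : 17 ≤ w * 28
    17≤ = ≤-trans (toWitness {a? = 17 ≤? 6 * 28} _) (*-monoˡ-≤ 28 6≤w)
    8I≤ : 8 * I ≤ 2 * a
    8I≤ = begin
      8 * I ≤⟨ *-monoˡ-≤ I (toWitness {a? = 8 ≤? 12} _) ⟩
      12 * I ≡⟨ *-assoc 2 6 I ⟩
      2 * (6 * I) ≤⟨ *-monoʳ-≤ 2 (*-mono-≤ 6≤w (n≤2^n I)) ⟩
      2 * a ∎
  2^T : 2 ^ T + 2 ^ T ≤ suc X
  2^T = begin
    2 ^ T + 2 ^ T ≡⟨ sym (2^suc T) ⟩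
    2 ^ suc T ≤⟨ ^-monoʳ-≤ 2 exponent ⟩
    2 ^ (45 * a) ≤⟨ ^-monoʳ-≤ 2 (begin
      45 * a ≤⟨ *-monoʳ-≤ 45 loq ⟩
      45 * (6 + k) ≡⟨ trans (cong (45 *_) q≡) (*-comm 45 (e / 45)) ⟩
      e / 45 * 45 ≤⟨ m≤n+m (e / 45 * 45) (e % 45) ⟩
      e % 45 + e / 45 * 45 ≡⟨ sym (m≡m%n+[m/n]*n e 45) ⟩
      e ∎) ⟩
    2 ^ e ≤⟨ lo ⟩
    suc X ∎
  enough : 40 * (66 ^ I * (2 ^ lev * (11 + 2 ^ z * L))) < X
  enough = ≤-<-trans upper (s≤s⁻¹ (≤-trans (≤-reflexive (+-comm 2 (2 ^ T))) (≤-trans (+-monoʳ-≤ (2 ^ T) 2≤2^T) 2^T)))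

-- With I = 0 there are no sieving blocks and θ = 1.
unsieved-case : ∀ l L lo X →
  (6 + l) * budget 6 (harm₆ l) + L * unit ≤ (11 * (6 + l) + l * 2) * unit →
  True (suc (suc (40 * (11 + 2 ^ (6 + l) * L))) ≤? 2 ^ lo) →
  2 ^ lo ≤ suc X → suc X < 2 ^ suc L → GoodSplit (suc X)
unsieved-case l L lo X fits small big N< = Averaging.good-split 6 ≤-refl 0 l L X N<
  (Budget.room 6 ≤-refl 0 l L X (harm₆ l) (harm₆-≼ l) fits)
  (subst (_< X) (trim (11 + 2 ^ (6 + l) * L)) (s≤s⁻¹ (≤-trans (toWitness small) big)))
  where
  trim : ∀ x → 40 * x ≡ 40 * (1 * (1 * x))
  trim x = cong (40 *_) (sym (trans (*-identityˡ (1 * x)) (*-identityˡ x)))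

theorem2 : (N : ℕ) → 2 ≤ N →
    ∃₂ λ (a b : ℕ) → N ≡ suc a + suc b × Ω (suc a * suc b) ≤ 21
theorem2 (suc (suc n)) (s≤s (s≤s z≤n)) with suc (suc n) <? 2 ^ 22
... | yes N< = 0 , n , refl , Ω≤ (suc 0 * suc n) (subst (_< 2 ^ 22) (sym (+-identityʳ (suc n))) (<-trans (n<1+n (suc n)) N<))
... | no N≥ with suc (suc n) <? 2 ^ 81
-- z = 10 serves up to 2^81 and z = 64 up to 2^301, well past the 2^270 from which the sieve is
-- available.
...   | yes N< = unsieved-case 4 80 22 (suc n) room-10 _ (≮⇒≥ N≥) N<
...   | no N≥′ with suc (suc n) <? 2 ^ 301
...     | yes N< = unsieved-case 58 300 81 (suc n) room-64 _ (≮⇒≥ N≥′) N<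
...     | no N≥″ = large-case (suc n) (≤-trans (^-monoʳ-≤ 2 (toWitness {a? = 270 ≤? 301} _)) (≮⇒≥ N≥″))
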